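{- Let $\mathcal{C}$ be a graph class of structurally bounded expansion. Then $\mathcal{C}$ is strongly flip-flat if and only if there exist a graph class $\mathcal{D}$ of bounded expansion that is uniformly almost-wide and a transduction $\tau$ such that $\mathcal{C}\subseteq\tau(\mathcal{D})$.
   Context: Graphs are finite simple undirected. A graph $H$ is a depth-$r$ shallow minor of $G$ if there are pairwise disjoint connected subgraphs $C_v$ ($v\in V(H)$) of $G$, each of radius at most $r$, such that $uv\in E(H)$ only if some edge of $G$ joins $C_u$ and $C_v$. A class $\mathcal{D}$ has bounded expansion if there is $f:\mathbb{N}\to\mathbb{N}$ such that for every $r$ and every depth-$r$ shallow minor $H$ of a graph in $\mathcal{D}$, $|E(H)|/|V(H)|\le f(r)$. Transductions: for $c\in\mathbb{N}$ and first-order formulas $\delta(x),\varphi(x,y)$ over the signature $\{E,C_1,\dots,C_c\}$ ($E$ the edge relation, $C_i$ unary predicates), the transduction $T_{\delta,\varphi}$ maps a graph $G$ to the set of graphs $H$ for which there is an expansion $G^+$ of $G$ (an arbitrary interpretation of $C_1,\dots,C_c$ on $V(G)$) with $V(H)=\{v: G^+\models\delta(v)\}$ and $E(H)=\{uv: u\ne v\in V(H),\ G^+\models\varphi(u,v)\vee\varphi(v,u)\}$; $T_{\delta,\varphi}(\mathcal{D})=\bigcup_{G\in\mathcal{D}}T_{\delta,\varphi}(G)$. A class $\mathcal{C}$ is of structurally bounded expansion if $\mathcal{C}\subseteq T(\mathcal{D})$ for some transduction $T$ and some class $\mathcal{D}$ of bounded expansion. $B\subseteq V(G)$ is $r$-independent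 in $G$ if its distinct vertices are pairwise at distance $>r$. A flip is a pair $(A,B)$ of vertex subsets; $G\oplus(A,B)$ has edge set $E(G)\,\Delta\,((A\times B)\cup(B\times A))$, and $G\oplus\{F_1,\dots,F_k\}=G\oplus F_1\oplus\cdots\oplus F_k$. $\mathcal{C}$ is strongly flip-flat if there is an integer $s$ such that for every $r\in\mathbb{N}$ there is $N_r:\mathbb{N}\to\mathbb{N}$ such that for all $m$, all $G\in\mathcal{C}$ and all $A\subseteq V(G)$ with $|A|\ge N_r(m)$ there are a set of at most $s$ flips $\mathcal{F}$ and $B\subseteq A$, $|B|\ge m$, $r$-independent in $G\oplus\mathcal{F}$. $\mathcal{D}$ is uniformly almost-wide if there is an integer $s$ such that for every $r$ there is $N_r:\mathbb{N}\to\mathbb{N}$ such that for all $m$, all $G\in\mathcal{D}$ and all $A\subseteq V(G)$ with $|A|\ge N_r(m)$ there are $S\subseteq V(G)$, $|S|\le s$, and $B\subseteq A\setminus S$, $|B|>m$, $r$-independent in $G\setminus S$ (the subgraph induced by $V(G)\setminus S$). -}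

module Defs where

open import Data.Nat using (ℕ; zero; suc; _+_; _*_; _≤_; _<_; _>_; _≥_)
open import Data.Fin using (Fin; zero; suc; toℕ; _≟_)
open import Data.Bool using (Bool; true; false; _∨_; _∧_; not; _xor_; if_then_else_)
open import Data.Maybe using (Maybe; just; nothing)
open import Data.List using (List; []; _∷_; length)
open import Data.Product using (Σ; ∃; ∃-syntax; _×_; _,_)
open import Data.Unit using (⊤)
open import Relation.Nullary using (¬_)
open import Relation.Nullary.Decidable using (⌊_⌋)
open import Relation.Binary.PropositionalEquality using (_≡_; _≢_)

record Graph : Set where
  field
    size    : ℕ
    adj     : Fin size → Fin size → Bool
    adj-sym : ∀ u v → adj u v ≡ adj v u
    adj-irr : ∀ v → adj v v ≡ false
open Graph public

Class : Set₁
Class = Graph → Set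

anyFin : (m : ℕ) → (Fin m → Bool) → Bool
anyFin zero    p = false
anyFin (suc m) p = p zero ∨ anyFin m (λ i → p (suc i))

allFin : (m : ℕ) → (Fin m → Bool) → Bool
allFin zero    p = true
allFin (suc m) p = p zero ∧ allFin m (λ i → p (suc i))

countFin : (m : ℕ) → (Fin m → Bool) → ℕ
countFin zero    p = 0
countFin (suc m) p = (if p zero then 1 else 0) + countFin m (λ i → p (suc i))

Subset : ℕ → Set
Subset n = Fin n → Bool

∣_∣ : {n : ℕ} → Subset n → ℕ
∣_∣ {n} A = countFin n A

_⊆_ : {n : ℕ} → Subset n → Subset n → Set
A ⊆ B = ∀ v → A v ≡ true → B v ≡ true

edgeCount : Graph → ℕ
edgeCount H = countPairs
  where
  countPairs : ℕ
  countPairs = sumFin (size H) (λ u → countFin (size H)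
                 (λ v → ⌊ Data.Nat._<?_ (toℕ u) (toℕ v) ⌋ ∧ adj H u v))
    where
    sumFin : (m : ℕ) → (Fin m → ℕ) → ℕ
    sumFin zero    f = 0
    sumFin (suc m) f = f zero + sumFin m (λ i → f (suc i))

data Walk {n : ℕ} (a : Fin n → Fin n → Bool) (P : Fin n → Set)
          : ℕ → Fin n → Fin n → Set where
  here : ∀ {r x} → Walk a P r x x
  step : ∀ {r x y z} → a x y ≡ true → P y → Walk a P r y z → Walk a P (suc r) x z

IndepIn : {n : ℕ} → (Fin n → Fin n → Bool) → (Fin n → Set) → ℕ → Subset n → Set
IndepIn a P r B = ∀ x y → B x ≡ true → B y ≡ true → x ≢ y → ¬ Walk a P r x y

-- H is a depth-r shallow minor of G.  branch x = just v means x ∈ C_v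
-- (so the C_v are pairwise disjoint); each C_v has a centre from which
-- every vertex of C_v is reachable by a walk of length ≤ r inside C_v
-- (hence C_v is nonempty, connected, of radius ≤ r).
record ShallowMinor (r : ℕ) (H G : Graph) : Set where
  field
    branch    : Fin (size G) → Maybe (Fin (size H))
    center    : Fin (size H) → Fin (size G)
    center-in : ∀ v → branch (center v) ≡ just v
    radius    : ∀ v x → branch x ≡ just v →
                Walk (adj G) (λ y → branch y ≡ just v) r (center v) x
    edges     : ∀ u v → adj H u v ≡ true →
                ∃[ x ] ∃[ y ] (branch x ≡ just u × branch y ≡ just v × adj G x y ≡ true)

-- |E(H)| / |V(H)| ≤ f(r), written multiplicatively
BoundedExpansion : Class → Set
BoundedExpansion D =
  Σ (ℕ → ℕ) λ f → ∀ r (G H : Graph) → D G → ShallowMinor r H G →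
    edgeCount H ≤ f r * size H

data Formula (c : ℕ) : ℕ → Set where
  edge  : ∀ {k} → Fin k → Fin k → Formula c k
  equal : ∀ {k} → Fin k → Fin k → Formula c k
  color : ∀ {k} → Fin c → Fin k → Formula c k
  neg   : ∀ {k} → Formula c k → Formula c k
  or    : ∀ {k} → Formula c k → Formula c k → Formula c k
  and   : ∀ {k} → Formula c k → Formula c k → Formula c k
  ex    : ∀ {k} → Formula c (suc k) → Formula c k
  all   : ∀ {k} → Formula c (suc k) → Formula c k

ext : {A : Set} {k : ℕ} → A → (Fin k → A) → Fin (suc k) → A
ext a ρ zero    = a
ext a ρ (suc i) = ρ i

eval : {c k : ℕ} → (G : Graph) → (Fin c → Fin (size G) → Bool) →
       Formula c k → (Fin k → Fin (size G)) → Bool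
eval G col (edge i j)  ρ = adj G (ρ i) (ρ j)
eval G col (equal i j) ρ = ⌊ ρ i ≟ ρ j ⌋
eval G col (color p i) ρ = col p (ρ i)
eval G col (neg φ)     ρ = not (eval G col φ ρ)
eval G col (or φ ψ)    ρ = eval G col φ ρ ∨ eval G col ψ ρ
eval G col (and φ ψ)   ρ = eval G col φ ρ ∧ eval G col ψ ρ
eval G col (ex φ)      ρ = anyFin (size G) (λ v → eval G col φ (ext v ρ))
eval G col (all φ)     ρ = allFin (size G) (λ v → eval G col φ (ext v ρ))

record Transduction : Set where
  field
    colours : ℕ
    δ       : Formula colours 1
    φ       : Formula colours 2
open Transduction public

empty : {A : Set} → Fin 0 → A
empty ()

-- H ∈ T(G), up to isomorphism: H's vertices are mapped bijectively
-- (injective ι whose image is exactly the δ-vertices) and adjacency of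
-- distinct vertices is φ(u,v) ∨ φ(v,u).
InTrans : Transduction → Graph → Graph → Set
InTrans T G H =
  Σ (Fin (colours T) → Fin (size G) → Bool) λ col →
  Σ (Fin (size H) → Fin (size G)) λ ι →
    (∀ i j → ι i ≡ ι j → i ≡ j) ×
    (∀ i → eval G col (δ T) (λ _ → ι i) ≡ true) ×
    (∀ v → eval G col (δ T) (λ _ → v) ≡ true → ∃[ i ] ι i ≡ v) ×
    (∀ i j → i ≢ j →
       adj H i j ≡ (eval G col (φ T) (ext (ι i) (ext (ι j) empty))
                    ∨ eval G col (φ T) (ext (ι j) (ext (ι i) empty))))

_⊆T[_]_ : Class → Transduction → Class → Set
C ⊆T[ T ] D = ∀ H → C H → ∃[ G ] (D G × InTrans T G H)

StructurallyBoundedExpansion : Class → Set₁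
StructurallyBoundedExpansion C =
  Σ Transduction λ T → Σ Class λ D → BoundedExpansion D × C ⊆T[ T ] D

Flip : ℕ → Set
Flip n = Subset n × Subset n

flipAdj : {n : ℕ} → Flip n → (Fin n → Fin n → Bool) → Fin n → Fin n → Bool
flipAdj (A , B) a x y = a x y xor ((A x ∧ B y) ∨ (B x ∧ A y))

flipsAdj : {n : ℕ} → List (Flip n) → (Fin n → Fin n → Bool) → Fin n → Fin n → Bool
flipsAdj []      a = a
flipsAdj (F ∷ Fs) a = flipsAdj Fs (flipAdj F a)

StronglyFlipFlat : Class → Set
StronglyFlipFlat C =
  Σ ℕ λ s → ∀ (r : ℕ) → Σ (ℕ → ℕ) λ N →
    ∀ (m : ℕ) (G : Graph) → C G → (A : Subset (size G)) → ∣ A ∣ ≥ N m →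
      Σ (List (Flip (size G))) λ F → length F ≤ s ×
      Σ (Subset (size G)) λ B → B ⊆ A × ∣ B ∣ ≥ m ×
        IndepIn (flipsAdj F (adj G)) (λ _ → ⊤) r B

UniformlyAlmostWide : Class → Set
UniformlyAlmostWide D =
  Σ ℕ λ s → ∀ (r : ℕ) → Σ (ℕ → ℕ) λ N →
    ∀ (m : ℕ) (G : Graph) → D G → (A : Subset (size G)) → ∣ A ∣ ≥ N m →
      Σ (Subset (size G)) λ S → ∣ S ∣ ≤ s ×
      Σ (Subset (size G)) λ B →
        (∀ v → B v ≡ true → A v ≡ true × S v ≡ false) × ∣ B ∣ > m ×
        IndepIn (adj G) (λ v → S v ≡ false) r B

{-# OPTIONS --safe #-}
-- Strong flip-flatness from almost-wideness: first-order formulas are local, so after deleting the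
-- few vertices that make a set scattered, adjacency of far vertices in the transduced graph depends
-- only on boundedly many labels, and flipping by these labels leaves only short edges.
--
-- Conversely, let H be transduced from a graph G of bounded expansion.  Small weak reachability sets
-- in G together with locality cover all pairs of vertices of H by boundedly many pieces with tree
-- models of bounded depth.  Replacing the nodes of such a tree, level by level, by the connected
-- components of H flipped by the table of the model yields tree models definable in H.  Joining each
-- vertex to the nodes above it gives a graph from which H is transduced; it has bounded expansion
-- because the components sit in connected subgraphs of G of bounded radius and congestion, and it is
-- almost-wide because it is definable from the flip-flat graph H and its edges are functional.
module Submission where

open import Defs
open import Data.Nat using (ℕ; zero; suc; _+_; _*_; _∸_; _^_; _≤_; _<_; _>_; _≥_; z≤n; s≤s; _≤?_; _<?_; _⊔_)
import Data.Nat.Properties as ℕₚ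
import Data.Nat.Solver as ℕSolver
open import Data.Fin using (Fin; zero; suc; toℕ; fromℕ<; _≟_; combine; remQuot)
import Data.Fin as Fin
import Data.Fin.Properties as Finₚ
open import Data.Bool using (Bool; true; false; _∨_; _∧_; not; _xor_; if_then_else_)
import Data.Bool.Properties
open import Data.Maybe using (Maybe; just; nothing)
import Data.Maybe as Maybe
import Data.Maybe.Properties as Maybeₚ
open import Data.List using (List; []; _∷_; length; _++_; concatMap; map)
import Data.List
import Data.List.Properties as Listₚ
open import Data.List.Relation.Unary.Any using (Any; here; there)
open import Data.List.Membership.Propositional using (_∈_)
import Data.List.Membership.Propositional.Properties as ∈ₚ
open import Data.Product using (Σ; ∃-syntax; _×_; _,_; proj₁; proj₂)
open import Data.Sum using (_⊎_; inj₁; inj₂)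
open import Data.Empty using (⊥; ⊥-elim)
open import Data.Unit using (⊤; tt)
open import Function using (id)
open import Function.Bundles using (_⇔_; mk⇔)
import Relation.Binary
open import Relation.Nullary using (¬_; Dec; yes; no)
open import Relation.Nullary.Decidable using (⌊_⌋)
open import Relation.Binary.PropositionalEquality using (_≡_; _≢_; refl; sym; trans; cong; cong₂; subst; subst₂; module ≡-Reasoning)

-- The obstacle in the second direction is that the tree models live on vertices of G, while flips
-- of H control only what formulas define in H. Connected components are definable once their
-- diameter is bounded, and it is: a long induced path in a flipped graph repeats the type of a
-- crossing between tree nodes, and two crossings of one type force a chord. The same exchange shows
-- that a component is determined by bounded data at its tree node, which gives the bounded
-- congestion. Bounded expansion enters only through orders with small weak reachability, since this
-- property, stated by walks and ranks, passes to intersection graphs of overlapping connected sets.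
-- For almost-wideness the number of deleted vertices may not depend on the distance r. The number
-- of labels given by locality depends only on the formula and on the number of flips or deletions;
-- r merely scales the distance at which the hypothesis is applied. For the same reason all label
-- sets and bounds are computed from the parameters before a graph is given.

∧-elim : ∀ {a b} → a ∧ b ≡ true → a ≡ true × b ≡ true
∧-elim {true} {true} refl = refl , refl

∧-intro : ∀ {a b} → a ≡ true → b ≡ true → a ∧ b ≡ true
∧-intro refl refl = refl

∨-elim : ∀ {a b} → a ∨ b ≡ true → a ≡ true ⊎ b ≡ true
∨-elim {true}  _ = inj₁ refl
∨-elim {false} p = inj₂ p

∨-introˡ : ∀ {a b} → a ≡ true → a ∨ b ≡ true
∨-introˡ refl = refl

∨-introʳ : ∀ {a b} → b ≡ true → a ∨ b ≡ true
∨-introʳ {true}  refl = refl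
∨-introʳ {false} refl = refl

bool-cases : ∀ b → b ≡ true ⊎ b ≡ false
bool-cases true  = inj₁ refl
bool-cases false = inj₂ refl

true≢false : ∀ {b} → b ≡ true → b ≡ false → ⊥
true≢false refl ()

≢true⇒false : ∀ {b} → (b ≡ true → ⊥) → b ≡ false
≢true⇒false {true}  h = ⊥-elim (h refl)
≢true⇒false {false} h = refl

not-true⇒false : ∀ {b} → not b ≡ true → b ≡ false
not-true⇒false {false} _ = refl

not-true : ∀ {b} → b ≡ false → not b ≡ true
not-true refl = refl

iff⇒≡ : ∀ {a b} → (a ≡ true → b ≡ true) → (b ≡ true → a ≡ true) → a ≡ b
iff⇒≡ {true}  {b}     f g = sym (f refl)
iff⇒≡ {false} {true}  f g = g refl
iff⇒≡ {false} {false} f g = refl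

⌊⌋-sound : ∀ {P : Set} (d : Dec P) → ⌊ d ⌋ ≡ true → P
⌊⌋-sound (yes p) _ = p

⌊⌋-complete : ∀ {P : Set} (d : Dec P) → P → ⌊ d ⌋ ≡ true
⌊⌋-complete (yes p) _ = refl
⌊⌋-complete (no ¬p) p = ⊥-elim (¬p p)

⌊⌋-refute : ∀ {P : Set} (d : Dec P) → ⌊ d ⌋ ≡ false → ¬ P
⌊⌋-refute (no ¬p) _ = ¬p

⌊⌋-false : ∀ {P : Set} (d : Dec P) → ¬ P → ⌊ d ⌋ ≡ false
⌊⌋-false d ¬p = ≢true⇒false (λ t → ¬p (⌊⌋-sound d t))

infix 5 _==_
_==_ : ∀ {n} → Fin n → Fin n → Bool
x == y = ⌊ x ≟ y ⌋

==-refl : ∀ {n} (x : Fin n) → (x == x) ≡ true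
==-refl x = ⌊⌋-complete (x ≟ x) refl

==-sound : ∀ {n} {x y : Fin n} → (x == y) ≡ true → x ≡ y
==-sound {x = x} {y} = ⌊⌋-sound (x ≟ y)

-- Search in finite sets

anyFin-elim : ∀ {n} (p : Fin n → Bool) → anyFin n p ≡ true → ∃[ i ] p i ≡ true
anyFin-elim {suc n} p h with ∨-elim {p zero} h
... | inj₁ q = zero , q
... | inj₂ q with anyFin-elim (λ i → p (suc i)) q
...   | i , r = suc i , r

anyFin-intro : ∀ {n} (p : Fin n → Bool) (i : Fin n) → p i ≡ true → anyFin n p ≡ true
anyFin-intro p zero    h = ∨-introˡ h
anyFin-intro p (suc i) h = ∨-introʳ {p zero} (anyFin-intro (λ j → p (suc j)) i h)

allFin-elim : ∀ {n} (p : Fin n → Bool) → allFin n p ≡ true → ∀ i → p i ≡ true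
allFin-elim p h zero    = proj₁ (∧-elim {p zero} h)
allFin-elim p h (suc i) = allFin-elim (λ j → p (suc j)) (proj₂ (∧-elim {p zero} h)) i

allFin-intro : ∀ {n} (p : Fin n → Bool) → (∀ i → p i ≡ true) → allFin n p ≡ true
allFin-intro {zero}  p h = refl
allFin-intro {suc n} p h = ∧-intro (h zero) (allFin-intro (λ j → p (suc j)) (λ i → h (suc i)))

any-cong : ∀ {n} {p q : Fin n → Bool} → (∀ i → p i ≡ q i) → anyFin n p ≡ anyFin n q
any-cong {zero}  h = refl
any-cong {suc n} h = cong₂ _∨_ (h zero) (any-cong (λ i → h (suc i)))

all-cong : ∀ {n} {p q : Fin n → Bool} → (∀ i → p i ≡ q i) → allFin n p ≡ allFin n q
all-cong {zero}  h = refl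
all-cong {suc n} h = cong₂ _∧_ (h zero) (all-cong (λ i → h (suc i)))

-- A choice that depends only on the extension of `p` (`first-cong`); representatives of classes and
-- nodes of trees are picked with it.
first : ∀ {n} → (Fin n → Bool) → Maybe (Fin n)
first {zero}  p = nothing
first {suc n} p = if p zero then just zero else Maybe.map suc (first (λ i → p (suc i)))

first-cong : ∀ {n} {p q : Fin n → Bool} → (∀ i → p i ≡ q i) → first p ≡ first q
first-cong {zero}  h = refl
first-cong {suc n} {p} {q} h rewrite h zero | first-cong {n} (λ i → h (suc i)) = refl

first-sound : ∀ {n} (p : Fin n → Bool) {i} → first p ≡ just i → p i ≡ true
first-sound {suc n} p h with p zero in eq
first-sound {suc n} p refl | true = eq
... | false with first (λ i → p (suc i)) in eq′
first-sound {suc n} p refl | false | just j = first-sound (λ i → p (suc i)) eq′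

first-complete : ∀ {n} (p : Fin n → Bool) i → p i ≡ true → ∃[ j ] first p ≡ just j
first-complete {suc n} p i h with p zero in eq
... | true = zero , refl
first-complete {suc n} p zero h | false = ⊥-elim (true≢false h eq)
first-complete {suc n} p (suc i) h | false with first-complete (λ i → p (suc i)) i h
... | j , e rewrite e = suc j , refl

find : ∀ {n} (p : Fin n → Bool) → (∃[ i ] p i ≡ true) ⊎ (∀ i → p i ≡ false)
find {n} p with first p in eq
... | just i  = inj₁ (i , first-sound p eq)
... | nothing = inj₂ λ i → ≢true⇒false λ t → contra (first-complete p i t)
  where
  contra : ∃[ j ] first p ≡ just j → ⊥
  contra (j , e) with trans (sym eq) e
  ... | ()

find₂ : ∀ {m n} (p : Fin m → Fin n → Bool) →
        (∃[ i ] ∃[ j ] p i j ≡ true) ⊎ (∀ i j → p i j ≡ false)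
find₂ p with find (λ i → anyFin _ (p i))
... | inj₁ (i , h) = inj₁ (i , anyFin-elim (p i) h)
... | inj₂ h       = inj₂ λ i j → ≢true⇒false λ t → true≢false (anyFin-intro (p i) j t) (h i)

argmin : ∀ {n} (f : Fin (suc n) → ℕ) → ∃[ i ] (∀ j → f i ≤ f j)
argmin {zero}  f = zero , λ { zero → ℕₚ.≤-refl }
argmin {suc n} f with argmin (λ i → f (suc i))
... | i , h with f zero ≤? f (suc i)
...   | yes q = zero  , λ { zero → ℕₚ.≤-refl ; (suc j) → ℕₚ.≤-trans q (h j) }
...   | no  q = suc i , λ { zero → ℕₚ.<⇒≤ (ℕₚ.≰⇒> q) ; (suc j) → h j }

argminOn : ∀ {n} (P : Fin n → Bool) (f : Fin n → ℕ) → ∀ x → P x ≡ true →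
           ∃[ i ] (P i ≡ true × (∀ j → P j ≡ true → f i ≤ f j))
argminOn {suc n} P f x px with find (λ i → P (suc i))
argminOn {suc n} P f zero px | inj₂ none =
  zero , px , λ { zero _ → ℕₚ.≤-refl ; (suc j) t → ⊥-elim (true≢false t (none j)) }
argminOn {suc n} P f (suc x) px | inj₂ none = ⊥-elim (true≢false px (none x))
... | inj₁ (y , py) with argminOn (λ i → P (suc i)) (λ i → f (suc i)) y py
...   | i , pi , h with bool-cases (P zero)
...     | inj₂ np = suc i , pi , λ { zero t → ⊥-elim (true≢false t np) ; (suc j) t → h j t }
...     | inj₁ p0 with f zero ≤? f (suc i)
...       | yes q = zero , p0 , λ { zero _ → ℕₚ.≤-refl ; (suc j) t → ℕₚ.≤-trans q (h j t) }
...       | no  q = suc i , pi , λ { zero _ → ℕₚ.<⇒≤ (ℕₚ.≰⇒> q) ; (suc j) t → h j t }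

-- Finite label sets

ΠFin : (P : ℕ) → (Fin P → ℕ) → ℕ
ΠFin zero    K = 1
ΠFin (suc P) K = K zero * ΠFin P (λ i → K (suc i))

-- Several labels are stored as one element of a single `Fin`, so that the number of labels is a
-- number fixed before the graph is known.
pack : ∀ P (K : Fin P → ℕ) → (∀ i → Fin (K i)) → Fin (ΠFin P K)
pack zero    K f = zero
pack (suc P) K f = combine (f zero) (pack P (λ i → K (suc i)) (λ i → f (suc i)))

unpack : ∀ P (K : Fin P → ℕ) → Fin (ΠFin P K) → ∀ i → Fin (K i)
unpack (suc P) K c zero    = proj₁ (remQuot {K zero} (ΠFin P (λ i → K (suc i))) c)
unpack (suc P) K c (suc i) =
  unpack P (λ i → K (suc i)) (proj₂ (remQuot {K zero} (ΠFin P (λ i → K (suc i))) c)) i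

unpack-pack : ∀ P K f i → unpack P K (pack P K f) i ≡ f i
unpack-pack (suc P) K f zero =
  cong proj₁ (Finₚ.remQuot-combine (f zero) (pack P (λ i → K (suc i)) (λ i → f (suc i))))
unpack-pack (suc P) K f (suc i) =
  trans (cong (λ c → unpack P (λ i → K (suc i)) (proj₂ c) i)
          (Finₚ.remQuot-combine (f zero) (pack P (λ i → K (suc i)) (λ i → f (suc i)))))
        (unpack-pack P (λ i → K (suc i)) (λ i → f (suc i)) i)

pack-injective : ∀ P K f g → pack P K f ≡ pack P K g → ∀ i → f i ≡ g i
pack-injective P K f g e i =
  trans (sym (unpack-pack P K f i)) (trans (cong (λ c → unpack P K c i) e) (unpack-pack P K g i))

pack-cong : ∀ P K f g → (∀ i → f i ≡ g i) → pack P K f ≡ pack P K g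
pack-cong zero    K f g h = refl
pack-cong (suc P) K f g h =
  cong₂ combine (h zero) (pack-cong P (λ i → K (suc i)) (λ i → f (suc i)) (λ i → g (suc i)) (λ i → h (suc i)))

bit : Bool → Fin 2
bit false = zero
bit true  = suc zero

unbit : Fin 2 → Bool
unbit zero       = false
unbit (suc zero) = true

unbit-bit : ∀ b → unbit (bit b) ≡ b
unbit-bit false = refl
unbit-bit true  = refl

bit-injective : ∀ {a b} → bit a ≡ bit b → a ≡ b
bit-injective {a} {b} e = trans (sym (unbit-bit a)) (trans (cong unbit e) (unbit-bit b))

#Sets : ℕ → ℕ
#Sets K = ΠFin K (λ _ → 2)

toSet : ∀ K → (Fin K → Bool) → Fin (#Sets K)
toSet K p = pack K (λ _ → 2) (λ i → bit (p i))

member : ∀ K → Fin (#Sets K) → Fin K → Bool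
member K c i = unbit (unpack K (λ _ → 2) c i)

member-toSet : ∀ K p i → member K (toSet K p) i ≡ p i
member-toSet K p i = trans (cong unbit (unpack-pack K (λ _ → 2) (λ i → bit (p i)) i)) (unbit-bit (p i))

toSet-injective : ∀ K p q → toSet K p ≡ toSet K q → ∀ i → p i ≡ q i
toSet-injective K p q e i = bit-injective (pack-injective K (λ _ → 2) (λ i → bit (p i)) (λ i → bit (q i)) e i)

toSet-cong : ∀ K {p q} → (∀ i → p i ≡ q i) → toSet K p ≡ toSet K q
toSet-cong K h = pack-cong K (λ _ → 2) _ _ (λ i → cong bit (h i))

-- Counting

count-mono : ∀ {n} (p q : Fin n → Bool) → (∀ i → p i ≡ true → q i ≡ true) → countFin n p ≤ countFin n q
count-mono {zero}  p q h = z≤n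
count-mono {suc n} p q h =
  ℕₚ.+-mono-≤ (ind (p zero) (q zero) (h zero)) (count-mono (λ i → p (suc i)) (λ i → q (suc i)) (λ i → h (suc i)))
  where
  ind : ∀ a b → (a ≡ true → b ≡ true) → (if a then 1 else 0) ≤ (if b then 1 else 0)
  ind false b     f = z≤n
  ind true  true  f = ℕₚ.≤-refl
  ind true  false f with f refl
  ... | ()

count-≤n : ∀ {n} (p : Fin n → Bool) → countFin n p ≤ n
count-≤n {zero}  p = z≤n
count-≤n {suc n} p with p zero
... | true  = s≤s (count-≤n (λ i → p (suc i)))
... | false = ℕₚ.m≤n⇒m≤1+n (count-≤n (λ i → p (suc i)))

remove : ∀ {n} → Fin n → (Fin n → Bool) → Fin n → Bool
remove x p i = p i ∧ not (i == x)

remove-intro : ∀ {n} {x : Fin n} {p : Fin n → Bool} {i} → p i ≡ true → i ≢ x → remove x p i ≡ true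
remove-intro {x = x} {i = i} h ne = ∧-intro h (not-true (⌊⌋-false (i ≟ x) ne))

remove-elim : ∀ {n} {x : Fin n} {p : Fin n → Bool} {i} → remove x p i ≡ true → p i ≡ true × i ≢ x
remove-elim {x = x} {p} {i} h with ∧-elim {p i} h
... | a , b = a , ⌊⌋-refute (i ≟ x) (not-true⇒false b)

suc-injective : ∀ {n} {i j : Fin n} → _≡_ {A = Fin (suc n)} (suc i) (suc j) → i ≡ j
suc-injective refl = refl

count-cong : ∀ {n} {p q : Fin n → Bool} → (∀ i → p i ≡ q i) → countFin n p ≡ countFin n q
count-cong {zero}  h = refl
count-cong {suc n} h = cong₂ (λ b c → (if b then 1 else 0) + c) (h zero) (count-cong (λ i → h (suc i)))

count-remove : ∀ {n} (p : Fin n → Bool) x → p x ≡ true → countFin n p ≡ suc (countFin n (remove x p))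
count-remove {suc n} p zero h rewrite h =
  cong suc (count-cong (λ i → iff⇒≡ (λ t → remove-intro {x = zero} {p} {suc i} t (λ ()))
                                    (λ t → proj₁ (remove-elim {x = zero} {p} {suc i} t))))
count-remove {suc n} p (suc x) h = begin
  ind (p zero) + countFin n p′                    ≡⟨ cong (ind (p zero) +_) (count-remove p′ x h) ⟩
  ind (p zero) + suc (countFin n (remove x p′))   ≡⟨ ℕₚ.+-suc _ _ ⟩
  suc (ind (p zero) + countFin n (remove x p′))   ≡⟨ cong suc (cong₂ _+_ (cong ind (sym lem)) (count-cong (λ i → sym (lem′ i)))) ⟩
  suc (ind (remove (suc x) p zero) + countFin n (λ i → remove (suc x) p (suc i))) ∎
  where
  open ≡-Reasoning
  p′ = λ i → p (suc i)
  ind : Bool → ℕ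
  ind b = if b then 1 else 0
  lem : remove (suc x) p zero ≡ p zero
  lem = iff⇒≡ (λ t → proj₁ (remove-elim {x = suc x} {p} {zero} t)) (λ t → remove-intro {x = suc x} {p} {zero} t (λ ()))
  lem′ : ∀ i → remove (suc x) p (suc i) ≡ remove x p′ i
  lem′ i = iff⇒≡ (λ t → let a , b = remove-elim {x = suc x} {p} {suc i} t in remove-intro {p = p′} {i} a (λ e → b (cong suc e)))
                 (λ t → let a , b = remove-elim {x = x} {p′} {i} t in remove-intro {p = p} {suc i} a (λ e → b (suc-injective e)))

count-strict : ∀ {n} (p q : Fin n → Bool) → (∀ i → p i ≡ true → q i ≡ true) →
               ∀ x → q x ≡ true → p x ≡ false → countFin n p < countFin n q
count-strict p q h x qx px rewrite count-remove q x qx =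
  s≤s (count-mono p (remove x q) λ i t → remove-intro {p = q} {i} (h i t) λ { refl → true≢false t px })

count-empty : ∀ {n} (p : Fin n → Bool) → (∀ i → p i ≡ false) → countFin n p ≡ 0
count-empty {zero}  p h = refl
count-empty {suc n} p h rewrite h zero = count-empty (λ i → p (suc i)) (λ i → h (suc i))

count-witness : ∀ {n} (p : Fin n → Bool) → 1 ≤ countFin n p → ∃[ i ] p i ≡ true
count-witness {n} p h with find p
... | inj₁ w = w
... | inj₂ none = ⊥-elim (absurd (subst (1 ≤_) (count-empty p none) h))
  where
  absurd : 1 ≤ 0 → ⊥
  absurd ()

count-≤-list : ∀ {n} (p : Fin n → Bool) (xs : List (Fin n)) → (∀ i → p i ≡ true → i ∈ xs) → countFin n p ≤ length xs
count-≤-list p [] h = ℕₚ.≤-reflexive (count-empty p λ i → ≢true⇒false λ t → nope (h i t))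
  where
  nope : ∀ {i} → i ∈ [] → ⊥
  nope ()
count-≤-list p (x ∷ xs) h with bool-cases (p x)
... | inj₁ px rewrite count-remove p x px = s≤s (count-≤-list (remove x p) xs go)
  where
  go : ∀ i → remove x p i ≡ true → i ∈ xs
  go i t with remove-elim {x = x} {p} {i} t
  ... | a , ne with h i a
  ...   | here e  = ⊥-elim (ne e)
  ...   | there m = m
... | inj₂ px = ℕₚ.m≤n⇒m≤1+n (count-≤-list p xs go)
  where
  go : ∀ i → p i ≡ true → i ∈ xs
  go i t with h i t
  ... | here refl = ⊥-elim (true≢false t px)
  ... | there m = m

count-injection : ∀ {m n} (p : Fin m → Bool) (q : Fin n → Bool) (f : Fin m → Fin n) →
  (∀ i j → f i ≡ f j → i ≡ j) → (∀ i → p i ≡ true → q (f i) ≡ true) → countFin m p ≤ countFin n q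
count-injection {zero}  p q f inj h = z≤n
count-injection {suc m} p q f inj h with bool-cases (p zero)
... | inj₂ e rewrite e = count-injection (λ i → p (suc i)) q (λ i → f (suc i)) (λ i j t → suc-injective (inj _ _ t)) (λ i → h (suc i))
... | inj₁ e rewrite e | count-remove q (f zero) (h zero e) =
  s≤s (count-injection (λ i → p (suc i)) (remove (f zero) q) (λ i → f (suc i)) (λ i j t → suc-injective (inj _ _ t))
        λ i t → remove-intro {p = q} {f (suc i)} (h (suc i) t) λ u → 0≢suc (inj _ _ u))
  where
  0≢suc : ∀ {i : Fin m} → suc i ≡ zero → ⊥
  0≢suc ()

elems : ∀ {n} → (Fin n → Bool) → List (Fin n)
elems {zero}  p = []
elems {suc n} p = if p zero then zero ∷ map suc (elems (λ i → p (suc i))) else map suc (elems (λ i → p (suc i)))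

elems-length : ∀ {n} (p : Fin n → Bool) → length (elems p) ≡ countFin n p
elems-length {zero}  p = refl
elems-length {suc n} p with p zero
... | true  = cong suc (trans (Listₚ.length-map Fin.suc (elems (λ i → p (suc i)))) (elems-length (λ i → p (suc i))))
... | false = trans (Listₚ.length-map Fin.suc (elems (λ i → p (suc i)))) (elems-length (λ i → p (suc i)))

elems-complete : ∀ {n} (p : Fin n → Bool) i → p i ≡ true → i ∈ elems p
elems-complete {suc n} p zero h rewrite h = here refl
elems-complete {suc n} p (suc i) h with p zero
... | true  = there (∈ₚ.∈-map⁺ suc (elems-complete (λ i → p (suc i)) i h))
... | false = ∈ₚ.∈-map⁺ suc (elems-complete (λ i → p (suc i)) i h)

elems-sound : ∀ {n} (p : Fin n → Bool) {i} → i ∈ elems p → p i ≡ true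
elems-sound {suc n} p {i} h with p zero in eq
elems-sound {suc n} p (here refl) | true = eq
elems-sound {suc n} p (there h) | true with ∈ₚ.∈-map⁻ suc h
... | j , m , refl = elems-sound (λ i → p (suc i)) m
elems-sound {suc n} p h | false with ∈ₚ.∈-map⁻ suc h
... | j , m , refl = elems-sound (λ i → p (suc i)) m

∈-concatMap : ∀ {A B : Set} (f : A → List B) {x y} (xs : List A) → x ∈ xs → y ∈ f x → y ∈ concatMap f xs
∈-concatMap f (x ∷ xs) (here refl) q = ∈ₚ.∈-++⁺ˡ q
∈-concatMap f (x ∷ xs) (there m)   q = ∈ₚ.∈-++⁺ʳ (f x) (∈-concatMap f xs m q)

length-concatMap-≤ : ∀ {A B : Set} (f : A → List B) {g} (xs : List A) → (∀ x → x ∈ xs → length (f x) ≤ g) →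
                     length (concatMap f xs) ≤ length xs * g
length-concatMap-≤ f []       h = z≤n
length-concatMap-≤ f (x ∷ xs) h = subst (_≤ _) (sym (Listₚ.length-++ (f x)))
  (ℕₚ.+-mono-≤ (h x (here refl)) (length-concatMap-≤ f xs (λ y m → h y (there m))))

is : ∀ {n} → Maybe (Fin n) → Fin n → Bool
is nothing  x = false
is (just s) x = s == x

is-sound : ∀ {n} (o : Maybe (Fin n)) {x} → is o x ≡ true → o ≡ just x
is-sound (just s) t = cong just (==-sound t)

is-complete : ∀ {n} (o : Maybe (Fin n)) {x} → o ≡ just x → is o x ≡ true
is-complete (just s) refl = ==-refl s

count-true : ∀ n → countFin n (λ _ → true) ≡ n
count-true zero    = refl
count-true (suc n) = cong suc (count-true n)

elems-all-len : ∀ k → length (elems {k} (λ _ → true)) ≡ k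
elems-all-len k = trans (elems-length {k} (λ _ → true)) (count-true k)

maybeList : ∀ {A : Set} → Maybe A → List A
maybeList nothing  = []
maybeList (just x) = x ∷ []

maybeList-len : ∀ {A : Set} (o : Maybe A) → length (maybeList o) ≤ 1
maybeList-len nothing  = z≤n
maybeList-len (just x) = ℕₚ.≤-refl

-- Finite sums

∑ : (m : ℕ) → (Fin m → ℕ) → ℕ
∑ zero    f = 0
∑ (suc m) f = f zero + ∑ m (λ i → f (suc i))

∑-mono : ∀ {m} {f g : Fin m → ℕ} → (∀ i → f i ≤ g i) → ∑ m f ≤ ∑ m g
∑-mono {zero}  h = z≤n
∑-mono {suc m} h = ℕₚ.+-mono-≤ (h zero) (∑-mono (λ i → h (suc i)))

∑-cong : ∀ {m} {f g : Fin m → ℕ} → (∀ i → f i ≡ g i) → ∑ m f ≡ ∑ m g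
∑-cong {zero}  h = refl
∑-cong {suc m} h = cong₂ _+_ (h zero) (∑-cong (λ i → h (suc i)))

∑-+ : ∀ {m} (f g : Fin m → ℕ) → ∑ m (λ i → f i + g i) ≡ ∑ m f + ∑ m g
∑-+ {zero}  f g = refl
∑-+ {suc m} f g rewrite ∑-+ (λ i → f (suc i)) (λ i → g (suc i)) =
  solve 4 (λ a b c d → (a :+ b) :+ (c :+ d) := (a :+ c) :+ (b :+ d)) refl (f zero) (g zero) (∑ m (λ i → f (suc i))) (∑ m (λ i → g (suc i)))
  where open ℕSolver.+-*-Solver

∑-zero : ∀ m → ∑ m (λ _ → 0) ≡ 0
∑-zero zero    = refl
∑-zero (suc m) = ∑-zero m

∑-swap : ∀ m n (f : Fin m → Fin n → ℕ) → ∑ m (λ i → ∑ n (f i)) ≡ ∑ n (λ j → ∑ m (λ i → f i j))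
∑-swap zero    n f = sym (∑-zero n)
∑-swap (suc m) n f = trans (cong (∑ n (f zero) +_) (∑-swap m n (λ i → f (suc i))))
                           (sym (∑-+ (f zero) (λ j → ∑ m (λ i → f (suc i) j))))

∑-bound : ∀ {m} {f : Fin m → ℕ} {g} → (∀ i → f i ≤ g) → ∑ m f ≤ m * g
∑-bound {zero}  h = z≤n
∑-bound {suc m} h = ℕₚ.+-mono-≤ (h zero) (∑-bound (λ i → h (suc i)))

indicator : Bool → ℕ
indicator b = if b then 1 else 0

count≡∑ : ∀ n (p : Fin n → Bool) → countFin n p ≡ ∑ n (λ i → indicator (p i))
count≡∑ zero    p = refl
count≡∑ (suc n) p = cong (indicator (p zero) +_) (count≡∑ n (λ i → p (suc i)))

∑-restricted : ∀ {n} (P : Fin n → Bool) (f : Fin n → ℕ) g → (∀ i → P i ≡ true → g ≤ f i) → countFin n P * g ≤ ∑ n f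
∑-restricted {zero}  P f g h = z≤n
∑-restricted {suc n} P f g h with bool-cases (P zero)
... | inj₁ e rewrite e = ℕₚ.+-mono-≤ (h zero e) (∑-restricted (λ i → P (suc i)) (λ i → f (suc i)) g (λ i → h (suc i)))
... | inj₂ e rewrite e = ℕₚ.≤-trans (∑-restricted (λ i → P (suc i)) (λ i → f (suc i)) g (λ i → h (suc i))) (ℕₚ.m≤n+m _ _)

-- Walks and distances in a Boolean relation

Rel : ℕ → Set
Rel n = Fin n → Fin n → Bool

Sym : ∀ {n} → Rel n → Set
Sym a = ∀ x y → a x y ≡ a y x

-- Side conditions on vertices, which `Walk` carries as a predicate, are moved into the relation by
-- `restrict`; reversing and joining walks then needs no bookkeeping at the end vertices.
data Path {n} (a : Rel n) : ℕ → Fin n → Fin n → Set where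
  stop : ∀ {r x} → Path a r x x
  _▸_  : ∀ {r x y z} → a x y ≡ true → Path a r y z → Path a (suc r) x z

infixr 5 _▸_ _▹▹_

weaken : ∀ {n} {a : Rel n} {r s x y} → r ≤ s → Path a r x y → Path a s x y
weaken _       stop    = stop
weaken (s≤s h) (e ▸ p) = e ▸ weaken h p

_▹▹_ : ∀ {n} {a : Rel n} {r s x y z} → Path a r x y → Path a s y z → Path a (r + s) x z
_▹▹_ {r = r} stop q = weaken (ℕₚ.m≤n+m _ r) q
(e ▸ p) ▹▹ q = e ▸ (p ▹▹ q)

mapPath : ∀ {n} {a b : Rel n} {r x y} → (∀ x y → a x y ≡ true → b x y ≡ true) → Path a r x y → Path b r x y
mapPath f stop    = stop
mapPath f (e ▸ p) = f _ _ e ▸ mapPath f p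

snoc : ∀ {n} {a : Rel n} {r x y z} → Path a r x y → a y z ≡ true → Path a (suc r) x z
snoc stop    e = e ▸ stop
snoc (d ▸ p) e = d ▸ snoc p e

reverse : ∀ {n} {a : Rel n} {r x y} → Sym a → Path a r x y → Path a r y x
reverse s stop = stop
reverse s (_▸_ {x = x} {y} e p) = snoc (reverse s p) (trans (s y x) e)

opaque
  near : ∀ {n} → Rel n → ℕ → Fin n → Fin n → Bool
  near     a zero    x z = x == z
  near {n} a (suc r) x z = (x == z) ∨ anyFin n (λ y → a x y ∧ near a r y z)

  near-sound : ∀ {n} {a : Rel n} r {x z} → near a r x z ≡ true → Path a r x z
  near-sound zero h with ==-sound h
  ... | refl = stop
  near-sound {n} {a} (suc r) {x} {z} h with ∨-elim {x == z} h
  ... | inj₁ e with ==-sound e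
  ...   | refl = stop
  near-sound {n} {a} (suc r) {x} {z} h | inj₂ e with anyFin-elim _ e
  ... | y , t with ∧-elim {a x y} t
  ...   | u , v = u ▸ near-sound r v

  near-complete : ∀ {n} {a : Rel n} {r x z} → Path a r x z → near a r x z ≡ true
  near-complete {r = zero}  {x} stop = ==-refl x
  near-complete {r = suc r} {x} stop = ∨-introˡ (==-refl x)
  near-complete {a = a} {r = suc r} {x} {z} (_▸_ {y = y} e p) =
    ∨-introʳ {x == z} (anyFin-intro _ y (∧-intro e (near-complete p)))

¬Path⇒far : ∀ {n} {a : Rel n} {r x z} → ¬ Path a r x z → near a r x z ≡ false
¬Path⇒far {r = r} h = ≢true⇒false λ t → h (near-sound r t)

far⇒¬Path : ∀ {n} {a : Rel n} {r x z} → near a r x z ≡ false → ¬ Path a r x z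
far⇒¬Path h p = true≢false (near-complete p) h

opaque
  restrict : ∀ {n} → Rel n → (Fin n → Bool) → Rel n
  restrict a P x y = a x y ∧ (P x ∧ P y)

  restrict-intro : ∀ {n} {a : Rel n} {P x y} → a x y ≡ true → P x ≡ true → P y ≡ true → restrict a P x y ≡ true
  restrict-intro e p q = ∧-intro e (∧-intro p q)

  restrict-elim : ∀ {n} {a : Rel n} {P : Fin n → Bool} {x y} → restrict a P x y ≡ true → a x y ≡ true × P x ≡ true × P y ≡ true
  restrict-elim {a = a} {P} {x} {y} h with ∧-elim {a x y} h
  ... | e , t = e , ∧-elim {P x} t

restrict-sym : ∀ {n} {a : Rel n} {P} → Sym a → Sym (restrict a P)
restrict-sym {a = a} {P} s x y = iff⇒≡ (go x y) (go y x)
  where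
  go : ∀ x y → restrict a P x y ≡ true → restrict a P y x ≡ true
  go x y h with restrict-elim {a = a} {P} {x} {y} h
  ... | e , p , q = restrict-intro {a = a} {P} {y} {x} (trans (s y x) e) q p

restrict-mono : ∀ {n} {a b : Rel n} {P Q : Fin n → Bool} → (∀ x y → a x y ≡ true → b x y ≡ true) →
                (∀ x → P x ≡ true → Q x ≡ true) → ∀ x y → restrict a P x y ≡ true → restrict b Q x y ≡ true
restrict-mono {a = a} {b} {P} {Q} f g x y h with restrict-elim {a = a} {P} {x} {y} h
... | e , p , q = restrict-intro {a = b} {Q} {x} {y} (f x y e) (g x p) (g y q)

restrict-forget : ∀ {n} {a : Rel n} {P} x y → restrict a P x y ≡ true → a x y ≡ true
restrict-forget {a = a} {P} x y h = proj₁ (restrict-elim {a = a} {P} {x} {y} h)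

restrict-start : ∀ {n} {a : Rel n} {P r x y} → Path (restrict a P) r x y → P y ≡ true → P x ≡ true
restrict-start stop h = h
restrict-start {a = a} {P} (_▸_ {x = x} {y} e p) h = proj₁ (proj₂ (restrict-elim {a = a} {P} {x} {y} e))

restrict-end : ∀ {n} {a : Rel n} {P r x y} → Path (restrict a P) r x y → P x ≡ true → P y ≡ true
restrict-end stop h = h
restrict-end {a = a} {P} (_▸_ {x = x} {y} e p) h = restrict-end {a = a} {P} p (proj₂ (proj₂ (restrict-elim {a = a} {P} {x} {y} e)))

restrict-ends : ∀ {n} {a : Rel n} {P r x y} → Path (restrict a P) r x y → x ≢ y → P x ≡ true × P y ≡ true
restrict-ends stop ne = ⊥-elim (ne refl)
restrict-ends {a = a} {P} (_▸_ {x = x} {y} e p) ne with restrict-elim {a = a} {P} {x} {y} e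
... | _ , px , py = px , restrict-end {a = a} {P} p py

at : ∀ {n} {a : Rel n} {r x y} → Path a r x y → ℕ → Fin n
at {x = x} w       zero    = x
at {x = x} stop    (suc t) = x
at         (e ▸ w) (suc t) = at w t

len : ∀ {n} {a : Rel n} {r x y} → Path a r x y → ℕ
len stop    = 0
len (e ▸ w) = suc (len w)

len-≤ : ∀ {n} {a : Rel n} {r x y} (w : Path a r x y) → len w ≤ r
len-≤ stop    = z≤n
len-≤ (e ▸ w) = s≤s (len-≤ w)

exact : ∀ {n} {a : Rel n} {r x y} (w : Path a r x y) → Path a (len w) x y
exact stop    = stop
exact (e ▸ w) = e ▸ exact w

at-edge : ∀ {n} {a : Rel n} {r x y} (w : Path a r x y) t → t < len w → a (at w t) (at w (suc t)) ≡ true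
at-edge (e ▸ w) zero    h       = e
at-edge (e ▸ w) (suc t) (s≤s h) = at-edge w t h

prefix : ∀ {n} {a : Rel n} {r x y} (w : Path a r x y) t → Path a t x (at w t)
prefix w       zero    = stop
prefix stop    (suc t) = stop
prefix (e ▸ w) (suc t) = e ▸ prefix w t

suffix : ∀ {n} {a : Rel n} {r x y} (w : Path a r x y) t → Path a (r ∸ t) (at w t) y
suffix w       zero    = w
suffix stop    (suc t) = stop
suffix (e ▸ w) (suc t) = suffix w t

prefixIn : ∀ {n} {a : Rel n} {P r x y} (w : Path a r x y) → (∀ s → P (at w s) ≡ true) →
           ∀ t → Path (restrict a P) t x (at w t)
prefixIn w    h zero    = stop
prefixIn stop h (suc t) = stop
prefixIn {a = a} {P} (_▸_ {x = x} {y} e w) h (suc t) =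
  restrict-intro {a = a} {P} {x} {y} e (h 0) (h 1) ▸ prefixIn {a = a} {P} w (λ s → h (suc s)) t

suffixIn : ∀ {n} {a : Rel n} {P r x y} (w : Path a r x y) → (∀ s → P (at w s) ≡ true) →
           ∀ t → Path (restrict a P) (r ∸ t) (at w t) y
suffixIn stop h zero    = stop
suffixIn {a = a} {P} (_▸_ {x = x} {y} e w) h zero =
  restrict-intro {a = a} {P} {x} {y} e (h 0) (h 1) ▸ suffixIn {a = a} {P} w (λ s → h (suc s)) 0
suffixIn stop    h (suc t) = stop
suffixIn {a = a} {P} (e ▸ w) h (suc t) = suffixIn {a = a} {P} w (λ s → h (suc s)) t

minAt : ∀ {n} {a : Rel n} {r x y} (f : Fin n → ℕ) (w : Path a r x y) → ∃[ t ] (∀ s → f (at w t) ≤ f (at w s))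
minAt f stop = 0 , λ { zero → ℕₚ.≤-refl ; (suc s) → ℕₚ.≤-refl }
minAt f (_▸_ {x = x} e w) with minAt f w
... | t , h with f x ≤? f (at w t)
...   | yes q = 0     , λ { zero → ℕₚ.≤-refl ; (suc s) → ℕₚ.≤-trans q (h s) }
...   | no  q = suc t , λ { zero → ℕₚ.<⇒≤ (ℕₚ.≰⇒> q) ; (suc s) → h s }

changesAt : ∀ {n} {a : Rel n} {r x y} {X : Set} (_≟X_ : (u v : X) → Dec (u ≡ v)) (f : Fin n → X) (w : Path a r x y) →
  f x ≢ f y → ∃[ t ] (t < len w × f (at w t) ≢ f (at w (suc t)))
changesAt _≟X_ f stop ne = ⊥-elim (ne refl)
changesAt _≟X_ f (_▸_ {x = x} {y} e w) ne with f x ≟X f y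
... | no  q = 0 , s≤s z≤n , q
... | yes q with changesAt _≟X_ f w (λ u → ne (trans q u))
...   | t , l , h = suc t , s≤s l , h

-- For symmetric `a` this is an induced path on `v 0`, ..., `v ℓ`. The sequence is total on the
-- naturals so that a block of it is again a sequence, shifted by an addition.
record Geodesic {n} (a : Rel n) (ℓ : ℕ) (v : ℕ → Fin n) : Set where
  field
    edges    : ∀ t → t < ℓ → a (v t) (v (suc t)) ≡ true
    distinct : ∀ s t → s < t → t ≤ ℓ → v s ≢ v t
    induced  : ∀ s t → suc s < t → t ≤ ℓ → a (v s) (v t) ≡ false

-- In a walk with more than `L` edges the first `L + 1` vertices cannot form an induced path, so
-- they contain a repetition or a chord, along which the walk is cut. Excluding induced paths of one
-- length thus bounds all finite distances.
shorten : ∀ {n} {a : Rel n} (L : ℕ) → (∀ v → ¬ Geodesic a L v) → ∀ {r x y} → Path a r x y → Path a L x y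
shorten {n} {a} L none {r} w = go r r ℕₚ.≤-refl w
  where
  go : ∀ fuel r → r ≤ fuel → ∀ {x y} → Path a r x y → Path a L x y
  go fuel r le {x} {y} w with len w ≤? L
  ... | yes q = weaken q (exact w)
  ... | no q = attempt fuel le (find₂ (λ s t → viol (toℕ s) (toℕ t)))
    where
    v : ℕ → Fin n
    v = at w
    L<r : L < r
    L<r = ℕₚ.<-≤-trans (ℕₚ.≰⇒> q) (len-≤ w)
    viol : ℕ → ℕ → Bool
    viol s t = (⌊ s <? t ⌋ ∧ (v s == v t)) ∨ (⌊ suc s <? t ⌋ ∧ a (v s) (v t))
    cut : ∀ s t → s < t → t ≤ L → s + (r ∸ t) < r
    cut s t s<t t≤L = ℕₚ.<-≤-trans (ℕₚ.+-monoˡ-< (r ∸ t) s<t)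
      (ℕₚ.≤-reflexive (ℕₚ.m+[n∸m]≡n (ℕₚ.≤-trans t≤L (ℕₚ.<⇒≤ L<r))))
    attempt : ∀ fuel → r ≤ fuel → (∃[ s ] ∃[ t ] viol (toℕ {suc L} s) (toℕ {suc L} t) ≡ true) ⊎
              (∀ s t → viol (toℕ {suc L} s) (toℕ {suc L} t) ≡ false) → Path a L x y
    attempt fuel le (inj₂ ok) = ⊥-elim (none v record
      { edges = λ t h → at-edge w t (ℕₚ.<-trans h (ℕₚ.≰⇒> q))
      ; distinct = λ s t s<t t≤L e → true≢false
          (∨-introˡ (∧-intro (⌊⌋-complete (s <? t) s<t) (⌊⌋-complete (v s ≟ v t) e)))
          (ok′ s t (ℕₚ.≤-trans (ℕₚ.<⇒≤ s<t) t≤L) t≤L)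
      ; induced = λ s t s<t t≤L → ≢true⇒false λ e → true≢false
          (∨-introʳ {⌊ s <? t ⌋ ∧ (v s == v t)} (∧-intro (⌊⌋-complete (suc s <? t) s<t) e))
          (ok′ s t (ℕₚ.≤-trans (ℕₚ.<⇒≤ (ℕₚ.<-trans (ℕₚ.n<1+n s) s<t)) t≤L) t≤L) })
      where
      ok′ : ∀ s t → s ≤ L → t ≤ L → viol s t ≡ false
      ok′ s t p q = subst₂ (λ s t → viol s t ≡ false) (Finₚ.toℕ-fromℕ< (s≤s p)) (Finₚ.toℕ-fromℕ< (s≤s q)) (ok (fromℕ< (s≤s p)) (fromℕ< (s≤s q)))
    attempt zero le (inj₁ _) = ⊥-elim (ℕₚ.n≮0 (ℕₚ.<-≤-trans L<r le))
    attempt (suc fuel) le (inj₁ (s′ , t′ , h)) with toℕ s′ | toℕ t′ | ℕₚ.≤-pred (Finₚ.toℕ<n t′)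
    ... | s | t | t≤L with ∨-elim {⌊ s <? t ⌋ ∧ (v s == v t)} h
    ...   | inj₁ u with ∧-elim {⌊ s <? t ⌋} u
    ...     | u₁ , u₂ = go fuel (s + (r ∸ t)) (ℕₚ.≤-pred (ℕₚ.≤-trans (cut s t (⌊⌋-sound (s <? t) u₁) t≤L) le))
                          (prefix w s ▹▹ subst (λ z → Path a (r ∸ t) z y) (sym (==-sound u₂)) (suffix w t))
    attempt (suc fuel) le (inj₁ (s′ , t′ , h)) | s | t | t≤L | inj₂ u with ∧-elim {⌊ suc s <? t ⌋} u
    ...     | u₁ , u₂ = go fuel (suc s + (r ∸ t)) (ℕₚ.≤-pred (ℕₚ.≤-trans (cut (suc s) t (⌊⌋-sound (suc s <? t) u₁) t≤L) le))
                          (snoc (prefix w s) u₂ ▹▹ suffix w t)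

-- Locality of first-order formulas

radius : ∀ {c k} → Formula c k → ℕ
radius (edge _ _)  = 1
radius (equal _ _) = 1
radius (color _ _) = 1
radius (neg φ)     = radius φ
radius (or φ ψ)    = radius φ ⊔ radius ψ
radius (and φ ψ)   = radius φ ⊔ radius ψ
-- Two parts that meet the same ball are joined by `R` steps into the ball, at most `4R` inside it
-- and `R` steps out (`farAgain`).
radius (ex φ)      = let R = radius φ in (R + ((R + R) + (R + R))) + R
radius (all φ)     = let R = radius φ in (R + ((R + R) + (R + R))) + R

-- A coloured graph with a second relation m whose distance replaces that of the graph: on pairs
-- that are not m-adjacent, adjacency is a function of the finite labels κ.
record Context (c k₀ : ℕ) : Set where
  field
    G    : Graph
    col  : Fin c → Fin (size G) → Bool
    m    : Rel (size G)
    msym : Sym m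
    κ    : Fin (size G) → Fin k₀
    κ-adj : ∀ x y x′ y′ → m x y ≡ false → m x′ y′ ≡ false → κ x ≡ κ x′ → κ y ≡ κ y′ →
            x ≢ y → x′ ≢ y′ → adj G x y ≡ adj G x′ y′
  V : Set
  V = Fin (size G)
open Context

FarParts : ∀ {n k P} → Rel n → ℕ → (Fin k → Fin P) → (Fin k → Fin n) → Set
FarParts m R π ρ = ∀ u v → π u ≢ π v → ¬ Path m R (ρ u) (ρ v)

FarParts-mono : ∀ {n k P} {m : Rel n} {R R′} {π : Fin k → Fin P} {ρ} → R ≤ R′ → FarParts m R′ π ρ → FarParts m R π ρ
FarParts-mono h f u v ne p = f u v ne (weaken h p)

-- Locality in composition form, chosen because it survives quantifiers: the variables are split
-- into parts, and on assignments with far parts the truth value is a function of one label per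
-- part. The labels may depend on the graph; only their number `K` may not.
record Local {c k k₀} (X : Context c k₀) (φ : Formula c k) (P : ℕ) (π : Fin k → Fin P) (K : ℕ) : Set where
  field
    lab : Fin P → (Fin k → V X) → Fin K
    dep : ∀ p ρ ρ′ → (∀ v → π v ≡ p → ρ v ≡ ρ′ v) → lab p ρ ≡ lab p ρ′
    det : ∀ ρ ρ′ → FarParts (m X) (radius φ) π ρ → FarParts (m X) (radius φ) π ρ′ →
          (∀ p → lab p ρ ≡ lab p ρ′) → eval (G X) (col X) φ ρ ≡ eval (G X) (col X) φ ρ′
open Local

module _ {n} (m : Rel n) (msym : Sym m) (R : ℕ) where

  Scattered Covered : (Fin n → Bool) → ℕ → Set
  Scattered Q N = Σ (Fin N → Fin n) λ f → (∀ i → Q (f i) ≡ true) × (∀ i j → i ≢ j → ¬ Path m (R + R) (f i) (f j))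
  Covered   Q N = Σ (Fin N → Fin n → Bool) λ ball →
    (∀ z → Q z ≡ true → ∃[ j ] ball j z ≡ true) × (∀ j z → ball j z ≡ true → Q z ≡ true) ×
    (∀ j z z′ → ball j z ≡ true → ball j z′ ≡ true → Path m ((R + R) + (R + R)) z z′)

  -- Greedy choice: vertices of `Q` are added at pairwise distance more than `2R`. When none can be
  -- added, the balls of radius `2R` around the chosen ones cover `Q` and have diameter at most
  -- `4R`; empty balls pad their number to `N`.
  scattered-or-covered : ∀ Q N → Scattered Q N ⊎ Covered Q N
  scattered-or-covered Q zero = inj₁ ((λ ()) , (λ ()) , λ ())
  scattered-or-covered Q (suc N) with scattered-or-covered Q N
  ... | inj₂ (ball , cov , sub , diam) = inj₂ (ball′ , (λ z q → let j , b = cov z q in suc j , b) , sub′ , diam′)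
    where
    ball′ : Fin (suc N) → Fin n → Bool
    ball′ zero    z = false
    ball′ (suc j) z = ball j z
    sub′ : ∀ j z → ball′ j z ≡ true → Q z ≡ true
    sub′ (suc j) = sub j
    diam′ : ∀ j z z′ → ball′ j z ≡ true → ball′ j z′ ≡ true → Path m ((R + R) + (R + R)) z z′
    diam′ (suc j) = diam j
  ... | inj₁ (f , fQ , sc) with find (λ z → Q z ∧ allFin N (λ i → not (near m (R + R) (f i) z)))
  ...   | inj₁ (z , h) = inj₁ (f′ , fQ′ , sc′)
    where
    far : ∀ i → near m (R + R) (f i) z ≡ false
    far i = not-true⇒false (allFin-elim (λ i → not (near m (R + R) (f i) z)) (proj₂ (∧-elim {Q z} h)) i)
    f′ : Fin (suc N) → Fin n
    f′ zero    = z
    f′ (suc i) = f i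
    fQ′ : ∀ i → Q (f′ i) ≡ true
    fQ′ zero    = proj₁ (∧-elim {Q z} h)
    fQ′ (suc i) = fQ i
    sc′ : ∀ i j → i ≢ j → ¬ Path m (R + R) (f′ i) (f′ j)
    sc′ zero    zero    ne p = ne refl
    sc′ zero    (suc j) ne p = far⇒¬Path (far j) (reverse msym p)
    sc′ (suc i) zero    ne p = far⇒¬Path (far i) p
    sc′ (suc i) (suc j) ne p = sc i j (λ e → ne (cong suc e)) p
  ...   | inj₂ none = inj₂ (ball′ , cov′ , sub′ , diam′)
    where
    ball′ : Fin (suc N) → Fin n → Bool
    ball′ zero    z = false
    ball′ (suc i) z = Q z ∧ near m (R + R) (f i) z
    cov′ : ∀ z → Q z ≡ true → ∃[ j ] ball′ j z ≡ true
    cov′ z q with find (λ i → near m (R + R) (f i) z)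
    ... | inj₁ (i , h) = suc i , ∧-intro q h
    ... | inj₂ h = ⊥-elim (true≢false (∧-intro q (allFin-intro (λ i → not (near m (R + R) (f i) z)) (λ i → not-true (h i)))) (none z))
    sub′ : ∀ j z → ball′ j z ≡ true → Q z ≡ true
    sub′ (suc j) z h = proj₁ (∧-elim {Q z} h)
    diam′ : ∀ j z z′ → ball′ j z ≡ true → ball′ j z′ ≡ true → Path m ((R + R) + (R + R)) z z′
    diam′ (suc j) z z′ h h′ = reverse msym (near-sound (R + R) (proj₂ (∧-elim {Q z} h))) ▹▹ near-sound (R + R) (proj₂ (∧-elim {Q z′} h′))

-- The step for a quantified variable z.  If z is near part i it joins that part; otherwise it is a
-- part of its own, and whether a far z with a given label exists is read off bits of the parts: the
-- vertices with that label either contain a large scattered set (then z always exists) or are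
-- covered by few balls, each of which is met by at most one part.
module QuantifierStep {c k k₀ P : ℕ} (X : Context c k₀) (ψ : Formula c (suc k)) (π : Fin k → Fin P)
  (K : Fin P → ℕ) (loc : ∀ i → Local X ψ P (ext i π) (K i))
  (Kn : ℕ) (locn : Local X ψ (suc P) (ext zero (λ v → suc (π v))) Kn) where

  private
    n = size (G X)
    R = radius ψ
    R⁺ = (R + ((R + R) + (R + R))) + R
    R≤R⁺ : R ≤ R⁺
    R≤R⁺ = ℕₚ.m≤n+m R _
    2R≤R⁺ : R + R ≤ R⁺
    2R≤R⁺ = ℕₚ.+-monoˡ-≤ R (ℕₚ.m≤m+n R _)

  nearPart : Fin P → (Fin k → V X) → V X → Bool
  nearPart i ρ z = anyFin k (λ v → (π v == i) ∧ near (m X) R (ρ v) z)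

  nearPart-elim : ∀ i ρ z → nearPart i ρ z ≡ true → ∃[ v ] (π v ≡ i × Path (m X) R (ρ v) z)
  nearPart-elim i ρ z h with anyFin-elim _ h
  ... | v , t with ∧-elim {π v == i} t
  ...   | e , q = v , ==-sound e , near-sound R q

  nearPart-intro : ∀ ρ z v → Path (m X) R (ρ v) z → nearPart (π v) ρ z ≡ true
  nearPart-intro ρ z v p = anyFin-intro _ v (∧-intro (==-refl (π v)) (near-complete p))

  nearPart-dep : ∀ i ρ ρ′ z → (∀ v → π v ≡ i → ρ v ≡ ρ′ v) → nearPart i ρ z ≡ nearPart i ρ′ z
  nearPart-dep i ρ ρ′ z h = any-cong go
    where
    go : ∀ v → ((π v == i) ∧ near (m X) R (ρ v) z) ≡ ((π v == i) ∧ near (m X) R (ρ′ v) z)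
    go v with π v ≟ i
    ... | yes e = cong (λ x → near (m X) R x z) (h v e)
    ... | no  _ = refl

  μ : V X → Fin Kn
  μ z = lab locn zero (λ _ → z)

  scat : ∀ t → Scattered (m X) (msym X) R (λ z → μ z == t) (suc k) ⊎ Covered (m X) (msym X) R (λ z → μ z == t) (suc k)
  scat t = scattered-or-covered (m X) (msym X) R (λ z → μ z == t) (suc k)

  ball : Fin Kn → Fin (suc k) → V X → Bool
  ball t j z with scat t
  ... | inj₁ _ = false
  ... | inj₂ (b , _) = b j z

  -- Nearness of `z` is asked only when `p` is the part `i` that `z` joins. The labels of the other
  -- parts do not involve `z`, so there any vertex exhibits them, and the bit depends on part `p`
  -- alone.
  nearSet : Fin P → (Fin k → V X) → (i : Fin P) → Fin (K i) → Bool
  nearSet p ρ i c = anyFin n (λ z → (not (p == i) ∨ nearPart i ρ z) ∧ (lab (loc i) p (ext z ρ) == c))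

  farSet : Fin P → (Fin k → V X) → Fin Kn → Bool
  farSet p ρ c = anyFin n (λ z → lab locn (suc p) (ext z ρ) == c)

  ballBit : Fin P → (Fin k → V X) → Fin Kn → Fin (suc k) → Bool
  ballBit p ρ t j = anyFin n (λ z → ball t j z ∧ not (nearPart p ρ z))

  #nearSets #ballBits : ℕ
  #nearSets = ΠFin P (λ i → #Sets (K i))
  #ballBits = ΠFin Kn (λ _ → #Sets (suc k))

  nearSets : Fin P → (Fin k → V X) → Fin #nearSets
  nearSets p ρ = pack P (λ i → #Sets (K i)) (λ i → toSet (K i) (nearSet p ρ i))

  ballBits : Fin P → (Fin k → V X) → Fin #ballBits
  ballBits p ρ = pack Kn (λ _ → #Sets (suc k)) (λ t → toSet (suc k) (ballBit p ρ t))

  label : Fin P → (Fin k → V X) → Fin (#nearSets * (#Sets Kn * #ballBits))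
  label p ρ = combine (nearSets p ρ) (combine (toSet Kn (farSet p ρ)) (ballBits p ρ))

  label-dep : ∀ p ρ ρ′ → (∀ v → π v ≡ p → ρ v ≡ ρ′ v) → label p ρ ≡ label p ρ′
  label-dep p ρ ρ′ h = cong₂ combine
    (pack-cong P _ _ _ λ i → toSet-cong (K i) λ c → any-cong λ z →
      cong₂ _∧_ (same i z) (cong (_== c) (dep (loc i) p _ _ (agree i z))))
    (cong₂ combine
      (toSet-cong Kn λ c → any-cong λ z → cong (_== c) (dep locn (suc p) _ _ (agree′ z)))
      (pack-cong Kn _ _ _ λ t → toSet-cong (suc k) λ j → any-cong λ z →
        cong (λ b → ball t j z ∧ not b) (nearPart-dep p ρ ρ′ z h)))
    where
    same : ∀ i z → (not (p == i) ∨ nearPart i ρ z) ≡ (not (p == i) ∨ nearPart i ρ′ z)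
    same i z with p ≟ i
    ... | yes refl = nearPart-dep p ρ ρ′ z h
    ... | no _ = refl
    agree : ∀ i z v → ext i π v ≡ p → ext z ρ v ≡ ext z ρ′ v
    agree i z zero    e = refl
    agree i z (suc v) e = h v e
    agree′ : ∀ z v → ext zero (λ v → suc (π v)) v ≡ suc p → ext z ρ v ≡ ext z ρ′ v
    agree′ z zero    ()
    agree′ z (suc v) e = h v (suc-injective e)

  module _ (ρ ρ′ : Fin k → V X) (far : FarParts (m X) R⁺ π ρ) (far′ : FarParts (m X) R⁺ π ρ′)
           (eq : ∀ p → label p ρ ≡ label p ρ′) where

    private
      eqs : ∀ p → nearSets p ρ ≡ nearSets p ρ′ × toSet Kn (farSet p ρ) ≡ toSet Kn (farSet p ρ′) × ballBits p ρ ≡ ballBits p ρ′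
      eqs p with Finₚ.combine-injective (nearSets p ρ) _ (nearSets p ρ′) _ (eq p)
      ... | a , b with Finₚ.combine-injective (toSet Kn (farSet p ρ)) (ballBits p ρ) (toSet Kn (farSet p ρ′)) (ballBits p ρ′) b
      ...   | d , e = a , d , e

      eqNear : ∀ p i c → nearSet p ρ i c ≡ nearSet p ρ′ i c
      eqNear p i = toSet-injective (K i) _ _ (pack-injective P (λ i → #Sets (K i)) _ _ (proj₁ (eqs p)) i)

      eqFar : ∀ p c → farSet p ρ c ≡ farSet p ρ′ c
      eqFar p = toSet-injective Kn _ _ (proj₁ (proj₂ (eqs p)))

      eqBall : ∀ p t j → ballBit p ρ t j ≡ ballBit p ρ′ t j
      eqBall p t = toSet-injective (suc k) _ _ (pack-injective Kn (λ _ → #Sets (suc k)) _ _ (proj₂ (proj₂ (eqs p))) t)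

      farJoin : ∀ σ i z → FarParts (m X) R⁺ π σ → nearPart i σ z ≡ true → FarParts (m X) R (ext i π) (ext z σ)
      farJoin σ i z f h zero    zero    ne p = ne refl
      farJoin σ i z f h (suc u) (suc v) ne p = f u v ne (weaken R≤R⁺ p)
      farJoin σ i z f h zero    (suc v) ne p with nearPart-elim i σ z h
      ... | u , e , q = f u v (λ t → ne (trans (sym e) t)) (weaken 2R≤R⁺ (q ▹▹ p))
      farJoin σ i z f h (suc v) zero    ne p with nearPart-elim i σ z h
      ... | u , e , q = f u v (λ t → ne (sym (trans (sym e) t))) (weaken 2R≤R⁺ (q ▹▹ reverse (msym X) p))

      farNew : ∀ σ z → FarParts (m X) R⁺ π σ → (∀ i → nearPart i σ z ≡ false) → FarParts (m X) R (ext zero (λ v → suc (π v))) (ext z σ)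
      farNew σ z f h zero    zero    ne p = ne refl
      farNew σ z f h (suc u) (suc v) ne p = f u v (λ e → ne (cong suc e)) (weaken R≤R⁺ p)
      farNew σ z f h zero    (suc v) ne p = true≢false (nearPart-intro σ z v (reverse (msym X) p)) (h (π v))
      farNew σ z f h (suc v) zero    ne p = true≢false (nearPart-intro σ z v p) (h (π v))

      Transfer : V X → Set
      Transfer z = ∃[ z′ ] eval (G X) (col X) ψ (ext z ρ) ≡ eval (G X) (col X) ψ (ext z′ ρ′)

      transferNear : ∀ z i → nearPart i ρ z ≡ true → Transfer z
      transferNear z i h = z′ , det (loc i) _ _ (farJoin ρ i z far h) (farJoin ρ′ i z′ far′ near′) labels
        where
        witness : ∀ p → (not (p == i) ∨ nearPart i ρ z) ≡ true →
          ∃[ w ] ((not (p == i) ∨ nearPart i ρ′ w) ≡ true × lab (loc i) p (ext w ρ′) ≡ lab (loc i) p (ext z ρ))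
        witness p t with anyFin-elim _ (trans (sym (eqNear p i (lab (loc i) p (ext z ρ))))
          (anyFin-intro (λ z₁ → (not (p == i) ∨ nearPart i ρ z₁) ∧ (lab (loc i) p (ext z₁ ρ) == lab (loc i) p (ext z ρ))) z (∧-intro t (==-refl _))))
        ... | w , q with ∧-elim {not (p == i) ∨ nearPart i ρ′ w} q
        ...   | q₁ , q₂ = w , q₁ , ==-sound q₂
        own = witness i (∨-introʳ {not (i == i)} h)
        z′ = proj₁ own
        near′ : nearPart i ρ′ z′ ≡ true
        near′ with ∨-elim {not (i == i)} (proj₁ (proj₂ own))
        ... | inj₂ q = q
        ... | inj₁ q = ⊥-elim (true≢false (==-refl i) (not-true⇒false q))
        labels : ∀ p → lab (loc i) p (ext z ρ) ≡ lab (loc i) p (ext z′ ρ′)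
        labels p with p ≟ i
        ... | yes refl = sym (proj₂ (proj₂ own))
        ... | no ne with witness p (∨-introˡ (not-true (⌊⌋-false (p ≟ i) ne)))
        ...   | w , _ , e = trans (sym e) (dep (loc i) p _ _ agree)
          where
          agree : ∀ v → ext i π v ≡ p → ext w ρ′ v ≡ ext z′ ρ′ v
          agree zero    e = ⊥-elim (ne (sym e))
          agree (suc v) e = refl

      transferFar : ∀ z z′ → (∀ i → nearPart i ρ z ≡ false) → (∀ i → nearPart i ρ′ z′ ≡ false) → μ z ≡ μ z′ → Transfer z
      transferFar z z′ h h′ e = z′ , det locn _ _ (farNew ρ z far h) (farNew ρ′ z′ far′ h′) labels
        where
        isμ : ∀ z σ → lab locn zero (ext z σ) ≡ μ z
        isμ z σ = dep locn zero _ _ λ { zero _ → refl ; (suc v) () }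
        labels : ∀ p → lab locn p (ext z ρ) ≡ lab locn p (ext z′ ρ′)
        labels zero = trans (isμ z ρ) (trans e (sym (isμ z′ ρ′)))
        labels (suc p) with anyFin-elim (λ z₁ → lab locn (suc p) (ext z₁ ρ′) == lab locn (suc p) (ext z ρ)) (trans (sym (eqFar p (lab locn (suc p) (ext z ρ))))
                              (anyFin-intro (λ z₁ → lab locn (suc p) (ext z₁ ρ) == lab locn (suc p) (ext z ρ)) z (==-refl _)))
        ... | w , q = trans (sym (==-sound q)) (dep locn (suc p) (ext w ρ′) (ext z′ ρ′) λ { zero () ; (suc v) _ → refl })

      farAgain : ∀ z → (∀ i → nearPart i ρ z ≡ false) → ∃[ z′ ] ((∀ i → nearPart i ρ′ z′ ≡ false) × μ z ≡ μ z′)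
      farAgain z h with scat (μ z) in scEq
      ... | inj₁ (f , fQ , sc) with find (λ i → allFin k (λ v → not (near (m X) R (ρ′ v) (f i))))
      ...   | inj₁ (i , ok) = f i , (λ p → ≢true⇒false λ t → bad p (nearPart-elim p ρ′ (f i) t)) , sym (==-sound (fQ i))
        where
        bad : ∀ p → ∃[ v ] (π v ≡ p × Path (m X) R (ρ′ v) (f i)) → ⊥
        bad p (v , _ , q) = far⇒¬Path (not-true⇒false (allFin-elim (λ v → not (near (m X) R (ρ′ v) (f i))) ok v)) q
      -- Otherwise each of the `k + 1` scattered vertices is within `R` of one of the `k` values of
      -- `ρ′`, and two that share a value are at distance at most `2R`.
      ...   | inj₂ none = ⊥-elim (clash (Finₚ.pigeonhole (ℕₚ.n<1+n k) (λ i → proj₁ (hit i))))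
        where
        hit : ∀ i → ∃[ v ] Path (m X) R (ρ′ v) (f i)
        hit i with find (λ v → near (m X) R (ρ′ v) (f i))
        ... | inj₁ (v , q) = v , near-sound R q
        ... | inj₂ q = ⊥-elim (true≢false (allFin-intro (λ v → not (near (m X) R (ρ′ v) (f i))) (λ v → not-true (q v))) (none i))
        clash : ∃[ i ] ∃[ j ] (i Fin.< j × proj₁ (hit i) ≡ proj₁ (hit j)) → ⊥
        clash (i , j , lt , e) = sc i j (Finₚ.<⇒≢ lt)
          (reverse (msym X) (subst (λ v → Path (m X) R (ρ′ v) (f i)) e (proj₂ (hit i))) ▹▹ proj₂ (hit j))
      farAgain z h | inj₂ (b , cov , sub , diam) = choose (find₂ (λ v w → ball t j w ∧ near (m X) R (ρ′ v) w))
        where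
        t = μ z
        j = proj₁ (cov z (==-refl t))
        b-ball : ∀ w → ball t j w ≡ b j w
        b-ball w rewrite scEq = refl
        zIn : ball t j z ≡ true
        zIn = trans (b-ball z) (proj₂ (cov z (==-refl t)))
        spare : ∀ p → ∃[ w ] (ball t j w ≡ true × nearPart p ρ′ w ≡ false)
        spare p with anyFin-elim _ (trans (sym (eqBall p t j))
                       (anyFin-intro (λ z → ball t j z ∧ not (nearPart p ρ z)) z (∧-intro zIn (not-true (h p)))))
        ... | w , q with ∧-elim {ball t j w} q
        ...   | q₁ , q₂ = w , q₁ , not-true⇒false q₂
        -- If no value of `ρ′` is near the ball, `z` itself serves. Otherwise only the part of one
        -- variable comes near it, and the ball bit of that part, equal for `ρ` and `ρ′`, supplies a
        -- vertex of the ball far from it.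
        choose : (∃[ v ] ∃[ w ] (ball t j w ∧ near (m X) R (ρ′ v) w) ≡ true) ⊎ (∀ v w → (ball t j w ∧ near (m X) R (ρ′ v) w) ≡ false) →
                 ∃[ z′ ] ((∀ i → nearPart i ρ′ z′ ≡ false) × μ z ≡ μ z′)
        choose (inj₂ none) = z , (λ p → ≢true⇒false λ q → bad p (nearPart-elim p ρ′ z q)) , refl
          where
          bad : ∀ p → ∃[ v ] (π v ≡ p × Path (m X) R (ρ′ v) z) → ⊥
          bad p (v , _ , q) = true≢false (∧-intro zIn (near-complete q)) (none v z)
        choose (inj₁ (v , w , q)) with ∧-elim {ball t j w} q | spare (π v)
        ... | bw , nw | z′ , bz , fz = z′ , (λ p → ≢true⇒false λ q → bad p (nearPart-elim p ρ′ z′ q)) ,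
                                       sym (==-sound (sub j z′ (trans (sym (b-ball z′)) bz)))
          where
          bad : ∀ p → ∃[ u ] (π u ≡ p × Path (m X) R (ρ′ u) z′) → ⊥
          bad p (u , _ , q) with π v ≟ π u
          ... | yes e = true≢false (subst (λ i → nearPart i ρ′ z′ ≡ true) (sym e) (nearPart-intro ρ′ z′ u q)) fz
          ... | no ne = far′ v u ne ((near-sound R nw ▹▹ diam j w z′ (trans (sym (b-ball w)) bw) (trans (sym (b-ball z′)) bz)) ▹▹ reverse (msym X) q)

    transfer : ∀ z → ∃[ z′ ] eval (G X) (col X) ψ (ext z ρ) ≡ eval (G X) (col X) ψ (ext z′ ρ′)
    transfer z with find (λ i → nearPart i ρ z)
    ... | inj₁ (i , h) = transferNear z i h
    ... | inj₂ h with farAgain z h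
    ...   | z′ , h′ , e = transferFar z z′ h h′ e

  localEx : Local X (ex ψ) P π (#nearSets * (#Sets Kn * #ballBits))
  localEx = record { lab = label ; dep = label-dep ; det = λ ρ ρ′ f f′ e → iff⇒≡ (go ρ ρ′ f f′ e) (go ρ′ ρ f′ f (λ p → sym (e p))) }
    where
    go : ∀ ρ ρ′ → FarParts (m X) R⁺ π ρ → FarParts (m X) R⁺ π ρ′ → (∀ p → label p ρ ≡ label p ρ′) →
         eval (G X) (col X) (ex ψ) ρ ≡ true → eval (G X) (col X) (ex ψ) ρ′ ≡ true
    go ρ ρ′ f f′ e h with anyFin-elim _ h
    ... | z , t with transfer ρ ρ′ f f′ e z
    ...   | z′ , q = anyFin-intro _ z′ (trans (sym q) t)

  localAll : Local X (all ψ) P π (#nearSets * (#Sets Kn * #ballBits))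
  localAll = record { lab = label ; dep = label-dep ; det = λ ρ ρ′ f f′ e → iff⇒≡ (go ρ ρ′ f f′ e) (go ρ′ ρ f′ f (λ p → sym (e p))) }
    where
    go : ∀ ρ ρ′ → FarParts (m X) R⁺ π ρ → FarParts (m X) R⁺ π ρ′ → (∀ p → label p ρ ≡ label p ρ′) →
         eval (G X) (col X) (all ψ) ρ ≡ true → eval (G X) (col X) (all ψ) ρ′ ≡ true
    go ρ ρ′ f f′ e h = allFin-intro _ λ z′ → let z , q = transfer ρ′ ρ f′ f (λ p → sym (e p)) z′ in trans q (allFin-elim _ h z)

module AtomStep {c k k₀ P : ℕ} (X : Context c k₀) (π : Fin k → Fin P) where

  when : ∀ {A : Set} → Bool → A → A → A
  when b x y = if b then x else y

  localEdge : ∀ i j → Local X (edge i j) P π (suc k₀ * (suc k₀ * 2))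
  localEdge i j = record { lab = label ; dep = label-dep ; det = label-det }
    where
    κ⁺ : Fin k → Fin P → (Fin k → V X) → Fin (suc k₀)
    κ⁺ i p ρ = when (π i == p) (suc (κ X (ρ i))) zero
    both : Fin P → (Fin k → V X) → Bool
    both p ρ = when ((π i == p) ∧ (π j == p)) (adj (G X) (ρ i) (ρ j)) false
    label : Fin P → (Fin k → V X) → Fin (suc k₀ * (suc k₀ * 2))
    label p ρ = combine (κ⁺ i p ρ) (combine (κ⁺ j p ρ) (bit (both p ρ)))
    κ⁺-dep : ∀ i p ρ ρ′ → (∀ v → π v ≡ p → ρ v ≡ ρ′ v) → κ⁺ i p ρ ≡ κ⁺ i p ρ′
    κ⁺-dep i p ρ ρ′ h with π i ≟ p
    ... | yes e = cong (λ x → suc (κ X x)) (h i e)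
    ... | no _ = refl
    label-dep : ∀ p ρ ρ′ → (∀ v → π v ≡ p → ρ v ≡ ρ′ v) → label p ρ ≡ label p ρ′
    label-dep p ρ ρ′ h = cong₂ combine (κ⁺-dep i p ρ ρ′ h) (cong₂ combine (κ⁺-dep j p ρ ρ′ h) (cong bit go))
      where
      go : both p ρ ≡ both p ρ′
      go with π i ≟ p | π j ≟ p
      ... | yes e | yes e′ = cong₂ (adj (G X)) (h i e) (h j e′)
      ... | yes _ | no _ = refl
      ... | no _  | _ = refl
    κ⁺-eq : ∀ i ρ ρ′ → κ⁺ i (π i) ρ ≡ κ⁺ i (π i) ρ′ → κ X (ρ i) ≡ κ X (ρ′ i)
    κ⁺-eq i ρ ρ′ e rewrite ==-refl (π i) = suc-injective e
    label-det : ∀ ρ ρ′ → FarParts (m X) 1 π ρ → FarParts (m X) 1 π ρ′ → (∀ p → label p ρ ≡ label p ρ′) →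
                adj (G X) (ρ i) (ρ j) ≡ adj (G X) (ρ′ i) (ρ′ j)
    label-det ρ ρ′ f f′ e = go (π i ≟ π j)
      where
      parts : ∀ p → κ⁺ i p ρ ≡ κ⁺ i p ρ′ × κ⁺ j p ρ ≡ κ⁺ j p ρ′ × both p ρ ≡ both p ρ′
      parts p with Finₚ.combine-injective (κ⁺ i p ρ) _ (κ⁺ i p ρ′) _ (e p)
      ... | a , b with Finₚ.combine-injective (κ⁺ j p ρ) (bit (both p ρ)) (κ⁺ j p ρ′) (bit (both p ρ′)) b
      ...   | d , g = a , d , bit-injective g
      apart : ∀ σ → FarParts (m X) 1 π σ → π i ≢ π j → m X (σ i) (σ j) ≡ false × σ i ≢ σ j
      apart σ f ne = ≢true⇒false (λ t → f i j ne (t ▸ stop)) , λ t → f i j ne (subst (Path (m X) 1 (σ i)) t stop)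
      go : Dec (π i ≡ π j) → adj (G X) (ρ i) (ρ j) ≡ adj (G X) (ρ′ i) (ρ′ j)
      go (yes q) = trans (sym (isAdj ρ)) (trans (proj₂ (proj₂ (parts (π i)))) (isAdj ρ′))
        where
        isAdj : ∀ σ → both (π i) σ ≡ adj (G X) (σ i) (σ j)
        isAdj σ rewrite ==-refl (π i) | ⌊⌋-complete (π j ≟ π i) (sym q) = refl
      go (no ne) = κ-adj X _ _ _ _ (proj₁ (apart ρ f ne)) (proj₁ (apart ρ′ f′ ne))
        (κ⁺-eq i ρ ρ′ (proj₁ (parts (π i)))) (κ⁺-eq j ρ ρ′ (proj₁ (proj₂ (parts (π j))))) (proj₂ (apart ρ f ne)) (proj₂ (apart ρ′ f′ ne))

  localEqual : ∀ i j → Local X (equal i j) P π 2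
  localEqual i j = record { lab = λ p ρ → bit (both p ρ) ; dep = λ p ρ ρ′ h → cong bit (both-dep p ρ ρ′ h) ; det = both-det }
    where
    both : Fin P → (Fin k → V X) → Bool
    both p ρ = when ((π i == p) ∧ (π j == p)) (ρ i == ρ j) false
    both-dep : ∀ p ρ ρ′ → (∀ v → π v ≡ p → ρ v ≡ ρ′ v) → both p ρ ≡ both p ρ′
    both-dep p ρ ρ′ h with π i ≟ p | π j ≟ p
    ... | yes e | yes e′ = cong₂ _==_ (h i e) (h j e′)
    ... | yes _ | no _ = refl
    ... | no _  | _ = refl
    both-det : ∀ ρ ρ′ → FarParts (m X) 1 π ρ → FarParts (m X) 1 π ρ′ → (∀ p → bit (both p ρ) ≡ bit (both p ρ′)) →
               (ρ i == ρ j) ≡ (ρ′ i == ρ′ j)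
    both-det ρ ρ′ f f′ e = go (π i ≟ π j)
      where
      differ : ∀ σ → FarParts (m X) 1 π σ → π i ≢ π j → (σ i == σ j) ≡ false
      differ σ f ne = ⌊⌋-false (σ i ≟ σ j) λ t → f i j ne (subst (Path (m X) 1 (σ i)) t stop)
      go : Dec (π i ≡ π j) → (ρ i == ρ j) ≡ (ρ′ i == ρ′ j)
      go (no ne) = trans (differ ρ f ne) (sym (differ ρ′ f′ ne))
      go (yes q) = trans (sym (isEq ρ)) (trans (bit-injective (e (π i))) (isEq ρ′))
        where
        isEq : ∀ σ → both (π i) σ ≡ (σ i == σ j)
        isEq σ rewrite ==-refl (π i) | ⌊⌋-complete (π j ≟ π i) (sym q) = refl

  localColor : ∀ q i → Local X (color q i) P π 2
  localColor q i = record
    { lab = λ p ρ → bit (own p ρ)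
    ; dep = λ p ρ ρ′ h → cong bit (own-dep p ρ ρ′ h)
    ; det = λ ρ ρ′ f f′ e → trans (sym (isOwn ρ)) (trans (bit-injective (e (π i))) (isOwn ρ′)) }
    where
    own : Fin P → (Fin k → V X) → Bool
    own p ρ = when (π i == p) (col X q (ρ i)) false
    own-dep : ∀ p ρ ρ′ → (∀ v → π v ≡ p → ρ v ≡ ρ′ v) → own p ρ ≡ own p ρ′
    own-dep p ρ ρ′ h with π i ≟ p
    ... | yes e = cong (col X q) (h i e)
    ... | no _ = refl
    isOwn : ∀ σ → own (π i) σ ≡ col X q (σ i)
    isOwn σ rewrite ==-refl (π i) = refl

  localBinary : ∀ {φ ψ χ : Formula c k} {K K′} → radius φ ≤ radius χ → radius ψ ≤ radius χ → (op : Bool → Bool → Bool) →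
    (∀ ρ → eval (G X) (col X) χ ρ ≡ op (eval (G X) (col X) φ ρ) (eval (G X) (col X) ψ ρ)) →
    Local X φ P π K → Local X ψ P π K′ → Local X χ P π (K * K′)
  localBinary {χ = χ} r₁ r₂ op isOp l₁ l₂ = record
    { lab = λ p ρ → combine (lab l₁ p ρ) (lab l₂ p ρ)
    ; dep = λ p ρ ρ′ h → cong₂ combine (dep l₁ p ρ ρ′ h) (dep l₂ p ρ ρ′ h)
    ; det = λ ρ ρ′ f f′ e → trans (isOp ρ) (trans (cong₂ op
        (det l₁ ρ ρ′ (FarParts-mono r₁ f) (FarParts-mono r₁ f′) (λ p → proj₁ (Finₚ.combine-injective (lab l₁ p ρ) _ (lab l₁ p ρ′) _ (e p))))
        (det l₂ ρ ρ′ (FarParts-mono r₂ f) (FarParts-mono r₂ f′) (λ p → proj₂ (Finₚ.combine-injective (lab l₁ p ρ) _ (lab l₁ p ρ′) _ (e p)))))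
        (sym (isOp ρ′))) }

locality : ∀ {c k} (φ : Formula c k) k₀ P (π : Fin k → Fin P) → Σ ℕ λ K → ∀ (X : Context c k₀) → Local X φ P π K
locality (edge i j)  k₀ P π = _ , λ X → AtomStep.localEdge X π i j
locality (equal i j) k₀ P π = _ , λ X → AtomStep.localEqual X π i j
locality (color q i) k₀ P π = _ , λ X → AtomStep.localColor X π q i
locality (neg φ) k₀ P π with locality φ k₀ P π
... | K , l = K , λ X → record { lab = lab (l X) ; dep = dep (l X) ; det = λ ρ ρ′ f f′ e → cong not (det (l X) ρ ρ′ f f′ e) }
locality (or φ ψ) k₀ P π with locality φ k₀ P π | locality ψ k₀ P π
... | K , l | K′ , l′ = K * K′ , λ X → AtomStep.localBinary X π {φ} {ψ} {or φ ψ} (ℕₚ.m≤m⊔n _ _) (ℕₚ.m≤n⊔m _ _) _∨_ (λ _ → refl) (l X) (l′ X)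
locality (and φ ψ) k₀ P π with locality φ k₀ P π | locality ψ k₀ P π
... | K , l | K′ , l′ = K * K′ , λ X → AtomStep.localBinary X π {φ} {ψ} {and φ ψ} (ℕₚ.m≤m⊔n _ _) (ℕₚ.m≤n⊔m _ _) _∧_ (λ _ → refl) (l X) (l′ X)
locality (ex ψ) k₀ P π =
  _ , λ X → QuantifierStep.localEx X ψ π (λ i → proj₁ (locality ψ k₀ P (ext i π))) (λ i → proj₂ (locality ψ k₀ P (ext i π)) X)
             (proj₁ (locality ψ k₀ (suc P) (ext zero (λ v → suc (π v))))) (proj₂ (locality ψ k₀ (suc P) (ext zero (λ v → suc (π v)))) X)
locality (all ψ) k₀ P π =
  _ , λ X → QuantifierStep.localAll X ψ π (λ i → proj₁ (locality ψ k₀ P (ext i π))) (λ i → proj₂ (locality ψ k₀ P (ext i π)) X)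
             (proj₁ (locality ψ k₀ (suc P) (ext zero (λ v → suc (π v))))) (proj₂ (locality ψ k₀ (suc P) (ext zero (λ v → suc (π v)))) X)

pair : ∀ {A : Set} → A → A → Fin 2 → A
pair x y = ext x (ext y empty)

record PairLocal {c k₀} (X : Context c k₀) (φ : Formula c 2) (K : ℕ) : Set where
  field
    plab : V X → Fin K
    pdet : ∀ x y x′ y′ → ¬ Path (m X) (radius φ) x y → ¬ Path (m X) (radius φ) x′ y′ → plab x ≡ plab x′ → plab y ≡ plab y′ →
           eval (G X) (col X) φ (pair x y) ≡ eval (G X) (col X) φ (pair x′ y′)
open PairLocal

-- With each variable in a part of its own, every label depends on a single vertex. A vertex may
-- stand in either argument, hence the pair of labels and `K * K`.
pairLocality : ∀ {c} (φ : Formula c 2) k₀ → Σ ℕ λ K → ∀ (X : Context c k₀) → PairLocal X φ K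
pairLocality φ k₀ with locality φ k₀ 2 id
... | K , l = K * K , λ X → record { plab = label X ; pdet = λ x y x′ y′ f f′ e e′ →
        det (l X) (pair x y) (pair x′ y′) (far X x y f) (far X x′ y′ f′) (labels X x y x′ y′ e e′) }
  where
  label : ∀ X → V X → Fin (K * K)
  label X x = combine (lab (l X) zero (λ _ → x)) (lab (l X) (suc zero) (λ _ → x))
  far : ∀ X x y → ¬ Path (m X) (radius φ) x y → FarParts (m X) (radius φ) id (pair x y)
  far X x y f zero       zero       ne p = ne refl
  far X x y f zero       (suc zero) ne p = f p
  far X x y f (suc zero) zero       ne p = f (reverse (msym X) p)
  far X x y f (suc zero) (suc zero) ne p = ne refl
  labels : ∀ X x y x′ y′ → label X x ≡ label X x′ → label X y ≡ label X y′ → ∀ p → lab (l X) p (pair x y) ≡ lab (l X) p (pair x′ y′)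
  labels X x y x′ y′ e e′ zero =
    trans (dep (l X) zero (pair x y) (λ _ → x) λ { zero _ → refl ; (suc v) () })
    (trans (proj₁ (Finₚ.combine-injective (lab (l X) zero (λ _ → x)) (lab (l X) (suc zero) (λ _ → x)) (lab (l X) zero (λ _ → x′)) (lab (l X) (suc zero) (λ _ → x′)) e))
           (dep (l X) zero (λ _ → x′) (pair x′ y′) λ { zero _ → refl ; (suc v) () }))
  labels X x y x′ y′ e e′ (suc zero) =
    trans (dep (l X) (suc zero) (pair x y) (λ _ → y) λ { zero () ; (suc zero) _ → refl })
    (trans (proj₂ (Finₚ.combine-injective (lab (l X) zero (λ _ → y)) (lab (l X) (suc zero) (λ _ → y)) (lab (l X) zero (λ _ → y′)) (lab (l X) (suc zero) (λ _ → y′)) e′))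
           (dep (l X) (suc zero) (λ _ → y′) (pair x′ y′) λ { zero () ; (suc zero) _ → refl }))

-- Vertex deletions as contexts, and flips by labels

module Deletion (G : Graph) {c} (col : Fin c → Fin (size G) → Bool) {σ} (S : Fin σ → Maybe (Fin (size G))) where

  adjTo : Maybe (Fin (size G)) → Fin (size G) → Bool
  adjTo nothing  x = false
  adjTo (just s) x = adj G s x

  deleted : Fin (size G) → Bool
  deleted x = anyFin σ (λ i → is (S i) x)

  remaining : Rel (size G)
  remaining = restrict (adj G) (λ x → not (deleted x))

  -- An edge missing from `remaining` has a deleted end. The first component identifies that end,
  -- and the second component of the other end reads off the adjacency. The number of values depends
  -- only on `σ`.
  κS : Fin (size G) → Fin (#Sets σ * #Sets σ)
  κS x = combine (toSet σ (λ i → is (S i) x)) (toSet σ (λ i → adjTo (S i) x))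

  private
    κS-elim : ∀ x x′ → κS x ≡ κS x′ → ∀ i → is (S i) x ≡ is (S i) x′ × adjTo (S i) x ≡ adjTo (S i) x′
    κS-elim x x′ e i with Finₚ.combine-injective (toSet σ (λ i → is (S i) x)) (toSet σ (λ i → adjTo (S i) x))
                            (toSet σ (λ i → is (S i) x′)) (toSet σ (λ i → adjTo (S i) x′)) e
    ... | u , v = toSet-injective σ _ _ u i , toSet-injective σ _ _ v i

    viaDeleted : ∀ x y x′ y′ → deleted x ≡ true → κS x ≡ κS x′ → κS y ≡ κS y′ → adj G x y ≡ true → adj G x′ y′ ≡ true
    viaDeleted x y x′ y′ h e e′ a with anyFin-elim _ h
    ... | i , t with S i | κS-elim x x′ e i | κS-elim y y′ e′ i
    ...   | just s | u , _ | _ , v with ==-sound {x = s} t | ==-sound {x = s} (trans (sym u) t)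
    ...     | refl | refl = trans (sym v) a

    half : ∀ x y x′ y′ → remaining x y ≡ false → κS x ≡ κS x′ → κS y ≡ κS y′ → adj G x y ≡ true → adj G x′ y′ ≡ true
    half x y x′ y′ h e e′ a with bool-cases (deleted x) | bool-cases (deleted y)
    ... | inj₁ d | _ = viaDeleted x y x′ y′ d e e′ a
    ... | inj₂ _ | inj₁ d = trans (adj-sym G x′ y′) (viaDeleted y x y′ x′ d e′ e (trans (adj-sym G y x) a))
    ... | inj₂ d | inj₂ d′ = ⊥-elim (true≢false (restrict-intro {a = adj G} {λ x → not (deleted x)} {x} {y} a (not-true d) (not-true d′)) h)

  context : Context c (#Sets σ * #Sets σ)
  context = record
    { G = G ; col = col ; m = remaining ; msym = restrict-sym {a = adj G} {λ x → not (deleted x)} (adj-sym G) ; κ = κS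
    ; κ-adj = λ x y x′ y′ h h′ e e′ _ _ → iff⇒≡ (half x y x′ y′ h e e′) (half x′ y′ x y h′ (sym e) (sym e′)) }

listEnum : ∀ {A : Set} s → List A → Fin s → Maybe A
listEnum s       []       i       = nothing
listEnum (suc s) (x ∷ xs) zero    = just x
listEnum (suc s) (x ∷ xs) (suc i) = listEnum s xs i

listEnum-complete : ∀ {A : Set} s (xs : List A) {x} → length xs ≤ s → x ∈ xs → ∃[ i ] listEnum s xs i ≡ just x
listEnum-complete (suc s) (x ∷ xs) (s≤s h) (here refl) = zero , refl
listEnum-complete (suc s) (x ∷ xs) (s≤s h) (there m) with listEnum-complete s xs h m
... | i , e = suc i , e

flipsAdj-pointwise : ∀ {n} (Fs : List (Flip n)) {a b : Rel n} {x y} → a x y ≡ b x y → flipsAdj Fs a x y ≡ flipsAdj Fs b x y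
flipsAdj-pointwise [] e = e
flipsAdj-pointwise ((A , B) ∷ Fs) {a} {b} {x} {y} e =
  flipsAdj-pointwise Fs {flipAdj (A , B) a} {flipAdj (A , B) b} (cong (_xor ((A x ∧ B y) ∨ (B x ∧ A y))) e)

toggles : ∀ {n} → Flip n → Rel n
toggles (A , B) x y = (A x ∧ B y) ∨ (B x ∧ A y)

xor-false : ∀ b → b xor false ≡ b
xor-false true  = refl
xor-false false = refl

xor-self : ∀ b → b xor b ≡ false
xor-self true  = refl
xor-self false = refl

flips-none : ∀ {n} K (f : Fin K → Flip n) (a : Rel n) x y → (∀ i → toggles (f i) x y ≡ false) →
             flipsAdj (Data.List.tabulate f) a x y ≡ a x y
flips-none zero    f a x y h = refl
flips-none (suc K) f a x y h = trans
  (flipsAdj-pointwise (Data.List.tabulate (λ i → f (suc i))) {flipAdj (f zero) a} {a} (trans (cong (a x y xor_) (h zero)) (xor-false (a x y))))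
  (flips-none K (λ i → f (suc i)) a x y (λ i → h (suc i)))

flips-one : ∀ {n} K (f : Fin K → Flip n) (a : Rel n) x y i → (∀ j → j ≢ i → toggles (f j) x y ≡ false) →
            flipsAdj (Data.List.tabulate f) a x y ≡ a x y xor toggles (f i) x y
flips-one (suc K) f a x y zero h = flips-none K (λ i → f (suc i)) (flipAdj (f zero) a) x y (λ i → h (suc i) (λ ()))
flips-one (suc K) f a x y (suc i) h = trans
  (flipsAdj-pointwise (Data.List.tabulate (λ i → f (suc i))) {flipAdj (f zero) a} {a} (trans (cong (a x y xor_) (h zero (λ ()))) (xor-false (a x y))))
  (flips-one K (λ i → f (suc i)) a x y i (λ j ne → h (suc j) (λ e → ne (suc-injective e))))

-- One flip per label i, against the labels ≥ i: each pair of vertices is toggled at most once.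
labelFlip : ∀ {n K} → (Fin n → Fin K) → (Fin K → Fin K → Bool) → Fin K → Flip n
labelFlip l F i = (λ x → l x == i) , (λ y → ⌊ toℕ i ≤? toℕ (l y) ⌋ ∧ F i (l y))

labelFlips-erase : ∀ {n K} (l : Fin n → Fin K) (F : Fin K → Fin K → Bool) (a : Rel n) x y →
  F (l x) (l y) ≡ a x y → F (l y) (l x) ≡ a x y → flipsAdj (Data.List.tabulate (labelFlip l F)) a x y ≡ false
-- The pair is toggled by the flip of the smaller of its two labels and by no other.
labelFlips-erase {n} {K} l F a x y h h′ with toℕ (l x) ≤? toℕ (l y)
... | yes le = trans (flips-one K (labelFlip l F) a x y (l x) others) (trans (cong (a x y xor_) hit) (xor-self (a x y)))
  where
  others : ∀ j → j ≢ l x → toggles (labelFlip l F j) x y ≡ false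
  others j ne = ≢true⇒false λ t → go (∨-elim {(l x == j) ∧ (⌊ toℕ j ≤? toℕ (l y) ⌋ ∧ F j (l y))} t)
    where
    go : _ → ⊥
    go (inj₁ t) = ne (sym (==-sound (proj₁ (∧-elim {l x == j} t))))
    go (inj₂ t) with ∧-elim {⌊ toℕ j ≤? toℕ (l x) ⌋ ∧ F j (l x)} t
    ... | u , v with ==-sound {x = l y} {j} v
    ...   | refl = ne (Finₚ.toℕ-injective (ℕₚ.≤-antisym (⌊⌋-sound (toℕ (l y) ≤? toℕ (l x)) (proj₁ (∧-elim u))) le))
  hit : toggles (labelFlip l F (l x)) x y ≡ a x y
  hit rewrite ==-refl (l x) | ⌊⌋-complete (toℕ (l x) ≤? toℕ (l y)) le = iff⇒≡
    (λ t → go (∨-elim {F (l x) (l y)} t)) (λ t → ∨-introˡ (trans h t))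
    where
    go : _ → a x y ≡ true
    go (inj₁ t) = trans (sym h) t
    go (inj₂ t) with ∧-elim {⌊ toℕ (l x) ≤? toℕ (l x) ⌋ ∧ F (l x) (l x)} t
    ... | u , v = trans (sym h) (subst (λ i → F (l x) i ≡ true) (sym (==-sound {x = l y} {l x} v)) (proj₂ (∧-elim {⌊ toℕ (l x) ≤? toℕ (l x) ⌋} u)))
... | no nle = trans (flips-one K (labelFlip l F) a x y (l y) others) (trans (cong (a x y xor_) hit) (xor-self (a x y)))
  where
  others : ∀ j → j ≢ l y → toggles (labelFlip l F j) x y ≡ false
  others j ne = ≢true⇒false λ t → go (∨-elim {(l x == j) ∧ (⌊ toℕ j ≤? toℕ (l y) ⌋ ∧ F j (l y))} t)
    where
    go : _ → ⊥
    go (inj₂ t) = ne (sym (==-sound (proj₂ (∧-elim {⌊ toℕ j ≤? toℕ (l x) ⌋ ∧ F j (l x)} t))))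
    go (inj₁ t) with ∧-elim {l x == j} t
    ... | u , v with ==-sound {x = l x} {j} u
    ...   | refl = nle (⌊⌋-sound (toℕ (l x) ≤? toℕ (l y)) (proj₁ (∧-elim v)))
  hit : toggles (labelFlip l F (l y)) x y ≡ a x y
  hit rewrite ==-refl (l y) | ⌊⌋-false (l x ≟ l y) (λ e → nle (ℕₚ.≤-reflexive (cong toℕ e)))
            | ⌊⌋-complete (toℕ (l y) ≤? toℕ (l x)) (ℕₚ.<⇒≤ (ℕₚ.≰⇒> nle)) = trans (∧-true (F (l y) (l x))) h′
    where
    ∧-true : ∀ b → b ∧ true ≡ b
    ∧-true true  = refl
    ∧-true false = refl

count-≤-image : ∀ {h n} (p : Fin h → Bool) (q : Fin n → Bool) (f : Fin h → Fin n) →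
  (∀ v → q v ≡ true → ∃[ i ] (p i ≡ true × f i ≡ v)) → countFin n q ≤ countFin h p
count-≤-image p q f h = subst (countFin _ q ≤_) (trans (Listₚ.length-map f (elems p)) (elems-length p))
  (count-≤-list q (map f (elems p)) λ v t → let i , pi , e = h v t in subst (_∈ map f (elems p)) e (∈ₚ.∈-map⁺ f (elems-complete p i pi)))

-- From almost-wideness to strong flip-flatness

strongly-flip-flat-transduction : ∀ (C D : Class) (T : Transduction) → UniformlyAlmostWide D → C ⊆T[ T ] D → StronglyFlipFlat C
-- One flip per label, whatever `r` is. After the flips an edge of H spans distance at most `R` in G
-- without `S`, so `r`-independence needs a set that is `r * R`-independent there.
strongly-flip-flat-transduction C D T (s , aw) sub = K , λ r → (λ k → proj₁ (aw (r * R)) k) , main r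
  where
  R = radius (φ T)
  loc = pairLocality (φ T) (#Sets s * #Sets s)
  K = proj₁ loc
  main : ∀ r k H → C H → (A : Subset (size H)) → ∣ A ∣ ≥ proj₁ (aw (r * R)) k →
    Σ (List (Flip (size H))) λ F → length F ≤ K × Σ (Subset (size H)) λ B → B ⊆ A × ∣ B ∣ ≥ k × IndepIn (flipsAdj F (adj H)) (λ _ → ⊤) r B
  main r k H cH A bigA with sub H cH
  ... | G , dG , col , ι , ι-inj , _ , _ , ι-adj = go (proj₂ (aw (r * R)) k G dG A′ bigA′)
    where
    A′ : Subset (size G)
    A′ v = anyFin (size H) (λ i → A i ∧ (ι i == v))
    bigA′ : ∣ A′ ∣ ≥ proj₁ (aw (r * R)) k
    bigA′ = ℕₚ.≤-trans bigA (count-injection A A′ ι ι-inj λ i t → anyFin-intro (λ j → A j ∧ (ι j == ι i)) i (∧-intro t (==-refl (ι i))))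
    go : _ → _
    go (S , smallS , B′ , B′⊆ , bigB′ , indep) =
      Data.List.tabulate (labelFlip lH F) , ℕₚ.≤-reflexive (Listₚ.length-tabulate (labelFlip lH F)) ,
      (λ i → B′ (ι i)) , (λ i t → B⊆A i (B′⊆ (ι i) t)) , ℕₚ.≤-trans (ℕₚ.<⇒≤ bigB′) countB , indepB
      where
      S# : Fin s → Maybe (Fin (size G))
      S# = listEnum s (elems S)
      open Deletion G col S#
      pl = proj₂ loc context
      lH : Fin (size H) → Fin K
      lH i = plab pl (ι i)
      far : Rel (size H)
      far i j = not (near remaining R (ι i) (ι j))
      F : Fin K → Fin K → Bool
      -- All far pairs with labels `α`, `β` agree on adjacency by locality, so existence of one
      -- adjacent pair is their common value.
      F α β = anyFin (size H) λ i → anyFin (size H) λ j → ((lH i == α) ∧ (lH j == β)) ∧ (far i j ∧ adj H i j)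
      deleted-S : ∀ v → S v ≡ true → deleted v ≡ true
      deleted-S v t with listEnum-complete s (elems S) (ℕₚ.≤-trans (ℕₚ.≤-reflexive (elems-length S)) smallS) (elems-complete S v t)
      ... | i , e = anyFin-intro (λ i → is (S# i) v) i (subst (λ w → is w v ≡ true) (sym e) (==-refl v))
      B⊆A : ∀ i → A′ (ι i) ≡ true × S (ι i) ≡ false → A i ≡ true
      B⊆A i (t , _) with anyFin-elim _ t
      ... | j , u with ∧-elim {A j} u
      ...   | p , q with ι-inj j i (==-sound q)
      ...     | refl = p
      countB : countFin (size G) B′ ≤ countFin (size H) (λ i → B′ (ι i))
      countB = count-≤-image (λ i → B′ (ι i)) B′ ι pre
        where
        pre : ∀ v → B′ v ≡ true → ∃[ i ] (B′ (ι i) ≡ true × ι i ≡ v)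
        pre v t with anyFin-elim _ (proj₁ (B′⊆ v t))
        ... | i , u = i , subst (λ w → B′ w ≡ true) (sym e) t , e
          where e = ==-sound (proj₂ (∧-elim {A i} u))
      farNE : ∀ {i j} → ¬ Path remaining R (ι i) (ι j) → i ≢ j
      farNE f refl = f stop
      sameAdj : ∀ i j i′ j′ → ¬ Path remaining R (ι i) (ι j) → ¬ Path remaining R (ι i′) (ι j′) → lH i ≡ lH i′ → lH j ≡ lH j′ → adj H i j ≡ adj H i′ j′
      sameAdj i j i′ j′ f f′ e e′ = trans (ι-adj i j (farNE f)) (trans
        (cong₂ _∨_ (pdet pl _ _ _ _ f f′ e e′) (pdet pl _ _ _ _ (rev f) (rev f′) e′ e)) (sym (ι-adj i′ j′ (farNE f′))))
        where
        rev : ∀ {u v} → ¬ Path remaining R u v → ¬ Path remaining R v u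
        rev f p = f (reverse (msym context) p)
      F-far : ∀ i j → ¬ Path remaining R (ι i) (ι j) → F (lH i) (lH j) ≡ adj H i j
      F-far i j f = iff⇒≡ to λ t → anyFin-intro _ i (anyFin-intro _ j
          (∧-intro (∧-intro (==-refl (lH i)) (==-refl (lH j))) (∧-intro (not-true (¬Path⇒far f)) t)))
        where
        to : F (lH i) (lH j) ≡ true → adj H i j ≡ true
        to t with anyFin-elim _ t
        ... | i′ , t′ with anyFin-elim _ t′
        ...   | j′ , u with ∧-elim {(lH i′ == lH i) ∧ (lH j′ == lH j)} u
        ...     | u₁ , u₂ with ∧-elim {lH i′ == lH i} u₁ | ∧-elim {far i′ j′} u₂
        ...       | e , e′ | f′ , a = trans (sameAdj i j i′ j′ f (far⇒¬Path (not-true⇒false f′)) (sym (==-sound e)) (sym (==-sound e′))) a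
      step-near : ∀ i j → flipsAdj (Data.List.tabulate (labelFlip lH F)) (adj H) i j ≡ true → Path remaining R (ι i) (ι j)
      step-near i j t with bool-cases (near remaining R (ι i) (ι j))
      ... | inj₁ h = near-sound R h
      ... | inj₂ h = ⊥-elim (true≢false t (labelFlips-erase lH F (adj H) i j (F-far i j f)
                       (trans (F-far j i (λ p → f (reverse (msym context) p))) (adj-sym H j i))))
        where f = far⇒¬Path h
      long : ∀ {r i j} → Walk (flipsAdj (Data.List.tabulate (labelFlip lH F)) (adj H)) (λ _ → ⊤) r i j → Path remaining (r * R) (ι i) (ι j)
      long here = stop
      long (step e _ w) = step-near _ _ e ▹▹ long w
      toWalk : ∀ {r x y} → Path remaining r x y → Walk (adj G) (λ v → S v ≡ false) r x y
      toWalk stop = here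
      toWalk (_▸_ {x = x} {y} e p) with restrict-elim {a = adj G} {λ x → not (deleted x)} {x} {y} e
      ... | a , _ , d = step a (≢true⇒false λ t → true≢false (deleted-S y t) (not-true⇒false d)) (toWalk p)
      indepB : IndepIn (flipsAdj (Data.List.tabulate (labelFlip lH F)) (adj H)) (λ _ → ⊤) r (λ i → B′ (ι i))
      indepB i j bi bj ne w = indep (ι i) (ι j) bi bj (λ e → ne (ι-inj i j e)) (toWalk (long w))

-- Counting edges of shallow minors

edgeCount≡∑ : ∀ H → edgeCount H ≡ ∑ (size H) (λ u → countFin (size H) (λ v → ⌊ toℕ u <? toℕ v ⌋ ∧ adj H u v))
edgeCount≡∑ H = apply (unique _ (λ _ → refl) (λ _ _ → refl))
  where
  unique : (s : (m : ℕ) → (Fin m → ℕ) → ℕ) → (∀ f → s 0 f ≡ 0) → (∀ m f → s (suc m) f ≡ f zero + s m (λ i → f (suc i))) →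
           ∀ m f → s m f ≡ ∑ m f
  unique s z c zero    f = z f
  unique s z c (suc m) f = trans (c m f) (cong (f zero +_) (unique s z c m (λ i → f (suc i))))
  -- The blank is the local summation function of edgeCount, which has no name in scope.
  apply : (∀ m (f : Fin m → ℕ) → _ ≡ ∑ m f) → edgeCount H ≡ ∑ (size H) (λ u → countFin (size H) (λ v → ⌊ toℕ u <? toℕ v ⌋ ∧ adj H u v))
  apply eq with size H | (λ u → countFin (size H) (λ v → ⌊ toℕ u <? toℕ v ⌋ ∧ adj H u v))
  ... | m | f = eq m f

∑∑ : (m : ℕ) → Rel m → ℕ
∑∑ m Q = ∑ m (λ u → countFin m (Q u))

∑∑≡ : ∀ m (Q : Rel m) → ∑∑ m Q ≡ ∑ m (λ u → ∑ m (λ v → indicator (Q u v)))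
∑∑≡ m Q = ∑-cong (λ u → count≡∑ m (Q u))

∑∑-swap : ∀ m (Q : Rel m) → ∑∑ m (λ u v → Q v u) ≡ ∑∑ m Q
∑∑-swap m Q = trans (∑∑≡ m (λ u v → Q v u)) (trans (∑-swap m m (λ u v → indicator (Q v u))) (sym (∑∑≡ m Q)))

∑∑-∪ : ∀ m (Q A B : Rel m) → (∀ u v → Q u v ≡ true → A u v ≡ true ⊎ B u v ≡ true) → ∑∑ m Q ≤ ∑∑ m A + ∑∑ m B
∑∑-∪ m Q A B h = begin
  ∑∑ m Q                                                     ≤⟨ ∑-mono (λ u → lem u) ⟩
  ∑ m (λ u → countFin m (A u) + countFin m (B u))            ≡⟨ ∑-+ (λ u → countFin m (A u)) (λ u → countFin m (B u)) ⟩
  ∑∑ m A + ∑∑ m B                                            ∎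
  where
  open ℕₚ.≤-Reasoning
  lem : ∀ u → countFin m (Q u) ≤ countFin m (A u) + countFin m (B u)
  lem u = begin
    countFin m (Q u)                                   ≤⟨ count-≤-list (Q u) (elems (A u) ++ elems (B u)) mem ⟩
    length (elems (A u) ++ elems (B u))                ≡⟨ Listₚ.length-++ (elems (A u)) ⟩
    length (elems (A u)) + length (elems (B u))        ≡⟨ cong₂ _+_ (elems-length (A u)) (elems-length (B u)) ⟩
    countFin m (A u) + countFin m (B u)                ∎
    where
    mem : ∀ v → Q u v ≡ true → v ∈ elems (A u) ++ elems (B u)
    mem v t with h u v t
    ... | inj₁ q = ∈ₚ.∈-++⁺ˡ (elems-complete (A u) v q)
    ... | inj₂ q = ∈ₚ.∈-++⁺ʳ (elems (A u)) (elems-complete (B u) v q)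

degree-sum : ∀ H → ∑∑ (size H) (adj H) ≤ edgeCount H + edgeCount H
degree-sum H = subst (λ e → ∑∑ (size H) (adj H) ≤ e) (cong₂ _+_ (sym (edgeCount≡∑ H)) (trans (∑∑-swap (size H) up) (sym (edgeCount≡∑ H))))
  (∑∑-∪ (size H) (adj H) up (λ u v → up v u) split)
  where
  up : Rel (size H)
  up u v = ⌊ toℕ u <? toℕ v ⌋ ∧ adj H u v
  split : ∀ u v → adj H u v ≡ true → up u v ≡ true ⊎ up v u ≡ true
  split u v t with ℕₚ.<-cmp (toℕ u) (toℕ v)
  ... | Relation.Binary.tri< l _ _ = inj₁ (∧-intro (⌊⌋-complete (toℕ u <? toℕ v) l) t)
  ... | Relation.Binary.tri> _ _ l = inj₂ (∧-intro (⌊⌋-complete (toℕ v <? toℕ u) l) (trans (adj-sym H v u) t))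
  ... | Relation.Binary.tri≈ _ e _ with Finₚ.toℕ-injective e
  ...   | refl = ⊥-elim (true≢false t (adj-irr H u))

enum : ∀ {n} (p : Fin n → Bool) → Fin (countFin n p) → Fin n
enum {suc n} p i with p zero
enum {suc n} p zero    | true  = zero
enum {suc n} p (suc i) | true  = suc (enum (λ j → p (suc j)) i)
enum {suc n} p i       | false = suc (enum (λ j → p (suc j)) i)

enum-injective : ∀ {n} (p : Fin n → Bool) i j → enum p i ≡ enum p j → i ≡ j
enum-injective {suc n} p i j e with p zero
enum-injective {suc n} p zero    zero    e | true  = refl
enum-injective {suc n} p (suc i) (suc j) e | true  = cong suc (enum-injective _ i j (suc-injective e))
enum-injective {suc n} p i       j       e | false = enum-injective _ i j (suc-injective e)

enum-sound : ∀ {n} (p : Fin n → Bool) i → p (enum p i) ≡ true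
enum-sound {suc n} p i with p zero in eq
enum-sound {suc n} p zero    | true  = eq
enum-sound {suc n} p (suc i) | true  = enum-sound (λ j → p (suc j)) i
enum-sound {suc n} p i       | false = enum-sound (λ j → p (suc j)) i

∑-enum : ∀ {n} (p : Fin n → Bool) (g : Fin n → ℕ) → (∀ x → p x ≡ false → g x ≡ 0) → ∑ n g ≤ ∑ (countFin n p) (λ i → g (enum p i))
∑-enum {zero}  p g h = z≤n
∑-enum {suc n} p g h with p zero in eq
... | true  = ℕₚ.+-monoʳ-≤ (g zero) (∑-enum (λ j → p (suc j)) (λ j → g (suc j)) (λ x → h (suc x)))
... | false rewrite h zero eq = ∑-enum (λ j → p (suc j)) (λ j → g (suc j)) (λ x → h (suc x))

just-injective : ∀ {A : Set} {x y : A} → just x ≡ just y → x ≡ y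
just-injective refl = refl

-- Branch sets are named by their centres, so a minor can be treated as a relation `Q` on the
-- vertices of `G`; only here is it renumbered to a graph on `Fin N` and symmetrised. Degree sums
-- count edges twice, whence `b * N + b * N`.
module MinorDegrees (G : Graph) (ρ b : ℕ) (bound : ∀ H → ShallowMinor ρ H G → edgeCount H ≤ b * size H)
  (own : Fin (size G) → Maybe (Fin (size G))) (Z : Fin (size G) → Bool)
  (own-centre : ∀ c → Z c ≡ true → own c ≡ just c) (own-Z : ∀ x c → own x ≡ just c → Z c ≡ true)
  (own-radius : ∀ x c → own x ≡ just c → Path (restrict (adj G) (λ y → is (own y) c)) ρ c x) where

  private
    n = size G
    N = countFin n Z

  module _ (Q : Rel n) (Q-minor : ∀ u v → Q u v ≡ true → Z u ≡ true × Z v ≡ true × u ≢ v ×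
              ∃[ x ] ∃[ y ] (own x ≡ just u × own y ≡ just v × adj G x y ≡ true)) where

    private
      minorAdj : Rel N
      minorAdj i j = Q (enum Z i) (enum Z j) ∨ Q (enum Z j) (enum Z i)

      index : Maybe (Fin n) → Maybe (Fin N)
      index nothing  = nothing
      index (just c) = first (λ i → enum Z i == c)

      index-sound : ∀ o {i} → index o ≡ just i → o ≡ just (enum Z i)
      index-sound (just c) e = cong just (sym (==-sound (first-sound (λ i → enum Z i == c) e)))

      index-complete : ∀ i → index (just (enum Z i)) ≡ just i
      index-complete i with first-complete (λ j → enum Z j == enum Z i) i (==-refl (enum Z i))
      ... | j , e = trans e (cong just (enum-injective Z j i (==-sound (first-sound (λ j → enum Z j == enum Z i) e))))

      H : Graph
      H = record
        { size = N ; adj = minorAdj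
        ; adj-sym = λ i j → Data.Bool.Properties.∨-comm (Q (enum Z i) (enum Z j)) _
        ; adj-irr = λ i → ≢true⇒false λ t → irr i (∨-elim {Q (enum Z i) (enum Z i)} t) }
        where
        irr : ∀ i → Q (enum Z i) (enum Z i) ≡ true ⊎ Q (enum Z i) (enum Z i) ≡ true → ⊥
        irr i (inj₁ t) = proj₁ (proj₂ (proj₂ (Q-minor _ _ t))) refl
        irr i (inj₂ t) = proj₁ (proj₂ (proj₂ (Q-minor _ _ t))) refl

      toWalk : ∀ i {r x y} → Path (restrict (adj G) (λ y → is (own y) (enum Z i))) r x y → Walk (adj G) (λ y → index (own y) ≡ just i) r x y
      toWalk i stop = here
      toWalk i (_▸_ {x = x} {y} e p) with restrict-elim {a = adj G} {λ y → is (own y) (enum Z i)} {x} {y} e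
      ... | a , _ , o = step a (trans (cong index (is-sound (own y) o)) (index-complete i)) (toWalk i p)

      minor : ShallowMinor ρ H G
      minor = record
        { branch = λ x → index (own x)
        ; center = enum Z
        ; center-in = λ i → trans (cong index (own-centre (enum Z i) (enum-sound Z i))) (index-complete i)
        ; radius = λ i x e → toWalk i (own-radius x (enum Z i) (index-sound (own x) e))
        ; edges = λ i j t → go i j (∨-elim {Q (enum Z i) (enum Z j)} t) }
        where
        owned⇒ : ∀ {x i} → own x ≡ just (enum Z i) → index (own x) ≡ just i
        owned⇒ {i = i} e = trans (cong index e) (index-complete i)
        go : ∀ i j → Q (enum Z i) (enum Z j) ≡ true ⊎ Q (enum Z j) (enum Z i) ≡ true → _
        go i j (inj₁ t) with Q-minor _ _ t
        ... | _ , _ , _ , x , y , o , o′ , a = x , y , owned⇒ o , owned⇒ o′ , a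
        go i j (inj₂ t) with Q-minor _ _ t
        ... | _ , _ , _ , x , y , o , o′ , a = y , x , owned⇒ o′ , owned⇒ o , trans (adj-sym G y x) a

    minor-degrees : ∑∑ n Q ≤ b * N + b * N
    minor-degrees = begin
      ∑∑ n Q                                                              ≡⟨ ∑∑≡ n Q ⟩
      ∑ n (λ u → ∑ n (λ v → indicator (Q u v)))                           ≤⟨ ∑-enum Z _ outer ⟩
      ∑ N (λ i → ∑ n (λ v → indicator (Q (enum Z i) v)))                  ≤⟨ ∑-mono (λ i → ∑-enum Z _ (inner (enum Z i))) ⟩
      ∑ N (λ i → ∑ N (λ j → indicator (Q (enum Z i) (enum Z j))))         ≡⟨ sym (∑∑≡ N (λ i j → Q (enum Z i) (enum Z j))) ⟩
      ∑∑ N (λ i j → Q (enum Z i) (enum Z j))                              ≤⟨ ∑-mono (λ i → count-mono (λ j → Q (enum Z i) (enum Z j)) (minorAdj i) (λ j t → ∨-introˡ t)) ⟩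
      ∑∑ N minorAdj                                                       ≤⟨ degree-sum H ⟩
      edgeCount H + edgeCount H                                           ≤⟨ ℕₚ.+-mono-≤ (bound H minor) (bound H minor) ⟩
      b * N + b * N                                                       ∎
      where
      open ℕₚ.≤-Reasoning
      inner : ∀ u v → Z v ≡ false → indicator (Q u v) ≡ 0
      inner u v z with Q u v in eq
      ... | false = refl
      ... | true = ⊥-elim (true≢false (proj₁ (proj₂ (Q-minor u v eq))) z)
      outer : ∀ u → Z u ≡ false → ∑ n (λ v → indicator (Q u v)) ≡ 0
      outer u z = trans (∑-cong λ v → lem v) (∑-zero n)
        where
        lem : ∀ v → indicator (Q u v) ≡ 0
        lem v with Q u v in eq
        ... | false = refl
        ... | true = ⊥-elim (true≢false (proj₁ (Q-minor u v eq)) z)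

-- Orders with small weak reachability sets

∑-strict : ∀ {m} {f g : Fin m → ℕ} → (∀ i → f i ≤ g i) → ∀ i → f i < g i → ∑ m f < ∑ m g
∑-strict {suc m} h zero    l = ℕₚ.+-mono-<-≤ l (∑-mono (λ i → h (suc i)))
∑-strict {suc m} h (suc i) l = ℕₚ.+-mono-≤-< (h zero) (∑-strict (λ i → h (suc i)) i l)

count-≤-∪ : ∀ {n} (p q : Fin n → Bool) (xs : List (Fin n)) → (∀ i → p i ≡ true → q i ≡ true ⊎ i ∈ xs) → countFin n p ≤ countFin n q + length xs
count-≤-∪ p q xs h = subst (countFin _ p ≤_) (trans (Listₚ.length-++ (elems q)) (cong (_+ length xs) (elems-length q)))
  (count-≤-list p (elems q ++ xs) mem)
  where
  mem : ∀ i → p i ≡ true → i ∈ elems q ++ xs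
  mem i t with h i t
  ... | inj₁ u = ∈ₚ.∈-++⁺ˡ (elems-complete q i u)
  ... | inj₂ u = ∈ₚ.∈-++⁺ʳ (elems q) u

at-clip : ∀ {n} {a : Rel n} {r x y} (w : Path a r x y) s → ∃[ t ] at w (toℕ {suc r} t) ≡ at w s
at-clip w       zero    = zero , refl
at-clip stop    (suc s) = zero , refl
at-clip (e ▸ w) (suc s) with at-clip w s
... | t , q = suc t , q

at-end : ∀ {n} {a : Rel n} {r x y} (w : Path a r x y) → ∃[ s ] at w s ≡ y
at-end stop    = 0 , refl
at-end (e ▸ w) with at-end w
... | s , q = suc s , q

-- Here `4 * d` is the degree allowed for an owner in the first minor, at most `c` times the size of
-- `S` vertices are owned, at least one in `2 * suc (4 * d)` elements of `S` lies in the independent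
-- set, and `f r + f r` bounds the average degree of the second minor.
hitBound : (ℕ → ℕ) → ℕ → ℕ
hitBound f r = let d = suc (f (r + r)) ; c = 1 + suc (r + r) * (f (r + r) + f (r + r)) in
  (f r + f r) * (c * (2 * suc (4 * d)))

private
  extension-budget : ∀ s e j j′ l → l ≤ e → j < j′ → s + e * j + l ≤ s + e * j′
  extension-budget s e j j′ l h h′ = begin
    s + e * j + l          ≤⟨ ℕₚ.+-monoʳ-≤ (s + e * j) h ⟩
    s + e * j + e          ≡⟨ solve 3 (λ s d j → s :+ d :* j :+ d := s :+ d :* (con 1 :+ j)) refl s e j ⟩
    s + e * suc j          ≤⟨ ℕₚ.+-monoʳ-≤ s (ℕₚ.*-monoʳ-≤ e h′) ⟩
    s + e * j′             ∎
    where
    open ℕₚ.≤-Reasoning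
    open ℕSolver.+-*-Solver

  majority-light : ∀ s l x → s ≤ l + x → 2 * x ≤ s → s ≤ 2 * l
  majority-light s l x split few = ℕₚ.+-cancelʳ-≤ s s (2 * l) (begin
    s + s                    ≤⟨ ℕₚ.+-mono-≤ split split ⟩
    (l + x) + (l + x)        ≡⟨ solve 2 (λ l x → (l :+ x) :+ (l :+ x) := con 2 :* l :+ con 2 :* x) refl l x ⟩
    2 * l + 2 * x            ≤⟨ ℕₚ.+-monoʳ-≤ (2 * l) few ⟩
    2 * l + s                ∎)
    where
    open ℕₚ.≤-Reasoning
    open ℕSolver.+-*-Solver

  few-heavy : ∀ k x s t → x * suc (4 * suc k) ≤ t → t ≤ k * s + k * s → 2 * x ≤ s
  few-heavy k x s t h h′ = ℕₚ.*-cancelˡ-≤ (2 * suc k) (begin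
    (2 * suc k) * (2 * x)    ≡⟨ solve 2 (λ e x → (con 2 :* e) :* (con 2 :* x) := x :* (con 4 :* e)) refl (suc k) x ⟩
    x * (4 * suc k)          ≤⟨ ℕₚ.*-monoʳ-≤ x (ℕₚ.n≤1+n (4 * suc k)) ⟩
    x * suc (4 * suc k)      ≤⟨ h ⟩
    t                        ≤⟨ h′ ⟩
    k * s + k * s            ≤⟨ ℕₚ.+-mono-≤ (ℕₚ.*-monoˡ-≤ s (ℕₚ.n≤1+n k)) (ℕₚ.*-monoˡ-≤ s (ℕₚ.n≤1+n k)) ⟩
    suc k * s + suc k * s    ≡⟨ solve 2 (λ e s → e :* s :+ e :* s := (con 2 :* e) :* s) refl (suc k) s ⟩
    (2 * suc k) * s          ∎)
    where
    open ℕₚ.≤-Reasoning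
    open ℕSolver.+-*-Solver

  owned-budget : ∀ s e g o j → o ≤ s + e * j → j ≤ g * s + g * s → o ≤ s * (1 + e * (g + g))
  owned-budget s e g o j h h′ = begin
    o                              ≤⟨ h ⟩
    s + e * j                      ≤⟨ ℕₚ.+-monoʳ-≤ s (ℕₚ.*-monoʳ-≤ e h′) ⟩
    s + e * (g * s + g * s)        ≡⟨ solve 3 (λ s e g → s :+ e :* (g :* s :+ g :* s) := s :* (con 1 :+ e :* (g :+ g))) refl s e g ⟩
    s * (1 + e * (g + g))          ∎
    where
    open ℕₚ.≤-Reasoning
    open ℕSolver.+-*-Solver

  minor-budget : ∀ g o s c i e → o ≤ s * c → s ≤ 2 * (i * e) → g * o + g * o ≤ i * ((g + g) * (c * (2 * e)))
  minor-budget g o s c i e h h′ = begin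
    g * o + g * o                                          ≤⟨ ℕₚ.+-mono-≤ (ℕₚ.*-monoʳ-≤ g h) (ℕₚ.*-monoʳ-≤ g h) ⟩
    g * (s * c) + g * (s * c)                              ≤⟨ ℕₚ.+-mono-≤ (ℕₚ.*-monoʳ-≤ g (ℕₚ.*-monoˡ-≤ c h′)) (ℕₚ.*-monoʳ-≤ g (ℕₚ.*-monoˡ-≤ c h′)) ⟩
    g * (2 * (i * e) * c) + g * (2 * (i * e) * c)          ≡⟨ solve 4 (λ g i e k → g :* (con 2 :* (i :* e) :* k) :+ g :* (con 2 :* (i :* e) :* k) := i :* ((g :+ g) :* (k :* (con 2 :* e)))) refl g i e c ⟩
    i * ((g + g) * (c * (2 * e)))                          ∎
    where
    open ℕₚ.≤-Reasoning
    open ℕSolver.+-*-Solver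

  no-surplus : ∀ i s h e → 0 < s → s ≤ 2 * (i * e) → i * suc h ≤ i * h → ⊥
  no-surplus zero    s h e p q t = ℕₚ.n≮0 (ℕₚ.<-≤-trans p q)
  no-surplus (suc i) s h e p q t = ℕₚ.1+n≰n (ℕₚ.*-cancelˡ-≤ (suc i) t)

-- Markov's inequality: a degree sum of at most `2k` per element leaves at most half of `S` above
-- `4 * suc k`. Using `suc k` keeps the cancelled factor positive.
low-degree : ∀ {n} (S : Fin n → Bool) (deg : Fin n → ℕ) k → ∑ n deg ≤ k * countFin n S + k * countFin n S →
             countFin n S ≤ 2 * countFin n (λ u → S u ∧ ⌊ deg u ≤? 4 * suc k ⌋)
low-degree {n} S deg k total = majority-light (countFin n S) (countFin n low) (countFin n high) split
  (few-heavy k (countFin n high) (countFin n S) (∑ n deg) (∑-restricted high deg (suc (4 * suc k)) large) total)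
  where
  low high : Fin n → Bool
  low u  = S u ∧ ⌊ deg u ≤? 4 * suc k ⌋
  high u = S u ∧ not ⌊ deg u ≤? 4 * suc k ⌋
  large : ∀ u → high u ≡ true → suc (4 * suc k) ≤ deg u
  large u h = ℕₚ.≰⇒> (⌊⌋-refute (deg u ≤? 4 * suc k) (not-true⇒false (proj₂ (∧-elim {S u} h))))
  either : ∀ u → S u ≡ true → ⌊ deg u ≤? 4 * suc k ⌋ ≡ true ⊎ ⌊ deg u ≤? 4 * suc k ⌋ ≡ false → low u ≡ true ⊎ u ∈ elems high
  either u s (inj₁ t) = inj₁ (∧-intro s t)
  either u s (inj₂ t) = inj₂ (elems-complete high u (∧-intro s (not-true t)))
  split : countFin n S ≤ countFin n low + countFin n high
  split = subst (λ z → countFin n S ≤ countFin n low + z) (elems-length high) (count-≤-∪ S low (elems high) λ u s → either u s (bool-cases ⌊ deg u ≤? 4 * suc k ⌋))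

module IndependentSet {n} (J : Rel n) (J-sym : ∀ {x y} → J x y ≡ true → J y x ≡ true) (J-irr : ∀ x → J x x ≡ false) where

  clash : Fin n → (Fin n → Bool) → Bool
  clash x B = anyFin n (λ y → B y ∧ J x y)

  indep : List (Fin n) → Fin n → Bool
  indep []       z = false
  indep (x ∷ xs) z = if clash x (indep xs) then indep xs z else ((z == x) ∨ indep xs z)

  indep-∈ : ∀ xs {z} → indep xs z ≡ true → z ∈ xs
  indep-∈ (x ∷ xs) {z} h with clash x (indep xs)
  ... | true = there (indep-∈ xs h)
  ... | false with ∨-elim {z == x} h
  ...   | inj₁ e = here (==-sound e)
  ...   | inj₂ e = there (indep-∈ xs e)

  indep-apart : ∀ xs {y z} → indep xs y ≡ true → indep xs z ≡ true → J y z ≡ false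
  indep-apart (x ∷ xs) {y} {z} h h′ with bool-cases (clash x (indep xs))
  ... | inj₁ e rewrite e = indep-apart xs h h′
  ... | inj₂ e rewrite e with ∨-elim {y == x} h | ∨-elim {z == x} h′
  ...   | inj₂ p | inj₂ q = indep-apart xs p q
  ...   | inj₁ p | inj₂ q with ==-sound {x = y} {x} p
  ...     | refl = ≢true⇒false λ t → true≢false (anyFin-intro (λ y → indep xs y ∧ J x y) z (∧-intro q t)) e
  indep-apart (x ∷ xs) {y} {z} h h′ | inj₂ e | inj₂ p | inj₁ q with ==-sound {x = z} {x} q
  ...     | refl = ≢true⇒false λ t → true≢false (anyFin-intro (λ y → indep xs y ∧ J x y) y (∧-intro p (J-sym t))) e
  indep-apart (x ∷ xs) {y} {z} h h′ | inj₂ e | inj₁ p | inj₁ q with ==-sound {x = y} {x} p | ==-sound {x = z} {x} q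
  ...     | refl | refl = J-irr x

  indep-maximal : ∀ xs {z} → z ∈ xs → indep xs z ≡ true ⊎ (∃[ y ] (indep xs y ≡ true × J y z ≡ true))
  indep-maximal (x ∷ xs) {z} h with bool-cases (clash x (indep xs))
  indep-maximal (x ∷ xs) {z} (there h) | inj₁ e rewrite e = indep-maximal xs h
  indep-maximal (x ∷ xs) {z} (here refl) | inj₁ e with anyFin-elim _ e
  ... | y , t with ∧-elim {indep xs y} t
  ...   | p , q rewrite e = inj₂ (y , p , J-sym q)
  indep-maximal (x ∷ xs) {z} (here refl) | inj₂ e rewrite e = inj₁ (∨-introˡ (==-refl x))
  indep-maximal (x ∷ xs) {z} (there h) | inj₂ e rewrite e with indep-maximal xs h
  ... | inj₁ p = inj₁ (∨-introʳ {z == x} p)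
  ... | inj₂ (y , p , q) = inj₂ (y , ∨-introʳ {y == x} p , q)

-- For a vertex set S we look for v ∈ S and few vertices that hit all short walks from v to S.
-- Grow disjoint connected sets owned by the vertices of S, joining non-adjacent owners through free
-- vertices until this is impossible; the hitting set of v consists of the owned vertices that v
-- reaches through free vertices.  Were all these sets large, then the free neighbourhoods of an
-- independent set of low-degree owners would be the branch sets of a second minor of too many edges.
module Hitting (G : Graph) (f : ℕ → ℕ) (bound : ∀ ρ H → ShallowMinor ρ H G → edgeCount H ≤ f ρ * size H)
  (r : ℕ) (S : Fin (size G) → Bool) where

  private
    n = size G
    Vx = Fin n
    a = adj G

  Own : Set
  Own = Vx → Maybe Vx

  owned : Own → Vx → Bool
  owned own x = Maybe.is-just (own x)

  opaque
    zone : Own → Vx → Vx → Bool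
    zone own v x = (x == v) ∨ not (owned own x)

    zone-self : ∀ own v → zone own v v ≡ true
    zone-self own v = ∨-introˡ (==-refl v)

    zone-elim : ∀ own v {x} → zone own v x ≡ true → x ≡ v ⊎ owned own x ≡ false
    zone-elim own v {x} h with ∨-elim {x == v} h
    ... | inj₁ e = inj₁ (==-sound e)
    ... | inj₂ e = inj₂ (not-true⇒false e)

    zone-free : ∀ own v {x} → owned own x ≡ false → zone own v x ≡ true
    zone-free own v {x} e = ∨-introʳ {x == v} (not-true e)

  free : Own → Vx → Rel n
  free own v = restrict a (zone own v)

  opaque
    joined : Own → Rel n
    joined own u v = (S u ∧ (S v ∧ not (u == v))) ∧ anyFin n (λ x → anyFin n (λ y → is (own x) u ∧ (is (own y) v ∧ a x y)))

    joined-intro : ∀ own {u v x y} → S u ≡ true → S v ≡ true → u ≢ v → own x ≡ just u → own y ≡ just v → a x y ≡ true → joined own u v ≡ true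
    joined-intro own {u} {v} {x} {y} su sv ne o o′ e = ∧-intro (∧-intro su (∧-intro sv (not-true (⌊⌋-false (u ≟ v) ne))))
      (anyFin-intro _ x (anyFin-intro _ y (∧-intro (is-complete (own x) o) (∧-intro (is-complete (own y) o′) e))))

    joined-elim : ∀ own {u v} → joined own u v ≡ true → S u ≡ true × S v ≡ true × u ≢ v ×
                  ∃[ x ] ∃[ y ] (own x ≡ just u × own y ≡ just v × a x y ≡ true)
    joined-elim own {u} {v} h with ∧-elim {S u ∧ (S v ∧ not (u == v))} h
    ... | h₁ , h₂ with ∧-elim {S u} h₁ | anyFin-elim _ h₂
    ...   | su , h₃ | x , h₄ with ∧-elim {S v} h₃ | anyFin-elim _ h₄
    ...     | sv , ne | y , h₅ with ∧-elim {is (own x) u} h₅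
    ...       | o , h₆ with ∧-elim {is (own y) v} h₆
    ...         | o′ , e = su , sv , ⌊⌋-refute (u ≟ v) (not-true⇒false ne) , x , y , is-sound (own x) o , is-sound (own y) o′ , e

  joined-sym : ∀ own {u v} → joined own u v ≡ true → joined own v u ≡ true
  joined-sym own h with joined-elim own h
  ... | su , sv , ne , x , y , o , o′ , e = joined-intro own sv su (λ q → ne (sym q)) o′ o (trans (adj-sym G y x) e)

  -- The connecting walk starts at the owner `u` itself, the centre of its set. Absorbing the walk
  -- therefore keeps the radius within `r + r`, however often sets are extended.
  joinable : Own → Rel n
  joinable own u v = (S u ∧ (S v ∧ not (u == v))) ∧ (not (joined own u v) ∧ anyFin n (λ y → near (free own u) (r + r) u y ∧ a y v))

  record Inv (own : Own) : Set where
    field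
      centre : ∀ c → S c ≡ true → own c ≡ just c
      ownS   : ∀ x c → own x ≡ just c → S c ≡ true
      rad    : ∀ x c → own x ≡ just c → Path (restrict a (λ y → is (own y) c)) (r + r) c x
      small  : countFin n (owned own) ≤ countFin n S + suc (r + r) * ∑∑ n (joined own)
  open Inv

  owned-just : ∀ own {x c} → own x ≡ just c → owned own x ≡ true
  owned-just own {x} e rewrite e = refl

  module _ (own : Own) (inv : Inv own) {u v} (su : S u ≡ true) (sv : S v ≡ true) (ne : u ≢ v) (nj : joined own u v ≡ false)
           {y} (w : Path (free own u) (r + r) u y) (yv : a y v ≡ true) where

    private
      on : Vx → Bool
      on x = anyFin (suc (r + r)) (λ t → at w (toℕ t) == x)

      own′ : Own
      own′ x = if owned own x then own x else (if on x then just u else nothing)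

      old : ∀ {x} → owned own x ≡ true → own′ x ≡ own x
      old e rewrite e = refl

      new : ∀ {x} → owned own x ≡ false → on x ≡ true → own′ x ≡ just u
      new e o rewrite e | o = refl

      cases : ∀ x {c} → own′ x ≡ just c → own x ≡ just c ⊎ (on x ≡ true × c ≡ u)
      cases x e with owned own x | on x
      ... | true  | _ = inj₁ e
      ... | false | true = inj₂ (refl , sym (just-injective e))
      cases x () | false | false

      keep : ∀ x {c} → own x ≡ just c → own′ x ≡ just c
      keep x e = trans (old (owned-just own e)) e

      at-on : ∀ s → on (at w s) ≡ true
      at-on s with at-clip w s
      ... | t , q = anyFin-intro (λ t → at w (toℕ t) == at w s) t (subst (λ z → (at w (toℕ t) == z) ≡ true) q (==-refl _))

      at-own : ∀ s → own′ (at w s) ≡ just u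
      at-own s with zone-elim own u (restrict-end {a = a} {zone own u} (prefix w s) (zone-self own u))
      ... | inj₁ e rewrite e = keep u (centre inv u su)
      ... | inj₂ e = new e (at-on s)

      y-own : own′ y ≡ just u
      y-own with at-end w
      ... | s , q = subst (λ z → own′ z ≡ just u) q (at-own s)

      more : ∀ p q → joined own p q ≡ true → joined own′ p q ≡ true
      more p q h with joined-elim own h
      ... | sp , sq , pq , x , z , o , o′ , e = joined-intro own′ sp sq pq (keep x o) (keep z o′) e

      gain : joined own′ u v ≡ true
      gain = joined-intro own′ su sv ne y-own (keep v (centre inv v sv)) yv

      grow : ∑∑ n (joined own) < ∑∑ n (joined own′)
      grow = ∑-strict (λ p → count-mono (joined own p) (joined own′ p) (more p)) u
                      (count-strict (joined own u) (joined own′ u) (more u) v gain nj)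

      inv′ : Inv own′
      inv′ = record
        { centre = λ c s → keep c (centre inv c s)
        ; ownS = λ x c e → ownS′ x c (cases x e)
        ; rad = λ x c e → rad′ x c (cases x e)
        ; small = small′ }
        where
        ownS′ : ∀ x c → own x ≡ just c ⊎ (on x ≡ true × c ≡ u) → S c ≡ true
        ownS′ x c (inj₁ e) = ownS inv x c e
        ownS′ x c (inj₂ (_ , refl)) = su
        rad′ : ∀ x c → own x ≡ just c ⊎ (on x ≡ true × c ≡ u) → Path (restrict a (λ y → is (own′ y) c)) (r + r) c x
        rad′ x c (inj₁ e) = mapPath (restrict-mono {a = a} {a} {λ y → is (own y) c} {λ y → is (own′ y) c} (λ _ _ t → t)
          (λ z t → is-complete (own′ z) (keep z (is-sound (own z) t)))) (rad inv x c e)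
        rad′ x c (inj₂ (o , refl)) with anyFin-elim _ o
        ... | t , q = subst (Path _ (r + r) u) (==-sound q)
          (weaken (ℕₚ.≤-pred (Finₚ.toℕ<n t))
            (mapPath (restrict-mono {a = free own u} {a} {λ y → is (own′ y) u} {λ y → is (own′ y) u} (restrict-forget {a = a} {zone own u}) (λ _ h → h))
              (prefixIn {a = free own u} {λ y → is (own′ y) u} w (λ s → is-complete (own′ (at w s)) (at-own s)) (toℕ t))))
        -- The at most `suc (r + r)` new vertices are charged to the pair `u`, `v`, which was not
        -- joined before.
        small′ : countFin n (owned own′) ≤ countFin n S + suc (r + r) * ∑∑ n (joined own′)
        small′ = begin
          countFin n (owned own′)                                                   ≤⟨ count-≤-∪ (owned own′) (owned own) path split ⟩
          countFin n (owned own) + length path                                      ≤⟨ ℕₚ.+-monoˡ-≤ _ (small inv) ⟩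
          countFin n S + suc (r + r) * ∑∑ n (joined own) + length path               ≤⟨ extension-budget (countFin n S) (suc (r + r)) (∑∑ n (joined own)) _ (length path) (ℕₚ.≤-reflexive (Listₚ.length-tabulate {n = suc (r + r)} (λ t → at w (toℕ t)))) grow ⟩
          countFin n S + suc (r + r) * ∑∑ n (joined own′)                            ∎
          where
          open ℕₚ.≤-Reasoning
          path : List Vx
          path = Data.List.tabulate {n = suc (r + r)} (λ t → at w (toℕ t))
          split : ∀ x → owned own′ x ≡ true → owned own x ≡ true ⊎ x ∈ path
          split x t with own′ x in eq
          split x t | just c with cases x eq
          ... | inj₁ e = inj₁ (owned-just own e)
          ... | inj₂ (o , _) with anyFin-elim (λ t → at w (toℕ {suc (r + r)} t) == x) o
          ...   | i , q = inj₂ (subst (_∈ path) (==-sound q) (∈ₚ.∈-tabulate⁺ {f = λ t → at w (toℕ {suc (r + r)} t)} i))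

      -- Otherwise `y` is `u`, and the edge from `u` to `v` would already join the two sets. Hence
      -- each extension uses up a free vertex and the process stops.
      y-free : owned own y ≡ false
      y-free with zone-elim own u (restrict-end {a = a} {zone own u} w (zone-self own u))
      ... | inj₂ e = e
      ... | inj₁ refl = ⊥-elim (true≢false (joined-intro own su sv ne (centre inv u su) (centre inv v sv) yv) nj)

    extend : ∃[ o ] (Inv o × countFin n (λ x → not (owned o x)) < countFin n (λ x → not (owned own x)))
    extend = own′ , inv′ , count-strict (λ x → not (owned own′ x)) (λ x → not (owned own x)) sub y (not-true y-free) (cong not (owned-just own′ y-own))
      where
      sub : ∀ x → not (owned own′ x) ≡ true → not (owned own x) ≡ true
      sub x t with bool-cases (owned own x)
      ... | inj₂ e = not-true e
      ... | inj₁ e = ⊥-elim (true≢false (trans (cong Maybe.is-just (old {x} e)) e) (not-true⇒false t))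

  saturated : ∃[ own ] (Inv own × (∀ u v → joinable own u v ≡ false))
  saturated = go (countFin n (λ x → not (owned own₀ x))) own₀ inv₀ ℕₚ.≤-refl
    where
    own₀ : Own
    own₀ x = if S x then just x else nothing
    only : ∀ x {c} → own₀ x ≡ just c → x ≡ c × S x ≡ true
    only x e with S x
    only x refl | true = refl , refl
    inv₀ : Inv own₀
    inv₀ = record
      { centre = λ c s → cong (λ b → if b then just c else nothing) s
      ; ownS = λ x c e → let q , s = only x e in subst (λ z → S z ≡ true) q s
      ; rad = λ x c e → subst (Path _ (r + r) c) (sym (proj₁ (only x e))) stop
      ; small = ℕₚ.≤-trans (count-mono (owned own₀) S sub) (ℕₚ.m≤m+n _ _) }
      where
      sub : ∀ x → owned own₀ x ≡ true → S x ≡ true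
      sub x t with S x
      ... | true = refl
    advance : ∀ own → Inv own → (∀ u v → joinable own u v ≡ false) ⊎
              (∃[ o ] (Inv o × countFin n (λ x → not (owned o x)) < countFin n (λ x → not (owned own x))))
    advance own inv with find₂ (joinable own)
    ... | inj₂ none = inj₁ none
    ... | inj₁ (u , v , h) with ∧-elim {S u ∧ (S v ∧ not (u == v))} h
    ...   | h₁ , h₂ with ∧-elim {S u} h₁ | ∧-elim {not (joined own u v)} h₂
    ...     | su , h₃ | nj , h₄ with ∧-elim {S v} h₃ | anyFin-elim _ h₄
    ...       | sv , ne | y , h₅ with ∧-elim {near (free own u) (r + r) u y} h₅
    ...         | w , yv = inj₂ (extend own inv su sv (⌊⌋-refute (u ≟ v) (not-true⇒false ne)) (not-true⇒false nj) (near-sound (r + r) w) yv)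
    go : ∀ fuel own → Inv own → countFin n (λ x → not (owned own x)) ≤ fuel → ∃[ own ] (Inv own × (∀ u v → joinable own u v ≡ false))
    go fuel own inv le with advance own inv
    go fuel       own inv le | inj₁ none = own , inv , none
    go zero       own inv le | inj₂ (own′ , inv′ , lt) = ⊥-elim (ℕₚ.n≮0 (ℕₚ.<-≤-trans lt le))
    go (suc fuel) own inv le | inj₂ (own′ , inv′ , lt) = go fuel own′ inv′ (ℕₚ.≤-pred (ℕₚ.≤-trans lt le))

  module Saturated (own : Own) (inv : Inv own) (sat : ∀ u v → joinable own u v ≡ false) where

    contacts : Vx → Vx → Bool
    contacts v m = (owned own m ∧ not (m == v)) ∧ anyFin n (λ y → near (free own v) r v y ∧ a y m)

    -- The contact is the first vertex of the walk outside the zone of `v`. That the rest is shorter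
    -- and stays in the same subrelation `c` is what allows hitting sets to be iterated along a walk
    -- that keeps above its end.
    hits : ∀ v {c : Rel n} → (∀ x y → c x y ≡ true → a x y ≡ true) → ∀ {k t} → k ≤ r → Path c k v t → S t ≡ true → t ≢ v →
           ∃[ m ] ∃[ k′ ] (contacts v m ≡ true × k′ < k × Path c k′ m t)
    hits v {c} c⊆a {k} {t} k≤r p st ne = go 0 k k≤r stop p
      where
      go : ∀ i k → i + k ≤ r → ∀ {x} → Path (free own v) i v x → Path c k x t → ∃[ m ] ∃[ k′ ] (contacts v m ≡ true × k′ < k × Path c k′ m t)
      go i k le q stop with zone-elim own v (restrict-end {a = a} {zone own v} q (zone-self own v))
      ... | inj₁ e = ⊥-elim (ne e)
      ... | inj₂ e = ⊥-elim (true≢false (owned-just own (centre inv t st)) e)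
      go i (suc k) le {x} q (_▸_ {y = y} e p) with bool-cases (zone own v y)
      ... | inj₁ z with go (suc i) k (subst (_≤ r) (ℕₚ.+-suc i k) le)
                       (snoc q (restrict-intro {a = a} {zone own v} {x} {y} (c⊆a x y e) (restrict-end {a = a} {zone own v} q (zone-self own v)) z)) p
      ...   | m , k′ , h , lt , p′ = m , k′ , h , ℕₚ.m≤n⇒m≤1+n lt , p′
      go i (suc k) le {x} q (_▸_ {y = y} e p) | inj₂ z = y , k , ∧-intro (∧-intro o (not-true (⌊⌋-false (y ≟ v) λ { refl → true≢false (zone-self own v) z })))
          (anyFin-intro _ x (∧-intro (near-complete (weaken (ℕₚ.≤-trans (ℕₚ.m≤m+n i (suc k)) le) q)) (c⊆a x y e))) , ℕₚ.n<1+n k , p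
        where
        o : owned own y ≡ true
        o with bool-cases (owned own y)
        ... | inj₁ t = t
        ... | inj₂ t = ⊥-elim (true≢false (zone-free own v t) z)

    private
      d : ℕ
      d = suc (f (r + r))
      deg : Vx → ℕ
      deg u = countFin n (joined own u)
      low : Vx → Bool
      low u = S u ∧ ⌊ deg u ≤? 4 * d ⌋
      |S| = countFin n S

      total : ∑∑ n (joined own) ≤ f (r + r) * |S| + f (r + r) * |S|
      total = MinorDegrees.minor-degrees G (r + r) (f (r + r)) (bound (r + r)) own S (centre inv) (ownS inv) (rad inv) (joined own) (λ u v h → joined-elim own h)

      S≤2low : |S| ≤ 2 * countFin n low
      S≤2low = low-degree S deg (f (r + r)) total

      open IndependentSet (joined own) (joined-sym own) (λ x → ≢true⇒false λ t → proj₁ (proj₂ (proj₂ (joined-elim own t))) refl)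

      I : Vx → Bool
      I = indep (elems low)

      I-low : ∀ {v} → I v ≡ true → S v ≡ true × deg v ≤ 4 * d
      I-low {v} h with ∧-elim {S v} (elems-sound low (indep-∈ (elems low) h))
      ... | s , t = s , ⌊⌋-sound (deg v ≤? 4 * d) t

      low≤I : countFin n low ≤ countFin n I * suc (4 * d)
      low≤I = begin
        countFin n low                                                      ≤⟨ count-≤-list low (concatMap star (elems I)) cover ⟩
        length (concatMap star (elems I))                                   ≤⟨ length-concatMap-≤ star (elems I) (λ v m → s≤s (ℕₚ.≤-trans (ℕₚ.≤-reflexive (elems-length (joined own v))) (proj₂ (I-low (elems-sound I m))))) ⟩
        length (elems I) * suc (4 * d)                                      ≡⟨ cong (_* suc (4 * d)) (elems-length I) ⟩
        countFin n I * suc (4 * d)                                          ∎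
        where
        open ℕₚ.≤-Reasoning
        star : Vx → List Vx
        star v = v ∷ elems (joined own v)
        cover : ∀ z → low z ≡ true → z ∈ concatMap star (elems I)
        cover z h with indep-maximal (elems low) (elems-complete low z h)
        ... | inj₁ p = ∈-concatMap star (elems I) (elems-complete I z p) (here refl)
        ... | inj₂ (y , p , q) = ∈-concatMap star (elems I) (elems-complete I y p) (there (elems-complete (joined own y) z q))

      -- A common free vertex would give a walk of at most `2r` steps through free vertices between
      -- two owners that are not joined, so they would be joinable, against saturation.
      meet : ∀ {v v′ z} → I v ≡ true → I v′ ≡ true → owned own z ≡ false → Path (free own v) r v z → Path (free own v′) r v′ z → v ≡ v′
      meet {v} {v′} {z} iv iv′ zf p q with v ≟ v′
      ... | yes e = e
      ... | no ne = ⊥-elim (true≢false good (sat v v′))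
        where
        sv = proj₁ (I-low iv)
        sv′ = proj₁ (I-low iv′)
        go : ∀ i k → i + k ≤ r + r → ∀ {x} → owned own x ≡ false → Path (free own v) i v x → Path (free own v′) k x v′ →
             ∃[ y ] (Path (free own v) (r + r) v y × a y v′ ≡ true)
        go i k le xf p stop = ⊥-elim (true≢false (owned-just own (centre inv v′ sv′)) xf)
        go i (suc k) le {x} xf p (_▸_ {y = y} e q) with restrict-elim {a = a} {zone own v′} {x} {y} e
        ... | e′ , _ , zy with zone-elim own v′ zy
        ...   | inj₁ refl = x , weaken (ℕₚ.≤-trans (ℕₚ.m≤m+n i (suc k)) le) p , e′
        ...   | inj₂ yf = go (suc i) k (subst (_≤ r + r) (ℕₚ.+-suc i k) le) yf
                            (snoc p (restrict-intro {a = a} {zone own v} {x} {y} e′ (zone-free own v xf) (zone-free own v yf))) q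
        good : joinable own v v′ ≡ true
        good with go r r ℕₚ.≤-refl zf p (reverse (restrict-sym {a = a} {zone own v′} (adj-sym G)) q)
        ... | y , p′ , e = ∧-intro (∧-intro sv (∧-intro sv′ (not-true (⌊⌋-false (v ≟ v′) ne))))
                  (∧-intro (not-true (indep-apart (elems low) iv iv′)) (anyFin-intro _ y (∧-intro (near-complete p′) e)))

      -- Branch sets of the second minor: every owned vertex is a centre, alone unless it lies in
      -- `I`, where it takes its free neighbourhood of radius `r` along. By `meet` these are
      -- disjoint, and the contacts of `v` become neighbours of `v` in the minor.
      own₂ : Own
      own₂ z = if owned own z then just z else first (λ v → I v ∧ near (free own v) r v z)

      own₂-owned : ∀ {z} → owned own z ≡ true → own₂ z ≡ just z
      own₂-owned e rewrite e = refl

      own₂-cases : ∀ z {c} → own₂ z ≡ just c → (owned own z ≡ true × z ≡ c) ⊎ (owned own z ≡ false × I c ≡ true × Path (free own c) r c z)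
      own₂-cases z {c} e with owned own z
      ... | true = inj₁ (refl , just-injective e)
      ... | false with ∧-elim {I c} (first-sound (λ v → I v ∧ near (free own v) r v z) e)
      ...   | p , q = inj₂ (refl , p , near-sound r q)

      own₂-free : ∀ {z v} → I v ≡ true → zone own v z ≡ true → Path (free own v) r v z → own₂ z ≡ just v
      own₂-free {z} {v} iv zz p with zone-elim own v zz
      ... | inj₁ refl = own₂-owned (owned-just own (centre inv v (proj₁ (I-low iv))))
      ... | inj₂ zf with first-complete (λ v → I v ∧ near (free own v) r v z) v (∧-intro iv (near-complete p))
      ...   | c , e with ∧-elim {I c} (first-sound (λ v → I v ∧ near (free own v) r v z) e)
      ...     | ic , q rewrite zf = trans e (cong just (meet ic iv zf (near-sound r q) p))

      crowded : (∀ v → S v ≡ true → hitBound f r < countFin n (contacts v)) → countFin n I * suc (hitBound f r) ≤ f r * countFin n (owned own) + f r * countFin n (owned own)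
      crowded big = ℕₚ.≤-trans
        (∑-restricted I (λ v → countFin n (Q v)) (suc (hitBound f r)) (λ v iv → ℕₚ.≤-trans (big v (proj₁ (I-low iv))) (count-mono (contacts v) (Q v) (λ m t → ∧-intro iv t))))
        (MinorDegrees.minor-degrees G r (f r) (bound r) own₂ (owned own) (λ c t → own₂-owned t) own₂-Z own₂-rad Q Q-minor)
        where
        Q : Rel n
        Q v m = I v ∧ contacts v m
        own₂-Z : ∀ x c → own₂ x ≡ just c → owned own c ≡ true
        own₂-Z x c e with own₂-cases x e
        ... | inj₁ (t , refl) = t
        ... | inj₂ (_ , ic , _) = owned-just own (centre inv c (proj₁ (I-low ic)))
        own₂-rad : ∀ x c → own₂ x ≡ just c → Path (restrict a (λ y → is (own₂ y) c)) r c x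
        own₂-rad x c e with own₂-cases x e
        ... | inj₁ (t , refl) = stop
        ... | inj₂ (_ , ic , w) with at-end w
        ...   | s , q with at-clip w s
        ...     | t , q′ = subst (Path _ r c) (trans q′ q) (weaken (ℕₚ.≤-pred (Finₚ.toℕ<n t))
                  (mapPath (restrict-mono {a = free own c} {a} {λ y → is (own₂ y) c} {λ y → is (own₂ y) c} (restrict-forget {a = a} {zone own c}) (λ _ h → h))
                    (prefixIn {a = free own c} {λ y → is (own₂ y) c} w along (toℕ t))))
          where
          along : ∀ s → is (own₂ (at w s)) c ≡ true
          along s with at-clip w s
          ... | t , q = is-complete (own₂ (at w s)) (own₂-free ic (restrict-end {a = a} {zone own c} (prefix w s) (zone-self own c))
                          (subst (Path (free own c) r c) q (weaken (ℕₚ.≤-pred (Finₚ.toℕ<n t)) (prefix w (toℕ t)))))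
        Q-minor : ∀ u v → Q u v ≡ true → owned own u ≡ true × owned own v ≡ true × u ≢ v × ∃[ x ] ∃[ y ] (own₂ x ≡ just u × own₂ y ≡ just v × a x y ≡ true)
        Q-minor u v h with ∧-elim {I u} h
        ... | iu , t with ∧-elim {owned own v ∧ not (v == u)} t
        ...   | t₁ , t₂ with ∧-elim {owned own v} t₁ | anyFin-elim _ t₂
        ...     | ov , ne | y , t₃ with ∧-elim {near (free own u) r u y} t₃
        ...       | p , e = owned-just own (centre inv u (proj₁ (I-low iu))) , ov , (λ q → ⌊⌋-refute (v ≟ u) (not-true⇒false ne) (sym q)) ,
                            y , v , own₂-free iu (restrict-end {a = a} {zone own u} (near-sound r p) (zone-self own u)) (near-sound r p) , own₂-owned ov , e

      few-contacts : ∀ s → S s ≡ true → ¬ (∀ v → S v ≡ true → hitBound f r < countFin n (contacts v))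
      few-contacts s ss big = no-surplus (countFin n I) |S| (hitBound f r) (suc (4 * d))
        (subst (0 <_) (sym (count-remove S s ss)) (s≤s z≤n)) S≤I
        (ℕₚ.≤-trans (crowded big) (minor-budget (f r) (countFin n (owned own)) |S| _ (countFin n I) (suc (4 * d)) ownedBound S≤I))
        where
        ownedBound : countFin n (owned own) ≤ |S| * (1 + suc (r + r) * (f (r + r) + f (r + r)))
        ownedBound = owned-budget |S| (suc (r + r)) (f (r + r)) _ _ (small inv) total
        S≤I : |S| ≤ 2 * (countFin n I * suc (4 * d))
        S≤I = ℕₚ.≤-trans S≤2low (ℕₚ.*-monoʳ-≤ 2 low≤I)

    small-contacts : ∀ s → S s ≡ true → ∃[ v ] (S v ≡ true × countFin n (contacts v) ≤ hitBound f r)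
    small-contacts s ss with find (λ v → S v ∧ ⌊ countFin n (contacts v) ≤? hitBound f r ⌋)
    ... | inj₁ (v , h) with ∧-elim {S v} h
    ...   | sv , t = v , sv , ⌊⌋-sound (countFin n (contacts v) ≤? hitBound f r) t
    small-contacts s ss | inj₂ none = ⊥-elim (few-contacts s ss λ v sv →
      ℕₚ.≰⇒> λ le → true≢false (∧-intro sv (⌊⌋-complete (countFin n (contacts v) ≤? hitBound f r) le)) (none v))

up : ∀ {n} → Rel n → (Fin n → ℕ) → Fin n → Rel n
up a rk y = restrict a (λ u → ⌊ rk y ≤? rk u ⌋)

-- An order (by rk) in which every vertex weakly r-reaches at most g vertices: y is weakly r-reached
-- from x if some walk of length ≤ r from x to y has y as its least vertex.
record WCol {n} (a : Rel n) (r g : ℕ) : Set where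
  field
    rk        : Fin n → ℕ
    rk-inj    : ∀ x y → rk x ≡ rk y → x ≡ y
    reach     : Fin n → List (Fin n)
    reach-len : ∀ x → length (reach x) ≤ g
    reach-cov : ∀ {x y} → Path (up a rk y) r x y → y ∈ reach x

up-start : ∀ {n} {a : Rel n} {rk : Fin n → ℕ} {r x y} → Path (up a rk y) r x y → rk y ≤ rk x
up-start {rk = rk} {x = x} {y} p = ⌊⌋-sound (rk y ≤? rk x) (restrict-start p (⌊⌋-complete (rk y ≤? rk y) ℕₚ.≤-refl))

-- The size of a tree of depth `k` with `h` children per vertex: whatever is weakly reached is found
-- by following hitting sets at most `k` times.
wcolBound : ℕ → ℕ → ℕ
wcolBound h zero    = 1
wcolBound h (suc k) = suc (h * wcolBound h k)

module BoundedExpansionOrder (G : Graph) (f : ℕ → ℕ) (bound : ∀ ρ H → ShallowMinor ρ H G → edgeCount H ≤ f ρ * size H) (r : ℕ) where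

  private
    n = size G
    h = hitBound f r

  record Ordering (S : Fin n → Bool) : Set where
    field
      rk     : Fin n → ℕ
      rk<    : ∀ v → S v ≡ true → rk v < countFin n S
      rk-inj : ∀ u v → S u ≡ true → S v ≡ true → rk u ≡ rk v → u ≡ v
      X      : Fin n → List (Fin n)
      X-len  : ∀ v → length (X v) ≤ h
      X-hits : ∀ v t → S v ≡ true → S t ≡ true → rk t < rk v → ∀ {c : Rel n} → (∀ x y → c x y ≡ true → adj G x y ≡ true) →
               ∀ {k} → k ≤ r → Path c k v t → ∃[ m ] ∃[ k′ ] (m ∈ X v × k′ < k × Path c k′ m t)

  -- The order is built from the top: a vertex of `S` with few contacts gets the largest rank and is
  -- removed. All of `S` left over ranks below it, so its contacts hit every short walk to a lower
  -- vertex.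
  ordering : ∀ k S → countFin n S ≡ k → Ordering S
  ordering zero S e = record
    { rk = λ _ → 0 ; rk< = λ v s → ⊥-elim (none v s) ; rk-inj = λ u v s → ⊥-elim (none u s)
    ; X = λ _ → [] ; X-len = λ _ → z≤n ; X-hits = λ v t s → ⊥-elim (none v s) }
    where
    none : ∀ v → S v ≡ true → ⊥
    none v s with trans (sym e) (count-remove S v s)
    ... | ()
  ordering (suc k) S e with count-witness S (ℕₚ.≤-trans (s≤s z≤n) (ℕₚ.≤-reflexive (sym e)))
  ... | s , ss with Hitting.saturated G f bound r S
  ...   | own , inv , sat with Hitting.Saturated.small-contacts G f bound r S own inv sat s ss
  ...     | v₀ , sv₀ , small = record
    { rk = rk ; rk< = rk< ; rk-inj = rk-inj ; X = X ; X-len = X-len ; X-hits = X-hits }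
    where
    S′ = remove v₀ S
    count′ : countFin n S ≡ suc (countFin n S′)
    count′ = count-remove S v₀ sv₀
    rest : Ordering S′
    rest = ordering k S′ (ℕₚ.suc-injective (trans (sym count′) e))
    module O = Ordering rest
    open Hitting.Saturated G f bound r S own inv sat
    rk : Fin n → ℕ
    rk v = if v == v₀ then countFin n S′ else O.rk v
    X : Fin n → List (Fin n)
    X v = if v == v₀ then elems (contacts v₀) else O.X v
    in′ : ∀ {v} → S v ≡ true → v ≢ v₀ → S′ v ≡ true
    in′ {v} s ne = remove-intro {x = v₀} {S} {v} s ne
    rk< : ∀ v → S v ≡ true → rk v < countFin n S
    rk< v s with v ≟ v₀
    ... | yes refl = subst (countFin n S′ <_) (sym count′) ℕₚ.≤-refl
    ... | no ne    = subst (O.rk v <_) (sym count′) (ℕₚ.m≤n⇒m≤1+n (O.rk< v (in′ s ne)))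
    rk-inj : ∀ u v → S u ≡ true → S v ≡ true → rk u ≡ rk v → u ≡ v
    rk-inj u v su sv e with u ≟ v₀ | v ≟ v₀
    ... | yes refl | yes refl = refl
    ... | yes refl | no ne = ⊥-elim (ℕₚ.<-irrefl (sym e) (O.rk< v (in′ sv ne)))
    ... | no ne | yes refl = ⊥-elim (ℕₚ.<-irrefl e (O.rk< u (in′ su ne)))
    ... | no ne | no ne′ = O.rk-inj u v (in′ su ne) (in′ sv ne′) e
    X-len : ∀ v → length (X v) ≤ h
    X-len v with v ≟ v₀
    ... | yes _ = ℕₚ.≤-trans (ℕₚ.≤-reflexive (elems-length (contacts v₀))) small
    ... | no _  = O.X-len v
    X-hits : ∀ v t → S v ≡ true → S t ≡ true → rk t < rk v → ∀ {c : Rel n} → (∀ x y → c x y ≡ true → adj G x y ≡ true) →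
             ∀ {k} → k ≤ r → Path c k v t → ∃[ m ] ∃[ k′ ] (m ∈ X v × k′ < k × Path c k′ m t)
    X-hits v t sv st lt c⊆ k≤ p with v ≟ v₀ | t ≟ v₀
    ... | yes refl | yes refl = ⊥-elim (ℕₚ.<-irrefl refl lt)
    ... | yes refl | no ne with hits v₀ c⊆ k≤ p st ne
    ...   | m , k′ , q , l , p′ = m , k′ , elems-complete (contacts v₀) m q , l , p′
    X-hits v t sv st lt c⊆ k≤ p | no ne | yes refl = ⊥-elim (ℕₚ.<-asym lt (O.rk< v (in′ sv ne)))
    X-hits v t sv st lt c⊆ k≤ p | no ne | no ne′ = O.X-hits v t (in′ sv ne) (in′ st ne′) lt c⊆ k≤ p

  wcol : WCol (adj G) r (wcolBound h r)
  wcol = record { rk = rk ; rk-inj = λ x y → rk-inj x y refl refl ; reach = list r ; reach-len = list-len r ; reach-cov = λ p → list-cov r ℕₚ.≤-refl p }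
    where
    open Ordering (ordering (countFin n (λ _ → true)) (λ _ → true) refl)
    list : ℕ → Fin n → List (Fin n)
    list zero    v = v ∷ []
    list (suc k) v = v ∷ concatMap (list k) (X v)
    list-len : ∀ k v → length (list k v) ≤ wcolBound h k
    list-len zero    v = ℕₚ.≤-refl
    list-len (suc k) v = s≤s (ℕₚ.≤-trans (length-concatMap-≤ (list k) (X v) (λ m _ → list-len k m)) (ℕₚ.*-monoˡ-≤ (wcolBound h k) (X-len v)))
    list-cov : ∀ k → k ≤ r → ∀ {x y} → Path (up (adj G) rk y) k x y → y ∈ list k x
    list-cov zero    k≤ stop = here refl
    list-cov (suc k) k≤ {x} {y} p with x ≟ y
    ... | yes refl = here refl
    ... | no ne with X-hits x y refl refl (ℕₚ.≤∧≢⇒< (up-start p) λ e → ne (rk-inj x y refl refl (sym e))) (restrict-forget {a = adj G}) k≤ p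
    -- The walk from the hit vertex `m` is strictly shorter and still stays above `y`, so induction
    -- finds `y` in the list of `m`.
    ...   | m , k′ , q , s≤s l , p′ = there (∈-concatMap (list k) (X x) q (list-cov k (ℕₚ.≤-trans (ℕₚ.n≤1+n k) k≤) (weaken l p′)))

-- The intersection graph of connected clusters inherits bounded reachability, with each cluster
-- ranked by its least vertex.
module ClusterOrder {n n′} (a : Rel n) (b : Rel n′) (X : Fin n′ → Fin n → Bool) (ρ w : ℕ)
  (base : Fin n′ → Fin n) (X-base : ∀ y → X y (base y) ≡ true)
  (X-conn : ∀ y z z′ → X y z ≡ true → X y z′ ≡ true → Path (restrict a (X y)) ρ z z′)
  (code : Fin n → List (Fin n′)) (code-len : ∀ z → length (code z) ≤ w) (code-cov : ∀ y z → X y z ≡ true → y ∈ code z)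
  (meet : ∀ x y → b x y ≡ true → ∃[ z ] (X x z ≡ true × X y z ≡ true)) where

  clusterOrder : ∀ r g → WCol a (ρ * suc r) g → WCol b r (g * w)
  clusterOrder r g W = record
    { rk = rk′ ; rk-inj = rk′-inj ; reach = λ x → concatMap code (reach (base x))
    ; reach-len = λ x → ℕₚ.≤-trans (length-concatMap-≤ code (reach (base x)) (λ z _ → code-len z)) (ℕₚ.*-monoˡ-≤ w (reach-len (base x)))
    ; reach-cov = λ {x} {y} p → ∈-concatMap code (reach (base x)) (reach-cov (trace p (base x) (X-base x))) (code-cov y (least y) (least-X y)) }
    where
    open WCol W
    least : Fin n′ → Fin n
    least y = proj₁ (argminOn (X y) rk (base y) (X-base y))
    least-X : ∀ y → X y (least y) ≡ true
    least-X y = proj₁ (proj₂ (argminOn (X y) rk (base y) (X-base y)))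
    least-≤ : ∀ y z → X y z ≡ true → rk (least y) ≤ rk z
    least-≤ y = proj₂ (proj₂ (argminOn (X y) rk (base y) (X-base y)))
    key : Fin n′ → ℕ
    key y = rk (least y)
    rk′ : Fin n′ → ℕ
    -- Overlapping clusters may share their least vertex; ties are broken by the index, giving a
    -- lexicographic order.
    rk′ y = key y * n′ + toℕ y
    rk′-key : ∀ y z → rk′ y ≤ rk′ z → key y ≤ key z
    rk′-key y z h = ℕₚ.≮⇒≥ λ lt → ℕₚ.<⇒≱ (begin-strict
      rk′ z                  <⟨ ℕₚ.+-monoʳ-< (key z * n′) (Finₚ.toℕ<n z) ⟩
      key z * n′ + n′        ≡⟨ ℕₚ.+-comm (key z * n′) n′ ⟩
      suc (key z) * n′       ≤⟨ ℕₚ.*-monoˡ-≤ n′ lt ⟩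
      key y * n′             ≤⟨ ℕₚ.m≤m+n _ _ ⟩
      rk′ y                  ∎) h
      where open ℕₚ.≤-Reasoning
    rk′-inj : ∀ y z → rk′ y ≡ rk′ z → y ≡ z
    rk′-inj y z e = Finₚ.toℕ-injective (ℕₚ.+-cancelˡ-≡ (key z * n′) (toℕ y) (toℕ z) (trans (cong (λ k → k * n′ + toℕ y) (sym eq)) e))
      where
      eq : key y ≡ key z
      eq = ℕₚ.≤-antisym (rk′-key y z (ℕₚ.≤-reflexive e)) (rk′-key z y (ℕₚ.≤-reflexive (sym e)))
    inside : ∀ {x y} → key y ≤ key x → ∀ {z z′} → Path (restrict a (X x)) ρ z z′ → Path (up a rk (least y)) ρ z z′
    inside {x} {y} h = mapPath (restrict-mono (λ _ _ t → t) λ u t → ⌊⌋-complete (key y ≤? rk u) (ℕₚ.≤-trans h (least-≤ x u t)))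
    -- Consecutive clusters intersect, and each of the at most `r + 1` clusters on the walk is
    -- crossed in `ρ` steps. None has a vertex below the least vertex of the last one, because their
    -- keys are at least its key.
    trace : ∀ {r x y} → Path (up b rk′ y) r x y → ∀ z → X x z ≡ true → Path (up a rk (least y)) (ρ * suc r) z (least y)
    trace {r} {x} stop z h = weaken (ℕₚ.m≤m*n ρ (suc r)) (inside {x} {x} ℕₚ.≤-refl (X-conn x z (least x) h (least-X x)))
    trace {suc r} {x} {y} (_▸_ {y = x′} e p) z h with restrict-elim e
    ... | bxx′ , le , _ with meet x x′ bxx′
    ...   | z₀ , h₁ , h₂ = subst (λ l → Path (up a rk (least y)) l z (least y)) (sym (ℕₚ.*-suc ρ (suc r)))
              (inside {x} {y} (rk′-key y x (⌊⌋-sound (rk′ y ≤? rk′ x) le)) (X-conn x z z₀ h h₁) ▹▹ trace p z₀ h₂)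

-- Sparsity of shallow minors from weak reachability

memb : ∀ {n} → Fin n → List (Fin n) → Bool
memb x xs = ⌊ Data.List.Relation.Unary.Any.any? (x ≟_) xs ⌋

memb-sound : ∀ {n} {x : Fin n} {xs} → memb x xs ≡ true → x ∈ xs
memb-sound {x = x} {xs} = ⌊⌋-sound (Data.List.Relation.Unary.Any.any? (x ≟_) xs)

memb-complete : ∀ {n} {x : Fin n} {xs} → x ∈ xs → memb x xs ≡ true
memb-complete {x = x} {xs} = ⌊⌋-complete (Data.List.Relation.Unary.Any.any? (x ≟_) xs)

Walk⇒restricted : ∀ {n m} {a : Rel n} {branch : Fin n → Maybe (Fin m)} {v r x y} → branch x ≡ just v →
  Walk a (λ z → branch z ≡ just v) r x y → Path (restrict a (λ z → is (branch z) v)) r x y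
Walk⇒restricted e here = stop
Walk⇒restricted {branch = branch} e (step {x = x} {y} h p w) =
  restrict-intro h (is-complete (branch x) e) (is-complete (branch y) p) ▸ Walk⇒restricted p w

-- Each branch set is represented by its least vertex. For an edge of the minor, the smaller
-- representative is weakly reached from the larger one: two spokes on either side of an edge of
-- `G`, at most `4r + 1` steps. So every edge is charged to one end, at most `g` times.
wcol-sparse : ∀ (G : Graph) r g → WCol (adj G) ((r + r) + suc (r + r)) g → ∀ H → ShallowMinor r H G → edgeCount H ≤ (g + g) * size H
wcol-sparse G r g W H minor = begin
  edgeCount H                                  ≡⟨ edgeCount≡∑ H ⟩
  _                                            ≤⟨ ∑-mono (λ u → count-mono (λ v → ⌊ toℕ u <? toℕ v ⌋ ∧ adj H u v) (adj H u) (λ v t → proj₂ (∧-elim {⌊ toℕ u <? toℕ v ⌋} t))) ⟩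
  ∑∑ h (adj H)                                 ≤⟨ ∑∑-∪ h (adj H) A (λ u v → A v u) edge-reach ⟩
  ∑∑ h A + ∑∑ h (λ u v → A v u)                ≡⟨ cong (∑∑ h A +_) (∑∑-swap h A) ⟩
  ∑∑ h A + ∑∑ h A                              ≤⟨ ℕₚ.+-mono-≤ (∑-bound few) (∑-bound few) ⟩
  h * g + h * g                                ≡⟨ solve 2 (λ h g → h :* g :+ h :* g := (g :+ g) :* h) refl h g ⟩
  (g + g) * h                                  ∎
  where
  open ℕₚ.≤-Reasoning
  open ℕSolver.+-*-Solver using (solve; _:+_; _:*_; _:=_)
  open WCol W
  open ShallowMinor minor renaming (radius to branch-radius; edges to branch-edges)
  h = size H
  part : Fin h → Fin (size G) → Bool
  part u x = is (branch x) u
  least : ∀ u → ∃[ x ] (part u x ≡ true × (∀ y → part u y ≡ true → rk x ≤ rk y))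
  least u = argminOn (part u) rk (center u) (is-complete (branch (center u)) (center-in u))
  μ : Fin h → Fin (size G)
  μ u = proj₁ (least u)
  μ-in : ∀ u → branch (μ u) ≡ just u
  μ-in u = is-sound (branch (μ u)) (proj₁ (proj₂ (least u)))
  μ-inj : ∀ u v → μ u ≡ μ v → u ≡ v
  μ-inj u v e = just-injective (trans (sym (μ-in u)) (trans (cong branch e) (μ-in v)))
  A : Rel h
  A v u = memb (μ u) (reach (μ v))
  few : ∀ v → countFin h (A v) ≤ g
  few v = ℕₚ.≤-trans (count-injection (A v) (λ z → memb z (reach (μ v))) μ μ-inj (λ _ t → t))
          (ℕₚ.≤-trans (count-≤-list _ (reach (μ v)) (λ z t → memb-sound t)) (reach-len (μ v)))
  spoke : ∀ {p} u x → branch x ≡ just u → rk p ≤ rk (μ u) → Path (up (adj G) rk p) r (center u) x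
  spoke {p} u x e le = mapPath (restrict-mono (λ _ _ t → t) λ z t → ⌊⌋-complete (rk p ≤? rk z) (ℕₚ.≤-trans le (proj₂ (proj₂ (least u)) z t)))
    (Walk⇒restricted {branch = branch} (center-in u) (branch-radius u x e))
  connect : ∀ u v → adj H u v ≡ true → rk (μ u) ≤ rk (μ v) → A v u ≡ true
  connect u v t le with branch-edges u v t
  ... | x , y , bx , by , e = memb-complete (reach-cov
      ((reverse usym (spoke v (μ v) (μ-in v) le) ▹▹ spoke v y by le) ▹▹
       (restrict-intro (trans (adj-sym G y x) e) (above v y by le) (above u x bx ℕₚ.≤-refl) ▸
        (reverse usym (spoke u x bx ℕₚ.≤-refl) ▹▹ spoke u (μ u) (μ-in u) ℕₚ.≤-refl))))
    where
    usym : Sym (up (adj G) rk (μ u))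
    usym = restrict-sym (adj-sym G)
    above : ∀ w z → branch z ≡ just w → rk (μ u) ≤ rk (μ w) → ⌊ rk (μ u) ≤? rk z ⌋ ≡ true
    above w z e le = ⌊⌋-complete (rk (μ u) ≤? rk z) (ℕₚ.≤-trans le (proj₂ (proj₂ (least w)) z (is-complete (branch z) e)))
  edge-reach : ∀ u v → adj H u v ≡ true → A u v ≡ true ⊎ A v u ≡ true
  edge-reach u v t with ℕₚ.≤-total (rk (μ u)) (rk (μ v))
  ... | inj₁ le = inj₂ (connect u v t le)
  ... | inj₂ le = inj₁ (connect v u (trans (adj-sym H v u) t) le)

-- Greedy colouring along an order

module Colouring {n} (rk : Fin n → ℕ) (out : Fin n → List (Fin n)) (g : ℕ) (out-len : ∀ x → length (out x) ≤ g) where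

  private
    fresh : List (Fin (suc g)) → Fin (suc g)
    fresh cs with find (λ c → not (memb c cs))
    ... | inj₁ (c , _) = c
    ... | inj₂ _ = zero

    fresh-∉ : ∀ cs → length cs ≤ g → ¬ (fresh cs ∈ cs)
    fresh-∉ cs l with find (λ c → not (memb c cs))
    ... | inj₁ (c , h) = λ m → true≢false (memb-complete m) (not-true⇒false h)
    ... | inj₂ none = λ _ → ℕₚ.1+n≰n (ℕₚ.≤-trans (subst (_≤ length cs) (count-true (suc g)) (count-≤-list (λ _ → true) cs covered)) l)
      where
      covered : ∀ c → true ≡ true → c ∈ cs
      covered c _ with bool-cases (memb c cs)
      ... | inj₁ t = memb-sound t
      ... | inj₂ t = ⊥-elim (true≢false (not-true t) (none c))

    colour : ℕ → Fin n → Fin (suc g)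
    used : ℕ → Fin n → List (Fin n) → List (Fin (suc g))
    colour zero    x = zero
    colour (suc k) x = fresh (used k x (out x))
    used k x []       = []
    used k x (y ∷ ys) = if ⌊ rk y <? rk x ⌋ then colour k y ∷ used k x ys else used k x ys

    used-len : ∀ k x ys → length (used k x ys) ≤ length ys
    used-len k x [] = z≤n
    used-len k x (y ∷ ys) with ⌊ rk y <? rk x ⌋
    ... | true  = s≤s (used-len k x ys)
    ... | false = ℕₚ.m≤n⇒m≤1+n (used-len k x ys)

    used-∈ : ∀ k x ys {y} → y ∈ ys → rk y < rk x → colour k y ∈ used k x ys
    used-∈ k x (z ∷ ys) {y} (here refl) lt rewrite ⌊⌋-complete (rk y <? rk x) lt = here refl
    used-∈ k x (z ∷ ys) (there m) lt with ⌊ rk z <? rk x ⌋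
    ... | true  = there (used-∈ k x ys m lt)
    ... | false = used-∈ k x ys m lt

    stable : ∀ k k′ x → rk x < k → rk x < k′ → colour k x ≡ colour k′ x
    stable-used : ∀ k k′ x ys → rk x ≤ k → rk x ≤ k′ → used k x ys ≡ used k′ x ys
    stable (suc k) (suc k′) x (s≤s h) (s≤s h′) = cong fresh (stable-used k k′ x (out x) h h′)
    stable-used k k′ x [] h h′ = refl
    stable-used k k′ x (y ∷ ys) h h′ with bool-cases ⌊ rk y <? rk x ⌋
    ... | inj₂ e rewrite e = stable-used k k′ x ys h h′
    ... | inj₁ e rewrite e = cong₂ _∷_ (stable k k′ y (ℕₚ.<-≤-trans lt h) (ℕₚ.<-≤-trans lt h′)) (stable-used k k′ x ys h h′)
      where lt = ⌊⌋-sound (rk y <? rk x) e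

  -- Colours are given in order of rank: at most `g` lower vertices of `out x` forbid a colour, and
  -- `g + 1` are available. The rank serves as fuel, and `stable` shows that surplus fuel does not
  -- change the colour.
  proper-colouring : Σ (Fin n → Fin (suc g)) λ χ → ∀ x y → y ∈ out x → rk y < rk x → χ x ≢ χ y
  proper-colouring = (λ x → colour (suc (rk x)) x) , λ x y m lt e →
    fresh-∉ (used (rk x) x (out x)) (ℕₚ.≤-trans (used-len (rk x) x (out x)) (out-len x))
      (subst (_∈ used (rk x) x (out x)) (trans (stable (rk x) (suc (rk y)) y lt ℕₚ.≤-refl) (sym e)) (used-∈ (rk x) x (out x) m lt))

-- Elimination forests of the subgraphs induced by few colours

-- Every vertex of the walk is itself within `R` of the end `u`, so the set of vertices that reach
-- `u` is connected around `u`.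
basin : ∀ {n} {a b : Rel n} {R u} → (∀ x y → b x y ≡ true → a x y ≡ true) → ∀ {k z} → k ≤ R → Path b k z u →
        Path (restrict a (λ y → near b R y u)) k z u
basin b⊆a k≤ stop = stop
basin b⊆a k≤ (e ▸ p) =
  restrict-intro (b⊆a _ _ e) (near-complete (weaken k≤ (e ▸ p))) (near-complete (weaken (ℕₚ.<⇒≤ k≤) p)) ▸ basin b⊆a (ℕₚ.<⇒≤ k≤) p

module Hat {n} (a : Rel n) (asym : Sym a) (R w : ℕ) (W : WCol a R w) where
  open WCol W

  reaches : Rel n
  reaches x u = near (up a rk u) R x u

  -- Weak reachability made into adjacency: in an elimination forest of this graph, a vertex is
  -- comparable with everything it weakly reaches within the forest. This lets ancestors in the
  -- forest separate short walks of the original graph.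
  hat : Rel n
  hat x y = not (x == y) ∧ (reaches x y ∨ reaches y x)

  hat-sym : Sym hat
  hat-sym x y = iff⇒≡ (go x y) (go y x)
    where
    go : ∀ x y → hat x y ≡ true → hat y x ≡ true
    go x y h with ∧-elim {not (x == y)} h
    ... | ne , t with ∨-elim {reaches x y} t
    ...   | inj₁ q = ∧-intro (not-true (⌊⌋-false (y ≟ x) λ e → ⌊⌋-refute (x ≟ y) (not-true⇒false ne) (sym e))) (∨-introʳ {reaches y x} q)
    ...   | inj₂ q = ∧-intro (not-true (⌊⌋-false (y ≟ x) λ e → ⌊⌋-refute (x ≟ y) (not-true⇒false ne) (sym e))) (∨-introˡ q)

  reaches-hat : ∀ {x y} → x ≢ y → reaches x y ≡ true → hat x y ≡ true
  reaches-hat {x} {y} ne h = ∧-intro (not-true (⌊⌋-false (x ≟ y) ne)) (∨-introˡ h)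

  -- The cluster of `u` consists of the vertices that weakly reach `u`. It is connected through `u`,
  -- a vertex lies in at most `w` clusters, and adjacent vertices of `hat` have intersecting
  -- clusters.
  hat-wcol : ∀ r g → WCol a ((R + R) * suc r) g → WCol hat r (g * w)
  hat-wcol = ClusterOrder.clusterOrder a hat (λ u x → reaches x u) (R + R) w id (λ u → near-complete stop) conn
    reach reach-len (λ y z h → reach-cov (near-sound R h)) meet
    where
    conn : ∀ u z z′ → reaches z u ≡ true → reaches z′ u ≡ true → Path (restrict a (λ x → reaches x u)) (R + R) z z′
    conn u z z′ h h′ = basin (restrict-forget {a = a}) ℕₚ.≤-refl (near-sound R h) ▹▹
      reverse (restrict-sym asym) (basin (restrict-forget {a = a}) ℕₚ.≤-refl (near-sound R h′))
    meet : ∀ x y → hat x y ≡ true → ∃[ z ] (reaches z x ≡ true × reaches z y ≡ true)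
    meet x y h with ∨-elim {reaches x y} (proj₂ (∧-elim {not (x == y)} h))
    ... | inj₁ q = x , near-complete stop , q
    ... | inj₂ q = y , q , near-complete stop

  least-on-walk : ∀ {b : Rel n} → (∀ x y → b x y ≡ true → a x y ≡ true) → Sym b → ∀ {x y} → Path b R x y →
                  ∃[ z ] (Path b R x z × reaches x z ≡ true × reaches y z ≡ true)
  least-on-walk {b} b⊆a bsym {x} {y} p with minAt rk p
  ... | t , least with at-clip p t
  ...   | t′ , e = z , subst (Path b R x) e (weaken t′≤ (prefix p (toℕ t′))) ,
            near-complete (lift (subst (Path (restrict b above) R x) e (weaken t′≤ (prefixIn p above-all (toℕ t′))))) ,
            near-complete (lift (reverse (restrict-sym bsym) (weaken (ℕₚ.m∸n≤m R t) (suffixIn p above-all t))))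
    where
    z = at p t
    above : Fin n → Bool
    above u = ⌊ rk z ≤? rk u ⌋
    above-all : ∀ s → above (at p s) ≡ true
    above-all s = ⌊⌋-complete (rk z ≤? rk (at p s)) (least s)
    t′≤ : toℕ t′ ≤ R
    t′≤ = ℕₚ.≤-pred (Finₚ.toℕ<n t′)
    lift : ∀ {k u v} → Path (restrict b above) k u v → Path (up a rk z) k u v
    lift = mapPath (restrict-mono b⊆a (λ _ t → t))

-- `Anc x u` puts `u` above `x` or equal to it. The forest is given as an order instead of by
-- parents; the vertices above `x` form a chain with pairwise different colours, so the number of
-- colours bounds the depth.
record Forest {n} (â : Rel n) (q ρ : ℕ) : Set where
  field
    rk      : Fin n → ℕ
    rk-inj  : ∀ x y → rk x ≡ rk y → x ≡ y
    χ       : Fin n → Fin q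
    inJ     : Fin n → Bool
    Anc     : Rel n
    A-refl  : ∀ {x} → inJ x ≡ true → Anc x x ≡ true
    A-in    : ∀ {x u} → Anc x u ≡ true → inJ x ≡ true × inJ u ≡ true
    A-rk    : ∀ {x u} → Anc x u ≡ true → rk u ≤ rk x
    A-col   : ∀ {x u} → Anc x u ≡ true → x ≢ u → χ x ≢ χ u
    A-trans : ∀ {x u v} → Anc x u ≡ true → Anc u v ≡ true → Anc x v ≡ true
    A-chain : ∀ {x u v} → Anc x u ≡ true → Anc x v ≡ true → rk v ≤ rk u → Anc u v ≡ true
    A-adj   : ∀ {x y} → â x y ≡ true → inJ x ≡ true → inJ y ≡ true → Anc x y ≡ true ⊎ Anc y x ≡ true
    A-path  : ∀ {z u} → Anc z u ≡ true → Path (restrict â (λ y → Anc y u)) ρ z u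

module BuildForest {n} (â : Rel n) (âsym : Sym â) {q} (p : ℕ) (rk : Fin n → ℕ) (rk-inj : ∀ x y → rk x ≡ rk y → x ≡ y)
  (χ : Fin n → Fin q) (χ-proper : ∀ {x u} → Path (up â rk u) (2 ^ p) x u → x ≢ u → χ x ≢ χ u)
  (J : Fin q → Bool) (J-small : countFin q J ≤ p) where

  private
    segment : ∀ {P : Fin n → Bool} (v : ℕ → Fin n) N → (∀ t → suc t < N → â (v t) (v (suc t)) ≡ true) → (∀ t → t < N → P (v t) ≡ true) →
              ∀ d i → i + d < N → Path (restrict â P) d (v i) (v (i + d))
    segment {P} v N e h zero i lt = subst (λ j → Path (restrict â P) 0 (v i) (v j)) (sym (ℕₚ.+-identityʳ i)) stop
    segment {P} v N e h (suc d) i lt = subst (λ j → Path (restrict â P) (suc d) (v i) (v j)) (sym (ℕₚ.+-suc i d))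
      (snoc (segment {P} v N e h d i (ℕₚ.<⇒≤ lt′)) (restrict-intro (e (i + d) lt′) (h (i + d) (ℕₚ.<⇒≤ lt′)) (h (suc (i + d)) lt′)))
      where
      lt′ : suc (i + d) < N
      lt′ = subst (_< N) (ℕₚ.+-suc i d) lt

    -- The colour of the least vertex of a path does not reappear on it, so the longer of the two
    -- remaining pieces uses one colour less.
    no-long : ∀ k (C : Fin q → Bool) → countFin q C ≤ k → ∀ (v : ℕ → Fin n) N → N ≤ 2 ^ p →
      (∀ t → suc t < N → â (v t) (v (suc t)) ≡ true) → (∀ s t → s < t → t < N → v s ≢ v t) → (∀ t → t < N → C (χ (v t)) ≡ true) → ¬ (2 ^ k ≤ N)
    no-long k C small v zero N≤ e dist col big = ℕₚ.<⇒≱ (ℕₚ.m^n>0 2 k) big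
    no-long zero C small v (suc N) N≤ e dist col big with trans (sym (ℕₚ.n≤0⇒n≡0 small)) (count-remove C (χ (v 0)) (col 0 (s≤s z≤n)))
    ... | ()
    no-long (suc k) C small v (suc N) N≤ e dist col big with argmin {N} (λ i → rk (v (toℕ i)))
    ... | i , least = halves (2 ^ k ≤? t)
      where
      t = toℕ i
      t<N : t < suc N
      t<N = Finₚ.toℕ<n i
      M = N ∸ t
      t+M : t + M ≡ N
      t+M = ℕₚ.m+[n∸m]≡n (ℕₚ.≤-pred t<N)
      c = χ (v t)
      C′ = remove c C
      small′ : countFin q C′ ≤ k
      small′ = ℕₚ.≤-pred (subst (_≤ suc k) (count-remove C c (col t t<N)) small)
      above : Fin n → Bool
      above u = ⌊ rk (v t) ≤? rk u ⌋
      above-all : ∀ s → s < suc N → above (v s) ≡ true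
      above-all s lt = ⌊⌋-complete (rk (v t) ≤? rk (v s)) (subst (λ s → rk (v t) ≤ rk (v s)) (Finₚ.toℕ-fromℕ< lt) (least (fromℕ< lt)))
      toLeast : ∀ s → s < suc N → s ≢ t → Path (up â rk (v t)) (2 ^ p) (v s) (v t)
      toLeast s lt ne with ℕₚ.≤-total s t
      ... | inj₁ le = weaken (ℕₚ.≤-trans (ℕₚ.≤-trans (ℕₚ.m∸n≤m t s) (ℕₚ.<⇒≤ t<N)) N≤)
              (subst (λ j → Path (up â rk (v t)) (t ∸ s) (v s) (v j)) (ℕₚ.m+[n∸m]≡n le)
                (segment v (suc N) e above-all (t ∸ s) s (subst (_< suc N) (sym (ℕₚ.m+[n∸m]≡n le)) t<N)))
      ... | inj₂ le = weaken (ℕₚ.≤-trans (ℕₚ.≤-trans (ℕₚ.m∸n≤m s t) (ℕₚ.<⇒≤ lt)) N≤) (reverse (restrict-sym âsym)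
              (subst (λ j → Path (up â rk (v t)) (s ∸ t) (v t) (v j)) (ℕₚ.m+[n∸m]≡n le)
                (segment v (suc N) e above-all (s ∸ t) t (subst (_< suc N) (sym (ℕₚ.m+[n∸m]≡n le)) lt))))
      other : ∀ s → s < suc N → s ≢ t → C′ (χ (v s)) ≡ true
      other s lt ne = remove-intro {x = c} {C} {χ (v s)} (col s lt) (χ-proper (toLeast s lt ne) differ)
        where
        differ : v s ≢ v t
        differ q with ℕₚ.<-cmp s t
        ... | Relation.Binary.tri< l _ _ = dist s t l t<N q
        ... | Relation.Binary.tri≈ _ l _ = ne l
        ... | Relation.Binary.tri> _ _ l = dist t s l lt (sym q)
      shift : ∀ {j} → j < M → suc t + j < suc N
      shift {j} lt = subst (suc t + j <_) (cong suc t+M) (ℕₚ.+-monoʳ-< (suc t) lt)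
      halves : Dec (2 ^ k ≤ t) → ⊥
      halves (yes le) = no-long k C′ small′ v t (ℕₚ.≤-trans (ℕₚ.<⇒≤ t<N) N≤) (λ s lt → e s (ℕₚ.<-trans lt t<N))
        (λ s s′ lt lt′ → dist s s′ lt (ℕₚ.<-trans lt′ t<N)) (λ s lt → other s (ℕₚ.<-trans lt t<N) (ℕₚ.<⇒≢ lt)) le
      halves (no nle) = no-long k C′ small′ (λ j → v (suc t + j)) M (ℕₚ.≤-trans (ℕₚ.m∸n≤m N t) (ℕₚ.<⇒≤ N≤))
        (λ j lt → subst (λ s → â (v (suc t + j)) (v s) ≡ true) (sym (ℕₚ.+-suc (suc t) j)) (e (suc t + j) (subst (_< suc N) (ℕₚ.+-suc (suc t) j) (shift lt))))
        (λ j j′ lt lt′ → dist _ _ (ℕₚ.+-monoʳ-< (suc t) lt) (shift lt′))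
        (λ j lt → other _ (shift lt) (λ q → ℕₚ.<-irrefl (sym q) (s≤s (ℕₚ.m≤m+n t j))))
        (ℕₚ.≮⇒≥ λ lt → ℕₚ.<⇒≱ (begin-strict
          suc N                 ≡⟨ cong suc (sym t+M) ⟩
          suc t + M             <⟨ ℕₚ.+-mono-≤-< (ℕₚ.≰⇒> nle) lt ⟩
          2 ^ k + 2 ^ k         ≡⟨ cong (2 ^ k +_) (sym (ℕₚ.+-identityʳ (2 ^ k))) ⟩
          2 ^ suc k             ∎) big)
        where open ℕₚ.≤-Reasoning

    L : ℕ
    L = 2 ^ p
    inJ : Fin n → Bool
    inJ x = J (χ x)
    inUp : Fin n → Fin n → Bool
    inUp u x = inJ x ∧ ⌊ rk u ≤? rk x ⌋
    aJ : Fin n → Rel n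
    aJ u = restrict â (inUp u)

    inUp-elim : ∀ {u x} → inUp u x ≡ true → inJ x ≡ true × rk u ≤ rk x
    inUp-elim {u} {x} h with ∧-elim {inJ x} h
    ... | j , l = j , ⌊⌋-sound (rk u ≤? rk x) l

    inUp-intro : ∀ {u x} → inJ x ≡ true → rk u ≤ rk x → inUp u x ≡ true
    inUp-intro {u} {x} j l = ∧-intro j (⌊⌋-complete (rk u ≤? rk x) l)

    -- The few colours of `J` exclude long paths above `u`, so reachability there agrees with
    -- reachability within `2 ^ p` steps. Hence `Anc` is transitive although it is defined with a
    -- length bound.
    aJ-short : ∀ u {k x y} → Path (aJ u) k x y → Path (aJ u) L x y
    aJ-short u = shorten L λ v geo → no-long p J J-small v L ℕₚ.≤-refl
      (λ t lt → restrict-forget _ _ (Geodesic.edges geo t (ℕₚ.<⇒≤ lt)))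
      (λ s t l l′ → Geodesic.distinct geo s t l (ℕₚ.<⇒≤ l′))
      (λ t lt → proj₁ (inUp-elim {u} (proj₁ (proj₂ (restrict-elim (Geodesic.edges geo t lt)))))) ℕₚ.≤-refl

    aJ-mono : ∀ {u v k x y} → rk v ≤ rk u → Path (aJ u) k x y → Path (aJ v) k x y
    aJ-mono {u} le = mapPath (restrict-mono (λ _ _ t → t) λ x t → let j , l = inUp-elim {u} t in inUp-intro j (ℕₚ.≤-trans le l))

    aJ-sym : ∀ u → Sym (aJ u)
    aJ-sym u = restrict-sym âsym

    Anc : Rel n
    Anc x u = inJ x ∧ near (aJ u) L x u

    elim : ∀ {x u} → Anc x u ≡ true → inJ x ≡ true × Path (aJ u) L x u
    elim {x} h with ∧-elim {inJ x} h
    ... | j , t = j , near-sound L t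

    intro : ∀ {x u k} → inJ x ≡ true → Path (aJ u) k x u → Anc x u ≡ true
    intro {u = u} j w = ∧-intro j (near-complete (aJ-short u w))

    A-in : ∀ {x u} → Anc x u ≡ true → inJ x ≡ true × inJ u ≡ true
    A-in {x} {u} h with x ≟ u
    ... | yes refl = proj₁ (elim h) , proj₁ (elim h)
    ... | no ne = proj₁ (elim h) , proj₁ (inUp-elim {u} (proj₂ (restrict-ends (proj₂ (elim h)) ne)))

    A-rk : ∀ {x u} → Anc x u ≡ true → rk u ≤ rk x
    A-rk {x} {u} h with x ≟ u
    ... | yes refl = ℕₚ.≤-refl
    ... | no ne = proj₂ (inUp-elim {u} (proj₁ (restrict-ends (proj₂ (elim h)) ne)))

    A-trans : ∀ {x u v} → Anc x u ≡ true → Anc u v ≡ true → Anc x v ≡ true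
    A-trans h h′ = intro (proj₁ (elim h)) (aJ-mono (A-rk h′) (proj₂ (elim h)) ▹▹ proj₂ (elim h′))

  forest : Forest â q (2 ^ p)
  forest = record
    { rk = rk ; rk-inj = rk-inj ; χ = χ ; inJ = inJ ; Anc = Anc
    ; A-refl = λ j → intro {k = 0} j stop
    ; A-in = A-in ; A-rk = A-rk
    ; A-col = λ {x} {u} h ne → χ-proper (mapPath (restrict-mono (λ _ _ t → t) λ y t → ⌊⌋-complete (rk u ≤? rk y) (proj₂ (inUp-elim {u} t))) (proj₂ (elim h))) ne
    ; A-trans = A-trans
    ; A-chain = λ {x} {u} {v} h h′ le → intro (proj₂ (A-in h)) (aJ-mono le (reverse (aJ-sym u) (proj₂ (elim h))) ▹▹ proj₂ (elim h′))
    ; A-adj = adjacent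
    ; A-path = λ {z} {u} h → mapPath (restrict-mono (λ _ _ t → t) λ y t → near-Anc y u (proj₂ (A-in h)) t) (basin (restrict-forget {a = â}) ℕₚ.≤-refl (proj₂ (elim h))) }
    where
    near-Anc : ∀ y u → inJ u ≡ true → near (aJ u) L y u ≡ true → Anc y u ≡ true
    near-Anc y u j t = ∧-intro (proj₁ (inUp-elim {u} (restrict-start (near-sound L t) (inUp-intro j ℕₚ.≤-refl)))) t
    adjacent : ∀ {x y} → â x y ≡ true → inJ x ≡ true → inJ y ≡ true → Anc x y ≡ true ⊎ Anc y x ≡ true
    adjacent {x} {y} e jx jy with ℕₚ.≤-total (rk y) (rk x)
    ... | inj₁ le = inj₁ (intro {k = 1} jx (restrict-intro e (inUp-intro jx le) (inUp-intro jy ℕₚ.≤-refl) ▸ stop))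
    ... | inj₂ le = inj₂ (intro {k = 1} jy (restrict-intro (trans (âsym y x) e) (inUp-intro jy le) (inUp-intro jx ℕₚ.≤-refl) ▸ stop))

-- Levels of an elimination forest

module Levels {n} {â : Rel n} {q ρ} (F : Forest â q ρ) where
  open Forest F

  -- The vertices above `u`, including `u`, have distinct colours, so this is the depth of `u`, with
  -- roots at 1; counting colours makes the bound `q` immediate.
  height : Fin n → ℕ
  height u = countFin q (λ c → anyFin n (λ v → Anc u v ∧ (χ v == c)))

  height-≤ : ∀ u → height u ≤ q
  height-≤ u = count-≤n _

  height-pos : ∀ {u} → inJ u ≡ true → 1 ≤ height u
  height-pos {u} j = subst (1 ≤_) (sym (count-remove (λ c → anyFin n (λ v → Anc u v ∧ (χ v == c))) (χ u)
    (anyFin-intro (λ v → Anc u v ∧ (χ v == χ u)) u (∧-intro (A-refl j) (==-refl (χ u)))))) (s≤s z≤n)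

  height-< : ∀ {x u} → Anc x u ≡ true → x ≢ u → height u < height x
  height-< {x} {u} h ne = count-strict _ _ sub (χ x)
    (anyFin-intro (λ v → Anc x v ∧ (χ v == χ x)) x (∧-intro (A-refl (proj₁ (A-in h))) (==-refl (χ x))))
    (≢true⇒false λ t → absent (anyFin-elim (λ v → Anc u v ∧ (χ v == χ x)) t))
    where
    sub : ∀ c → anyFin n (λ v → Anc u v ∧ (χ v == c)) ≡ true → anyFin n (λ v → Anc x v ∧ (χ v == c)) ≡ true
    sub c t with anyFin-elim (λ v → Anc u v ∧ (χ v == c)) t
    ... | v , s with ∧-elim {Anc u v} s
    ...   | a , e = anyFin-intro (λ v → Anc x v ∧ (χ v == c)) v (∧-intro (A-trans h a) e)
    absent : ∃[ v ] (Anc u v ∧ (χ v == χ x)) ≡ true → ⊥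
    absent (v , s) with ∧-elim {Anc u v} s
    ... | a , e with x ≟ v
    ...   | yes refl = ne (rk-inj x u (ℕₚ.≤-antisym (A-rk a) (A-rk h)))
    ...   | no xv = A-col (A-trans h a) xv (sym (==-sound e))

  Anc-colour-injective : ∀ {z u u′} → Anc z u ≡ true → Anc z u′ ≡ true → χ u ≡ χ u′ → u ≡ u′
  Anc-colour-injective {z} {u} {u′} h h′ e with u ≟ u′
  ... | yes q = q
  ... | no ne with ℕₚ.≤-total (rk u) (rk u′)
  ...   | inj₁ le = ⊥-elim (A-col (A-chain h′ h le) (λ q → ne (sym q)) (sym e))
  ...   | inj₂ le = ⊥-elim (A-col (A-chain h h′ le) ne e)

  -- Among ancestors larger rank means closer to `x`, so `u` is the level-`m` node above `x`, or `x`
  -- itself once its height is at most `m`. At level 0 there is none, and `nothing` acts as a common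
  -- root of all trees.
  IsTop : ℕ → Fin n → Fin n → Set
  IsTop m x u = Anc x u ≡ true × height u ≤ m × (∀ v → Anc x v ≡ true → height v ≤ m → rk v ≤ rk u)

  isTop : ℕ → Fin n → Fin n → Bool
  isTop m x u = (Anc x u ∧ ⌊ height u ≤? m ⌋) ∧ allFin n (λ v → not (Anc x v ∧ ⌊ height v ≤? m ⌋) ∨ ⌊ rk v ≤? rk u ⌋)

  isTop-sound : ∀ m x u → isTop m x u ≡ true → IsTop m x u
  isTop-sound m x u h with ∧-elim {Anc x u ∧ ⌊ height u ≤? m ⌋} h
  ... | h₁ , h₂ with ∧-elim {Anc x u} h₁
  ...   | a , l = a , ⌊⌋-sound (height u ≤? m) l , below
    where
    below : ∀ v → Anc x v ≡ true → height v ≤ m → rk v ≤ rk u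
    below v av hv with ∨-elim {not (Anc x v ∧ ⌊ height v ≤? m ⌋)} (allFin-elim _ h₂ v)
    ... | inj₁ t = ⊥-elim (true≢false (∧-intro av (⌊⌋-complete (height v ≤? m) hv)) (not-true⇒false t))
    ... | inj₂ t = ⌊⌋-sound (rk v ≤? rk u) t

  isTop-complete : ∀ m x u → IsTop m x u → isTop m x u ≡ true
  isTop-complete m x u (a , l , below) = ∧-intro (∧-intro a (⌊⌋-complete (height u ≤? m) l)) (allFin-intro _ go)
    where
    go : ∀ v → (not (Anc x v ∧ ⌊ height v ≤? m ⌋) ∨ ⌊ rk v ≤? rk u ⌋) ≡ true
    go v with bool-cases (Anc x v ∧ ⌊ height v ≤? m ⌋)
    ... | inj₂ e rewrite e = refl
    ... | inj₁ e with ∧-elim {Anc x v} e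
    ...   | av , hv = ∨-introʳ {not (Anc x v ∧ ⌊ height v ≤? m ⌋)} (⌊⌋-complete (rk v ≤? rk u) (below v av (⌊⌋-sound (height v ≤? m) hv)))

  opaque
    top : ℕ → Fin n → Maybe (Fin n)
    top m x = first (isTop m x)

    top-sound : ∀ {m x u} → top m x ≡ just u → IsTop m x u
    top-sound {m} {x} e = isTop-sound m x _ (first-sound (isTop m x) e)

    top-complete : ∀ {m x u} → IsTop m x u → top m x ≡ just u
    top-complete {m} {x} {u} t with first-complete (isTop m x) u (isTop-complete m x u t)
    ... | u′ , e with top-sound e
    ...   | a , l , below = trans e (cong just (rk-inj u′ u (ℕₚ.≤-antisym (proj₂ (proj₂ t) u′ a l) (below u (proj₁ t) (proj₁ (proj₂ t))))))

    top-cong : ∀ {m x y} → (∀ u → IsTop m x u → IsTop m y u) → (∀ u → IsTop m y u → IsTop m x u) → top m x ≡ top m y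
    top-cong {m} {x} {y} f g = first-cong λ u → iff⇒≡ (λ t → isTop-complete m y u (f u (isTop-sound m x u t))) (λ t → isTop-complete m x u (g u (isTop-sound m y u t)))

  taller-below : ∀ {x u v} → Anc x u ≡ true → Anc x v ≡ true → height v ≤ height u → rk v ≤ rk u
  taller-below {x} {u} {v} a b le = ℕₚ.≮⇒≥ λ lt →
    ℕₚ.<⇒≱ (height-< (A-chain b a (ℕₚ.<⇒≤ lt)) (λ e → ℕₚ.<-irrefl (cong rk (sym e)) lt)) le

  top-exists : ∀ {m x v} → Anc x v ≡ true → height v ≤ m → ∃[ u ] top m x ≡ just u
  top-exists {m} {x} {v} a l with argminOn (λ u → Anc x u ∧ ⌊ height u ≤? m ⌋) (λ u → q ∸ height u) v (∧-intro a (⌊⌋-complete (height v ≤? m) l))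
  ... | u , h , best with ∧-elim {Anc x u} h
  ...   | au , lu = u , top-complete (au , ⌊⌋-sound (height u ≤? m) lu , λ w aw lw → taller-below au aw
            (ℕₚ.≮⇒≥ λ lt → ℕₚ.<⇒≱ (ℕₚ.∸-monoʳ-< lt (height-≤ w)) (best w (∧-intro aw (⌊⌋-complete (height w ≤? m) lw)))))

  top-suc : ∀ m {x} → inJ x ≡ true → ∃[ u ] top (suc m) x ≡ just u
  top-suc m {x} j with argminOn (Anc x) rk x (A-refl j)
  ... | u , a , least = top-exists a (ℕₚ.≤-trans (count-≤-list _ (χ u ∷ []) single) (s≤s z≤n))
    where
    single : ∀ c → anyFin n (λ v → Anc u v ∧ (χ v == c)) ≡ true → c ∈ χ u ∷ []
    single c t with anyFin-elim (λ v → Anc u v ∧ (χ v == c)) t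
    ... | v , s with ∧-elim {Anc u v} s
    ...   | av , e with rk-inj v u (ℕₚ.≤-antisym (A-rk av) (least v (A-trans a av)))
    ...     | refl = here (sym (==-sound e))

  top-zero : ∀ x → top 0 x ≡ nothing
  top-zero x with top 0 x in e
  ... | nothing = refl
  ... | just u with top-sound e
  ...   | a , l , _ = ⊥-elim (ℕₚ.<⇒≱ (height-pos (proj₂ (A-in a))) l)

  top-self : ∀ {x} → inJ x ≡ true → top q x ≡ just x
  top-self {x} j = top-complete (A-refl j , height-≤ x , λ v a _ → A-rk a)

  top-Anc : ∀ {m x v} → Anc x v ≡ true → m ≤ height v → top m x ≡ top m v
  top-Anc {m} {x} {v} a l = top-cong
    (λ u (au , lu , b) → below u au lu , lu , λ w aw lw → b w (A-trans a aw) lw)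
    (λ u (au , lu , b) → A-trans a au , lu , λ w aw lw → b w (below w aw lw) lw)
    where
    below : ∀ w → Anc x w ≡ true → height w ≤ m → Anc v w ≡ true
    below w aw lw = A-chain a aw (taller-below a aw (ℕₚ.≤-trans lw l))

  top-top : ∀ {m m′ x u} → m ≤ m′ → top m′ x ≡ just u → top m x ≡ top m u
  top-top {m} {m′} {x} {u} le e with top-sound e
  ... | a , l , b with m ≤? height u
  ...   | yes q = top-Anc a q
  ...   | no q = trans (top-complete (a , ℕₚ.<⇒≤ (ℕₚ.≰⇒> q) , λ v av lv → b v av (ℕₚ.≤-trans lv le)))
                   (sym (top-complete (A-refl (proj₂ (A-in a)) , ℕₚ.<⇒≤ (ℕₚ.≰⇒> q) , λ v av _ → A-rk av)))

  top-nest : ∀ {m x y} → inJ x ≡ true → inJ y ≡ true → top (suc m) x ≡ top (suc m) y → top m x ≡ top m y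
  top-nest {m} {x} {y} jx jy e with top-suc m jx
  ... | u , eu = trans (top-top (ℕₚ.n≤1+n m) eu) (sym (top-top (ℕₚ.n≤1+n m) (trans (sym e) eu)))

  -- A common ancestor of height above `m` would have the same level-`(m + 1)` node as `x` and as
  -- `y`. So `v` has height at most `m`, and it lies above the last such ancestor of `x`.
  common-ancestor : ∀ {m x y v} → Anc x v ≡ true → Anc y v ≡ true → top (suc m) x ≢ top (suc m) y →
                    height v ≤ m × (∃[ u ] (top m x ≡ just u × Anc u v ≡ true))
  common-ancestor {m} {x} {y} {v} ax ay ne = low , u , e , A-chain (proj₁ s) ax (proj₂ (proj₂ s) v ax low)
    where
    low : height v ≤ m
    low = ℕₚ.≮⇒≥ λ lt → ne (trans (top-Anc ax lt) (sym (top-Anc ay lt)))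
    u = proj₁ (top-exists ax low)
    e = proj₂ (top-exists ax low)
    s = top-sound e

  ancestorOf : Fin n → Fin q → Maybe (Fin n)
  ancestorOf z c = first (λ u → Anc z u ∧ (χ u == c))

  ancestorOf-complete : ∀ {z u} → Anc z u ≡ true → ancestorOf z (χ u) ≡ just u
  ancestorOf-complete {z} {u} a with first-complete (λ v → Anc z v ∧ (χ v == χ u)) u (∧-intro a (==-refl (χ u)))
  ... | v , e with ∧-elim {Anc z v} (first-sound (λ v → Anc z v ∧ (χ v == χ u)) e)
  ...   | av , c = trans e (cong just (Anc-colour-injective av a (==-sound c)))

  ancestors : Fin n → List (Fin n)
  ancestors z = concatMap (λ c → maybeList (ancestorOf z c)) (elems {q} (λ _ → true))

  ancestors-len : ∀ z → length (ancestors z) ≤ q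
  ancestors-len z = ℕₚ.≤-trans (length-concatMap-≤ (λ c → maybeList (ancestorOf z c)) (elems {q} (λ _ → true)) (λ c _ → maybeList-len (ancestorOf z c)))
    (ℕₚ.≤-reflexive (trans (ℕₚ.*-identityʳ _) (elems-all-len q)))

  ancestors-cov : ∀ {z u} → Anc z u ≡ true → u ∈ ancestors z
  ancestors-cov {z} {u} a = ∈-concatMap (λ c → maybeList (ancestorOf z c)) (elems {q} (λ _ → true)) (elems-complete (λ _ → true) (χ u) refl)
    (subst (λ o → u ∈ maybeList o) (sym (ancestorOf-complete a)) (here refl))

-- A graph on Fin h with vertices ι x in the leaves of a bounded-depth forest on Fin n; t m x is the
-- level-m node above x, and adjacency of x and y is given by M at the last level at which their
-- nodes agree.  Cl u is the set of vertices below u.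
record TreeModel {h} (adjH : Rel h) {n} (â : Rel n) (ι : Fin h → Fin n) (q ρ K : ℕ) (M : Fin K → Fin K → Bool) : Set where
  field
    U        : Fin h → Bool
    t        : ℕ → Fin h → Maybe (Fin n)
    t-zero   : ∀ x y → t 0 x ≡ t 0 y
    t-nest   : ∀ m x y → U x ≡ true → U y ≡ true → t (suc m) x ≡ t (suc m) y → t m x ≡ t m y
    t-top    : ∀ x → U x ≡ true → t q x ≡ just (ι x)
    t-just   : ∀ m x → U x ≡ true → ∃[ u ] t (suc m) x ≡ just u
    ℓ        : ℕ → Fin h → Fin K
    model    : ∀ m x y → U x ≡ true → U y ≡ true → t m x ≡ t m y → t (suc m) x ≢ t (suc m) y → adjH x y ≡ M (ℓ m x) (ℓ m y)
    Cl       : Rel n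
    Cl-t     : ∀ {m x u} → t m x ≡ just u → Cl u (ι x) ≡ true
    Cl-nest  : ∀ {m m′ x u u′} → m′ ≤ m → t m x ≡ just u → t m′ x ≡ just u′ → Cl u′ u ≡ true
    cand     : Fin n → List (Fin n)
    cand-len : ∀ z → length (cand z) ≤ q
    cand-cov : ∀ {u z} → Cl u z ≡ true → u ∈ cand z
    Cl-conn  : ∀ {u z} → Cl u z ≡ true → Path (restrict â (Cl u)) ρ z u

tableOf : ∀ K → Fin (K * #Sets (K * K)) → Fin K → Fin K → Bool
tableOf K α α′ β = member (K * K) (proj₂ (remQuot {K} (#Sets (K * K)) α)) (combine α′ β)

labelOf : ∀ K → Fin (K * #Sets (K * K)) → Fin K
labelOf K α = proj₁ (remQuot {K} (#Sets (K * K)) α)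

labelOf-combine : ∀ K α T → labelOf K (combine α T) ≡ α
labelOf-combine K α T = cong proj₁ (Finₚ.remQuot-combine {K} {#Sets (K * K)} α T)

tableOf-combine : ∀ K α p α′ β → tableOf K (combine α (toSet (K * K) p)) α′ β ≡ p (combine α′ β)
tableOf-combine K α p α′ β = trans (cong (λ c → member (K * K) (proj₂ c) (combine α′ β)) (Finₚ.remQuot-combine {K} {#Sets (K * K)} α (toSet (K * K) p)))
  (member-toSet (K * K) p (combine α′ β))

-- The table of a node varies with the graph and the node. It is carried inside the labels, so that
-- one fixed `M` serves all graphs and can be written into formulas; the disjunction makes it
-- symmetric.
modelTable : ∀ K → Fin (K * #Sets (K * K)) → Fin (K * #Sets (K * K)) → Bool
modelTable K α β = tableOf K α (labelOf K α) (labelOf K β) ∨ tableOf K β (labelOf K β) (labelOf K α)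

modelTable-sym : ∀ K α β → modelTable K α β ≡ modelTable K β α
modelTable-sym K α β = Data.Bool.Properties.∨-comm (tableOf K α (labelOf K α) (labelOf K β)) _

-- Two vertices of U are separated, in the metric of the graph without the common ancestors u of
-- their tree node, so locality determines their adjacency from labels depending on that node.
module TreeModelOf (G : Graph) {c} (col : Fin c → Fin (size G) → Bool) (ψ : Formula c 2)
  (w : ℕ) (W : WCol (adj G) (radius ψ) w) (q ρ : ℕ) (F : Forest (Hat.hat (adj G) (adj-sym G) (radius ψ) w W) q ρ)
  (H : Graph) (ι : Fin (size H) → Fin (size G))
  (ι-adj : ∀ i j → i ≢ j → adj H i j ≡ (eval G col ψ (pair (ι i) (ι j)) ∨ eval G col ψ (pair (ι j) (ι i))))
  (U : Fin (size H) → Bool) (U-in : ∀ i → U i ≡ true → Forest.inJ F (ι i) ≡ true)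
  (U-reach : ∀ i z → U i ≡ true → Hat.reaches (adj G) (adj-sym G) (radius ψ) w W (ι i) z ≡ true → Forest.inJ F z ≡ true)
  (K : ℕ) (loc : (X : Context c (#Sets q * #Sets q)) → PairLocal X ψ K) where

  open Hat (adj G) (adj-sym G) (radius ψ) w W
  open Forest F hiding (rk)
  open Levels F

  private
    R = radius ψ
    h = size H

    -- The vertices above a node, at most one per colour, so `q` slots suffice; at level 0 nothing
    -- is deleted.
    separator : Maybe (Fin (size G)) → Fin q → Maybe (Fin (size G))
    separator nothing  c = nothing
    separator (just u) c = ancestorOf u c

    module Del o = Deletion G col (separator o)

    local : ∀ o → PairLocal (Del.context o) ψ K
    local o = loc (Del.context o)

    deleted-anc : ∀ {u v} → Anc u v ≡ true → Del.deleted (just u) v ≡ true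
    deleted-anc {u} {v} a = anyFin-intro (λ c → is (ancestorOf u c) v) (χ v)
      (subst (λ o → is o v ≡ true) (sym (ancestorOf-complete a)) (==-refl v))

    t : ℕ → Fin h → Maybe (Fin (size G))
    t m i = top m (ι i)

    comparable : ∀ i z → U i ≡ true → reaches (ι i) z ≡ true → Anc (ι i) z ≡ true ⊎ Anc z (ι i) ≡ true
    comparable i z ui r with ι i ≟ z
    ... | yes e = inj₁ (subst (λ z → Anc (ι i) z ≡ true) e (A-refl (U-in i ui)))
    ... | no ne = A-adj (reaches-hat ne r) (U-in i ui) (U-reach i z ui r)

    -- The least vertex `z` of a short walk is weakly reached from both ends, hence comparable with
    -- both in the forest. In each of the four cases `z` or one of the ends is a common ancestor of
    -- the ends; these are all deleted by `common-ancestor`, yet the walk avoids deleted vertices.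
    far : ∀ m i j → U i ≡ true → U j ≡ true → t (suc m) i ≢ t (suc m) j → ¬ Path (Del.remaining (t m i)) R (ι i) (ι j)
    far m i j ui uj ne p with least-on-walk {Del.remaining (t m i)} (restrict-forget {a = adj G}) (restrict-sym (adj-sym G)) p
    ... | z , pz , rx , ry = go (comparable i z ui rx) (comparable j z uj ry)
      where
      x≢y : ι i ≢ ι j
      x≢y e = ne (cong (top (suc m)) e)
      kept : Fin (size G) → Set
      kept v = not (Del.deleted (t m i) v) ≡ true
      x-kept : kept (ι i)
      x-kept = proj₁ (restrict-ends p x≢y)
      y-kept : kept (ι j)
      y-kept = proj₂ (restrict-ends p x≢y)
      z-kept : kept z
      z-kept = restrict-end pz x-kept
      bad : ∀ v → kept v → Anc (ι i) v ≡ true → Anc (ι j) v ≡ true → ⊥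
      bad v kv ax ay with common-ancestor ax ay ne
      ... | _ , u , e , a = true≢false (subst (λ o → Del.deleted o v ≡ true) (sym e) (deleted-anc a)) (not-true⇒false kv)
      go : Anc (ι i) z ≡ true ⊎ Anc z (ι i) ≡ true → Anc (ι j) z ≡ true ⊎ Anc z (ι j) ≡ true → ⊥
      go (inj₁ a) (inj₁ b) = bad z z-kept a b
      go (inj₂ a) (inj₁ b) = bad (ι i) x-kept (A-refl (U-in i ui)) (A-trans b a)
      go (inj₁ a) (inj₂ b) = bad (ι j) y-kept (A-trans a b) (A-refl (U-in j uj))
      go (inj₂ a) (inj₂ b) with ℕₚ.≤-total (Forest.rk F (ι i)) (Forest.rk F (ι j))
      ... | inj₁ le = bad (ι i) x-kept (A-refl (U-in i ui)) (A-chain b a le)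
      ... | inj₂ le = bad (ι j) y-kept (A-chain a b le) (A-refl (U-in j uj))

    lab₀ : ℕ → Fin h → Fin K
    lab₀ m i = plab (local (t m i)) (ι i)

    _≟ₜ_ : (u v : Maybe (Fin (size G))) → Dec (u ≡ v)
    _≟ₜ_ = Maybeₚ.≡-dec _≟_

    record Split (m : ℕ) (o : Maybe (Fin (size G))) (i j : Fin h) : Set where
      constructor split
      field
        ui : U i ≡ true
        uj : U j ≡ true
        oi : t m i ≡ o
        oj : t m j ≡ o
        ne : t (suc m) i ≢ t (suc m) j

    isSplit : ℕ → Maybe (Fin (size G)) → Rel h
    isSplit m o i j = (U i ∧ U j) ∧ ((⌊ t m i ≟ₜ o ⌋ ∧ ⌊ t m j ≟ₜ o ⌋) ∧ not ⌊ t (suc m) i ≟ₜ t (suc m) j ⌋)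

    isSplit-sound : ∀ m o i j → isSplit m o i j ≡ true → Split m o i j
    isSplit-sound m o i j s with ∧-elim {U i ∧ U j} s
    ... | s₁ , s₂ with ∧-elim {U i} s₁ | ∧-elim {⌊ t m i ≟ₜ o ⌋ ∧ ⌊ t m j ≟ₜ o ⌋} s₂
    ...   | ui , uj | s₃ , s₄ with ∧-elim {⌊ t m i ≟ₜ o ⌋} s₃
    ...     | e , e′ = split ui uj (⌊⌋-sound (t m i ≟ₜ o) e) (⌊⌋-sound (t m j ≟ₜ o) e′) (⌊⌋-refute (t (suc m) i ≟ₜ t (suc m) j) (not-true⇒false s₄))

    isSplit-complete : ∀ {m o i j} → Split m o i j → isSplit m o i j ≡ true
    isSplit-complete {m} {o} {i} {j} (split ui uj oi oj ne) = ∧-intro (∧-intro ui uj)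
      (∧-intro (∧-intro (⌊⌋-complete (t m i ≟ₜ o) oi) (⌊⌋-complete (t m j ≟ₜ o) oj)) (not-true (⌊⌋-false (t (suc m) i ≟ₜ t (suc m) j) ne)))

    determined : ∀ {m o i j i′ j′} → Split m o i j → Split m o i′ j′ → lab₀ m i ≡ lab₀ m i′ → lab₀ m j ≡ lab₀ m j′ → adj H i j ≡ adj H i′ j′
    determined {m} {o} {i} {j} {i′} {j′} s s′ e e′ = trans (ι-adj i j (diff s)) (trans
      (cong₂ _∨_ (pdet l _ _ _ _ (farO s) (farO s′) ei ej)
                 (pdet l _ _ _ _ (λ p → farO s (rev p)) (λ p → farO s′ (rev p)) ej ei)) (sym (ι-adj i′ j′ (diff s′))))
      where
      l = local o
      diff : ∀ {i j} → Split m o i j → i ≢ j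
      diff s e = Split.ne s (cong (t (suc m)) e)
      farO : ∀ {i j} → Split m o i j → ¬ Path (Del.remaining o) R (ι i) (ι j)
      farO {i} {j} (split ui uj refl oj ne) = far m i j ui uj ne
      rev : ∀ {u v} → Path (Del.remaining o) R u v → Path (Del.remaining o) R v u
      rev = reverse (restrict-sym (adj-sym G))
      lab₀-at : ∀ {i} → t m i ≡ o → lab₀ m i ≡ plab l (ι i)
      lab₀-at refl = refl
      ei : plab l (ι i) ≡ plab l (ι i′)
      ei = trans (sym (lab₀-at (Split.oi s))) (trans e (lab₀-at (Split.oi s′)))
      ej : plab l (ι j) ≡ plab l (ι j′)
      ej = trans (sym (lab₀-at (Split.oj s))) (trans e′ (lab₀-at (Split.oj s′)))

    table : ℕ → Maybe (Fin (size G)) → Fin (K * K) → Bool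
    table m o αβ = anyFin h λ i → anyFin h λ j → isSplit m o i j ∧ ((combine (lab₀ m i) (lab₀ m j) == αβ) ∧ adj H i j)

    table-adj : ∀ {m o i j} → Split m o i j → table m o (combine (lab₀ m i) (lab₀ m j)) ≡ adj H i j
    table-adj {m} {o} {i} {j} s = iff⇒≡ to λ e → anyFin-intro _ i (anyFin-intro _ j (∧-intro (isSplit-complete s) (∧-intro (==-refl _) e)))
      where
      to : table m o (combine (lab₀ m i) (lab₀ m j)) ≡ true → adj H i j ≡ true
      to e with anyFin-elim _ e
      ... | i′ , e₁ with anyFin-elim _ e₁
      ...   | j′ , e₂ with ∧-elim {isSplit m o i′ j′} e₂
      ...     | s′ , e₃ with ∧-elim {combine (lab₀ m i′) (lab₀ m j′) == combine (lab₀ m i) (lab₀ m j)} e₃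
      ...       | c , a with Finₚ.combine-injective (lab₀ m i′) (lab₀ m j′) (lab₀ m i) (lab₀ m j) (==-sound c)
      ...         | ci , cj = trans (determined s (isSplit-sound m o i′ j′ s′) (sym ci) (sym cj)) a

    label : ℕ → Fin h → Fin (K * #Sets (K * K))
    label m i = combine (lab₀ m i) (toSet (K * K) (table m (t m i)))

    raw : ∀ {m o i j} → Split m o i j → tableOf K (label m i) (labelOf K (label m i)) (labelOf K (label m j)) ≡ adj H i j
    raw {m} {o} {i} {j} s@(split _ _ refl _ _) = trans (tableOf-combine K (lab₀ m i) (table m (t m i)) _ _)
      (trans (cong₂ (λ α β → table m (t m i) (combine α β)) (labelOf-combine K (lab₀ m i) _) (labelOf-combine K (lab₀ m j) _)) (table-adj s))

  treeModel : TreeModel (adj H) hat ι q ρ (K * #Sets (K * K)) (modelTable K)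
  treeModel = record
    { U = U ; t = t
    ; t-zero = λ i j → trans (top-zero (ι i)) (sym (top-zero (ι j)))
    ; t-nest = λ m i j ui uj → top-nest (U-in i ui) (U-in j uj)
    ; t-top = λ i ui → top-self (U-in i ui)
    ; t-just = λ m i ui → top-suc m (U-in i ui)
    ; ℓ = label
    ; model = λ m i j ui uj e ne → let s = split ui uj e refl ne ; s′ = split uj ui refl e (λ q → ne (sym q)) in
        sym (trans (cong₂ _∨_ (raw s) (trans (raw s′) (adj-sym H j i))) (Data.Bool.Properties.∨-idem _))
    ; Cl = λ u z → Anc z u
    ; Cl-t = λ e → proj₁ (top-sound e)
    ; Cl-nest = λ le e e′ → proj₁ (top-sound (trans (sym (top-top le e)) e′))
    ; cand = ancestors ; cand-len = ancestors-len ; cand-cov = ancestors-cov ; Cl-conn = A-path }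

-- Making a tree model definable from the graph itself

#types : ℕ → ℕ
#types K = (K * K) * (K * K)

-- One block more than there are types, so that two blocks cross nodes with the same type. The 3
-- extra steps per block keep crossings of different blocks from being consecutive on the path.
diamBound : ℕ → ℕ → ℕ
diamBound K zero    = 1
diamBound K (suc d) = suc (#types K) * (diamBound K d + 3)

-- Follows `decode`: `q` candidate nodes, each yielding one single vertex, or a level, a class of
-- the previous stage and a type.
decodeBound : ℕ → ℕ → ℕ → ℕ
decodeBound q K zero    = 1
decodeBound q K (suc i) = q * suc (q * (decodeBound q K i * #types K))

xor-same : ∀ {a b} → (a xor b) ≡ true → a ≡ b → ⊥
xor-same {true}  {true}  () _
xor-same {false} {false} () _

xor-differ : ∀ {a b} → (a xor b) ≡ false → a ≡ b
xor-differ {true}  {true}  _ = refl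
xor-differ {false} {false} _ = refl

-- Level by level, flip by the table of the model (hb) and pass to connected components (Eqv).  The
-- components refine the nodes of the tree, so they form a tree model again; they have bounded
-- diameter, and a tree node is the least one containing a component only boundedly often.
module Components {h} (adjH : Rel h) (adjH-sym : Sym adjH) {n} {â : Rel n} {ι : Fin h → Fin n} (ι-inj : ∀ x y → ι x ≡ ι y → x ≡ y)
  {q ρ K} {M : Fin K → Fin K → Bool} (M-sym : ∀ α β → M α β ≡ M β α) (TM : TreeModel adjH â ι q ρ K M) where

  open TreeModel TM

  _≟ₜ_ : (u v : Maybe (Fin n)) → Dec (u ≡ v)
  _≟ₜ_ = Maybeₚ.≡-dec _≟_

  ord : Maybe (Fin n) → ℕ
  ord nothing  = 0
  ord (just u) = suc (toℕ u)

  ord-inj : ∀ u v → ord u ≡ ord v → u ≡ v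
  ord-inj nothing  nothing  _ = refl
  ord-inj (just u) (just v) e = cong just (Finₚ.toℕ-injective (ℕₚ.suc-injective e))

  L : ℕ
  L = diamBound K q

  opaque
    flipped : Rel h → ℕ → Rel h
    flipped E i x y = (U x ∧ U y) ∧ (E x y ∧ (adjH x y xor M (ℓ i x) (ℓ i y)))

    flipped-elim : ∀ {E i x y} → flipped E i x y ≡ true → U x ≡ true × U y ≡ true × E x y ≡ true × (adjH x y xor M (ℓ i x) (ℓ i y)) ≡ true
    flipped-elim {E} {i} {x} {y} e with ∧-elim {U x ∧ U y} e
    ... | e₁ , e₂ with ∧-elim {U x} e₁ | ∧-elim {E x y} e₂
    ...   | a , b | c , d = a , b , c , d

    flipped-intro : ∀ {E i x y} → U x ≡ true → U y ≡ true → E x y ≡ true → (adjH x y xor M (ℓ i x) (ℓ i y)) ≡ true → flipped E i x y ≡ true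
    flipped-intro a b c d = ∧-intro (∧-intro a b) (∧-intro c d)

  Eqv : ℕ → Rel h
  hb  : ℕ → Rel h
  Eqv zero    x y = true
  Eqv (suc i) x y = near (hb i) L x y
  hb i = flipped (Eqv i) i

  record Good (i : ℕ) : Set where
    field
      e-refl  : ∀ x → Eqv i x x ≡ true
      e-sym   : ∀ {x y} → Eqv i x y ≡ true → Eqv i y x ≡ true
      e-trans : ∀ {x y z} → Eqv i x y ≡ true → Eqv i y z ≡ true → Eqv i x z ≡ true
      e-t     : ∀ {x y} → Eqv i x y ≡ true → t i x ≡ t i y

  type : ℕ → ℕ → Fin h → Fin h → Fin (#types K)
  type i m x y = combine (combine (ℓ m x) (ℓ i x)) (combine (ℓ m y) (ℓ i y))

  type-elim : ∀ i m x y x′ y′ → type i m x y ≡ type i m x′ y′ → (ℓ m x ≡ ℓ m x′ × ℓ i x ≡ ℓ i x′) × (ℓ m y ≡ ℓ m y′ × ℓ i y ≡ ℓ i y′)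
  type-elim i m x y x′ y′ e with Finₚ.combine-injective (combine (ℓ m x) (ℓ i x)) (combine (ℓ m y) (ℓ i y)) (combine (ℓ m x′) (ℓ i x′)) (combine (ℓ m y′) (ℓ i y′)) e
  ... | a , b = Finₚ.combine-injective (ℓ m x) (ℓ i x) (ℓ m x′) (ℓ i x′) a , Finₚ.combine-injective (ℓ m y) (ℓ i y) (ℓ m y′) (ℓ i y′) b

  module AtLevel (i : ℕ) (good : Good i) where
    open Good good

    hb-sym : Sym (hb i)
    hb-sym x y = iff⇒≡ (go x y) (go y x)
      where
      go : ∀ x y → hb i x y ≡ true → hb i y x ≡ true
      go x y e with flipped-elim e
      ... | a , b , c , d = flipped-intro b a (e-sym c) (trans (cong₂ _xor_ (adjH-sym y x) (M-sym (ℓ i y) (ℓ i x))) d)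

    -- Inside a class of stage `i`, adjacency between different nodes of level `i + 1` is what the
    -- table says, and the flip erases it. So components refine these nodes.
    hb-t : ∀ {x y} → hb i x y ≡ true → t (suc i) x ≡ t (suc i) y
    hb-t {x} {y} e with flipped-elim e
    ... | a , b , c , d with t (suc i) x ≟ₜ t (suc i) y
    ...   | yes q = q
    ...   | no ne = ⊥-elim (xor-same d (model i x y a b (e-t c) ne))

    -- Not both `x`, `y′` and `x′`, `y` can share a level-`(m + 1)` node, since both crossings go
    -- upward in `ord`. The pair that is split has the same labels as `x`, `y` at levels `m` and
    -- `i`, so the model gives it the same adjacency and the same flip.
    crossing-swap : ∀ m {x y x′ y′} → t m x ≡ t m y → t m x ≡ t m x′ → t m x ≡ t m y′ →
      ord (t (suc m) x) < ord (t (suc m) y) → ord (t (suc m) x′) < ord (t (suc m) y′) → type i m x y ≡ type i m x′ y′ →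
      Eqv i x x′ ≡ true → hb i x y ≡ true → hb i x′ y′ ≡ true → hb i x y′ ≡ true ⊎ hb i x′ y ≡ true
    crossing-swap m {x} {y} {x′} {y′} ty tx′ ty′ lt lt′ et exx′ e e′ with flipped-elim e | flipped-elim e′ | type-elim i m x y x′ y′ et
    ... | ux , uy , exy , d | ux′ , uy′ , ex′y′ , _ | (mx , ix) , (my , iy) with t (suc m) x ≟ₜ t (suc m) y′
    ...   | no ne = inj₁ (flipped-intro ux uy′ (e-trans exx′ ex′y′) (trans (cong₂ _xor_ same (cong (M (ℓ i x)) (sym iy))) d))
      where
      same : adjH x y′ ≡ adjH x y
      same = trans (model m x y′ ux uy′ ty′ ne) (trans (cong (M (ℓ m x)) (sym my)) (sym (model m x y ux uy ty λ q → ℕₚ.<-irrefl (cong ord q) lt)))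
    ...   | yes eq = inj₂ (flipped-intro ux′ uy (e-trans (e-sym exx′) exy) (trans (cong₂ _xor_ same (cong (λ α → M α (ℓ i y)) (sym ix))) d))
      where
      ne′ : t (suc m) x′ ≢ t (suc m) y
      ne′ q = ℕₚ.<-irrefl (cong ord q) (ℕₚ.<-trans lt′ (subst (λ o → ord o < ord (t (suc m) y)) eq lt))
      same : adjH x′ y ≡ adjH x y
      same = trans (model m x′ y ux′ uy (trans (sym tx′) ty) ne′) (trans (cong (λ α → M α (ℓ m y)) (sym mx)) (sym (model m x y ux uy ty λ q → ℕₚ.<-irrefl (cong ord q) lt)))

    private
      geo-Eqv : ∀ {ℓ′ v} → Geodesic (hb i) ℓ′ v → ∀ s → s ≤ ℓ′ → Eqv i (v 0) (v s) ≡ true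
      geo-Eqv g zero    l = e-refl _
      geo-Eqv g (suc s) l = e-trans (geo-Eqv g s (ℕₚ.<⇒≤ l)) (proj₁ (proj₂ (proj₂ (flipped-elim (Geodesic.edges g s l)))))

      -- Induction on the levels below a node containing the path. By induction every block crosses
      -- between child nodes; two blocks cross with equal types, and exchanging ends gives a chord
      -- of the induced path. At level `q` nodes are single vertices.
      no-geodesic : ∀ d m → m + d ≡ q → ∀ v → Geodesic (hb i) (diamBound K d) v → (∀ s → s ≤ diamBound K d → t m (v s) ≡ t m (v 0)) → ⊥
      no-geodesic zero m e v g same with flipped-elim (Geodesic.edges g 0 ℕₚ.≤-refl)
      ... | a , b , _ = Geodesic.distinct g 0 1 ℕₚ.≤-refl ℕₚ.≤-refl (ι-inj _ _ (just-injective
              (trans (sym (t-top (v 0) a)) (trans (subst (λ m → t m (v 0) ≡ t m (v 1)) m≡q (sym (same 1 ℕₚ.≤-refl))) (t-top (v 1) b)))))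
        where
        m≡q : m ≡ q
        m≡q = trans (sym (ℕₚ.+-identityʳ m)) e
      no-geodesic (suc d) m e v g same = finish (Finₚ.pigeonhole (ℕₚ.n<1+n (#types K)) blockType)
        where
        Ld = diamBound K d
        B = Ld + 3
        full = suc (#types K) * B
        begins : Fin (suc (#types K)) → ℕ
        begins b = toℕ b * B
        block-end : ∀ b → begins b + B ≤ full
        block-end b = subst (_≤ full) (ℕₚ.+-comm B (begins b)) (ℕₚ.*-monoˡ-≤ B (Finₚ.toℕ<n b))
        node : ℕ → Maybe (Fin n)
        node s = t (suc m) (v s)
        record Crossing (b : Fin (suc (#types K))) : Set where
          field
            p lo hi : ℕ
            p≥  : begins b ≤ p
            p<  : p < begins b + Ld
            lo≥ : p ≤ lo
            lo≤ : lo ≤ suc p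
            hi≥ : p ≤ hi
            hi≤ : hi ≤ suc p
            lo<hi : ord (node lo) < ord (node hi)
            lohi : hb i (v lo) (v hi) ≡ true
        within : ∀ b s → s < begins b + B → s ≤ full
        within b s lt = ℕₚ.≤-trans (ℕₚ.<⇒≤ lt) (block-end b)
        B-room : ∀ b s → s ≤ Ld → begins b + s < begins b + B
        B-room b s l = ℕₚ.+-monoʳ-< (begins b) (ℕₚ.≤-<-trans l (ℕₚ.m<m+n Ld (s≤s z≤n)))
        crossing : ∀ b → Crossing b
        crossing b with find {Ld} (λ s → not ⌊ node (begins b + toℕ s) ≟ₜ node (suc (begins b + toℕ s)) ⌋)
        -- A block without a crossing would be an induced path inside one node of level `m + 1`.
        ... | inj₂ none = ⊥-elim (no-geodesic d (suc m) (trans (sym (ℕₚ.+-suc m d)) e) (λ s → v (begins b + s)) shifted constant)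
          where
          shifted : Geodesic (hb i) Ld (λ s → v (begins b + s))
          shifted = record
            { edges = λ s lt → subst (λ z → hb i (v (begins b + s)) (v z) ≡ true) (sym (ℕₚ.+-suc (begins b) s))
                        (Geodesic.edges g (begins b + s) (within b _ (subst (_< begins b + B) (ℕₚ.+-suc (begins b) s) (B-room b (suc s) lt))))
            ; distinct = λ s s′ lt le → Geodesic.distinct g _ _ (ℕₚ.+-monoʳ-< (begins b) lt) (within b _ (B-room b s′ le))
            ; induced = λ s s′ lt le → Geodesic.induced g _ _ (subst (_< begins b + s′) (ℕₚ.+-suc (begins b) s) (ℕₚ.+-monoʳ-< (begins b) lt)) (within b _ (B-room b s′ le)) }
          step-same : ∀ s → s < Ld → node (begins b + s) ≡ node (begins b + suc s)
          step-same s lt = subst (λ z → node (begins b + s) ≡ node z) (sym (ℕₚ.+-suc (begins b) s)) (decide (node (begins b + s) ≟ₜ node (suc (begins b + s)))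
            (λ ne → true≢false (not-true (⌊⌋-false (node (begins b + s) ≟ₜ node (suc (begins b + s))) ne))
              (subst (λ z → not ⌊ node (begins b + z) ≟ₜ node (suc (begins b + z)) ⌋ ≡ false) (Finₚ.toℕ-fromℕ< lt) (none (fromℕ< lt)))))
            where
            decide : ∀ {P : Set} → Dec P → ¬ ¬ P → P
            decide (yes p) _ = p
            decide (no ¬p) k = ⊥-elim (k ¬p)
          constant : ∀ s → s ≤ Ld → node (begins b + s) ≡ node (begins b + 0)
          constant zero    l = refl
          constant (suc s) l = trans (sym (step-same s l)) (constant s (ℕₚ.<⇒≤ l))
        ... | inj₁ (s , ne) = orient (ℕₚ.<-cmp (ord (node p)) (ord (node (suc p))))
          where
          p = begins b + toℕ s
          p< : p < begins b + Ld
          p< = ℕₚ.+-monoʳ-< (begins b) (Finₚ.toℕ<n s)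
          e′ : hb i (v p) (v (suc p)) ≡ true
          e′ = Geodesic.edges g p (within b (suc p) (ℕₚ.≤-<-trans p< (B-room b Ld ℕₚ.≤-refl)))
          orient : _ → Crossing b
          orient (Relation.Binary.tri< l _ _) = record { p = p ; lo = p ; hi = suc p ; p≥ = ℕₚ.m≤m+n _ _ ; p< = p< ; lo≥ = ℕₚ.≤-refl ; lo≤ = ℕₚ.n≤1+n p
            ; hi≥ = ℕₚ.n≤1+n p ; hi≤ = ℕₚ.≤-refl ; lo<hi = l ; lohi = e′ }
          orient (Relation.Binary.tri> _ _ l) = record { p = p ; lo = suc p ; hi = p ; p≥ = ℕₚ.m≤m+n _ _ ; p< = p< ; lo≥ = ℕₚ.n≤1+n p ; lo≤ = ℕₚ.≤-refl
            ; hi≥ = ℕₚ.≤-refl ; hi≤ = ℕₚ.n≤1+n p ; lo<hi = l ; lohi = trans (hb-sym (v (suc p)) (v p)) e′ }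
          orient (Relation.Binary.tri≈ _ l _) = ⊥-elim (⌊⌋-refute (node p ≟ₜ node (suc p)) (not-true⇒false ne) (ord-inj _ _ l))
        blockType : Fin (suc (#types K)) → Fin (#types K)
        blockType b = type i m (v (Crossing.lo (crossing b))) (v (Crossing.hi (crossing b)))
        finish : ∃[ b ] ∃[ b′ ] (b Fin.< b′ × blockType b ≡ blockType b′) → ⊥
        finish (b , b′ , lt , et) = clash (crossing-swap m (eqT lo′< hi′<) (eqT lo′< lo″<) (eqT lo′< hi″<) (Crossing.lo<hi X) (Crossing.lo<hi Y) et
                                   (e-trans (e-sym (geo-Eqv g _ lo′<)) (geo-Eqv g _ lo″<)) (Crossing.lohi X) (Crossing.lohi Y))
          where
          X = crossing b
          Y = crossing b′
          eqT : ∀ {s s′} → s ≤ full → s′ ≤ full → t m (v s) ≡ t m (v s′)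
          eqT l l′ = trans (same _ l) (sym (same _ l′))
          end : ∀ b (C : Crossing b) {s} → s ≤ suc (Crossing.p C) → s ≤ full
          end b C l = ℕₚ.≤-trans l (within b _ (ℕₚ.≤-<-trans (Crossing.p< C) (B-room b Ld ℕₚ.≤-refl)))
          lo′< = end b X (Crossing.lo≤ X)
          hi′< = end b X (Crossing.hi≤ X)
          lo″< = end b′ Y (Crossing.lo≤ Y)
          hi″< = end b′ Y (Crossing.hi≤ Y)
          gap : ∀ {s s′} → s ≤ suc (Crossing.p X) → Crossing.p Y ≤ s′ → suc s < s′
          gap {s} {s′} l l′ = begin-strict
            suc s                        ≤⟨ s≤s l ⟩
            suc (suc (Crossing.p X))     ≤⟨ s≤s (Crossing.p< X) ⟩
            suc (begins b + Ld)           <⟨ ℕₚ.n<1+n _ ⟩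
            2 + (begins b + Ld)           ≤⟨ ℕₚ.n≤1+n _ ⟩
            3 + (begins b + Ld)           ≡⟨ solve 2 (λ a b → con 3 :+ (a :+ b) := a :+ (b :+ con 3)) refl (begins b) Ld ⟩
            begins b + B                  ≡⟨ ℕₚ.+-comm (begins b) B ⟩
            suc (toℕ b) * B              ≤⟨ ℕₚ.*-monoˡ-≤ B lt ⟩
            begins b′                     ≤⟨ Crossing.p≥ Y ⟩
            Crossing.p Y                 ≤⟨ l′ ⟩
            s′                           ∎
            where
            open ℕₚ.≤-Reasoning
            open ℕSolver.+-*-Solver using (solve; _:+_; _:=_; con)
          clash : hb i (v (Crossing.lo X)) (v (Crossing.hi Y)) ≡ true ⊎ hb i (v (Crossing.lo Y)) (v (Crossing.hi X)) ≡ true → ⊥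
          clash (inj₁ a) = true≢false a (Geodesic.induced g _ _ (gap (Crossing.lo≤ X) (Crossing.hi≥ Y)) hi″<)
          clash (inj₂ a) = true≢false (trans (hb-sym _ _) a) (Geodesic.induced g _ _ (gap (Crossing.hi≤ X) (Crossing.lo≥ Y)) lo″<)

    -- Connectedness is distance at most `L`, with `L` independent of the graph. This makes the
    -- components definable by formulas.
    component : ∀ {k x y} → Path (hb i) k x y → Eqv (suc i) x y ≡ true
    component p = near-complete (shorten L (λ v g → no-geodesic q 0 refl v g (λ s _ → t-zero (v s) (v 0))) p)

    component⁻ : ∀ {x y} → Eqv (suc i) x y ≡ true → Path (hb i) L x y
    component⁻ = near-sound L

    good-suc : Good (suc i)
    good-suc = record
      { e-refl = λ x → near-complete stop
      ; e-sym = λ e → near-complete (reverse hb-sym (component⁻ e))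
      ; e-trans = λ e e′ → component (component⁻ e ▹▹ component⁻ e′)
      ; e-t = λ e → along (component⁻ e) }
      where
      along : ∀ {k x y} → Path (hb i) k x y → t (suc i) x ≡ t (suc i) y
      along stop = refl
      along (e ▸ p) = trans (hb-t e) (along p)

  good : ∀ i → Good i
  good zero = record { e-refl = λ _ → refl ; e-sym = λ _ → refl ; e-trans = λ _ _ → refl ; e-t = λ {x} {y} _ → t-zero x y }
  good (suc i) = AtLevel.good-suc i (good i)

-- Connected clusters of the components and their congestion

module ComponentClusters {h} (adjH : Rel h) (adjH-sym : Sym adjH) {n} {â : Rel n} {ι : Fin h → Fin n} (ι-inj : ∀ x y → ι x ≡ ι y → x ≡ y)
  {q ρ K} {M : Fin K → Fin K → Bool} (M-sym : ∀ α β → M α β ≡ M β α) (TM : TreeModel adjH â ι q ρ K M) where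

  open TreeModel TM
  open Components adjH adjH-sym ι-inj M-sym TM
  module E i = Good (good i)

  opaque
    rep : ℕ → Fin h → Fin h
    rep i x = Maybe.fromMaybe x (first (Eqv i x))

    rep-class : ∀ i x → Eqv i x (rep i x) ≡ true
    rep-class i x with first (Eqv i x) in e
    ... | just z  = first-sound (Eqv i x) e
    ... | nothing = E.e-refl i x

    rep-cong : ∀ i {x y} → Eqv i x y ≡ true → rep i x ≡ rep i y
    rep-cong i {x} {y} e with first-complete (Eqv i x) y e | first-cong {p = Eqv i x} {Eqv i y} (λ z → iff⇒≡ (λ t → E.e-trans i (E.e-sym i e) t) (λ t → E.e-trans i e t))
    ... | z , q | q′ = trans (cong (Maybe.fromMaybe x) q) (sym (cong (Maybe.fromMaybe y) (trans (sym q′) q)))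

  rep-Eqv : ∀ i {x y} → rep i x ≡ rep i y → Eqv i x y ≡ true
  rep-Eqv i {x} {y} e = E.e-trans i (rep-class i x) (subst (λ z → Eqv i z y ≡ true) (sym e) (E.e-sym i (rep-class i y)))

  Eqv-down : ∀ i {x y} → Eqv (suc i) x y ≡ true → Eqv i x y ≡ true
  Eqv-down i {x} {y} e = go (AtLevel.component⁻ i (good i) e)
    where
    go : ∀ {k x y} → Path (hb i) k x y → Eqv i x y ≡ true
    go {x = x} stop = E.e-refl i x
    go (e ▸ p) = E.e-trans i (proj₁ (proj₂ (proj₂ (flipped-elim e)))) (go p)

  Eqv-U : ∀ i {x y} → Eqv (suc i) x y ≡ true → U x ≡ true → U y ≡ true
  Eqv-U i e = go (AtLevel.component⁻ i (good i) e)
    where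
    go : ∀ {k x y} → Path (hb i) k x y → U x ≡ true → U y ≡ true
    go stop u = u
    go (e ▸ p) u = go p (proj₁ (proj₂ (flipped-elim e)))

  Eqv-top : ∀ {x y} → U x ≡ true → U y ≡ true → Eqv q x y ≡ true → x ≡ y
  Eqv-top {x} {y} ux uy e = ι-inj x y (just-injective (trans (sym (t-top x ux)) (trans (E.e-t q e) (t-top y uy))))

  separated-adj : ∀ i {x y} → U x ≡ true → U y ≡ true → Eqv i x y ≡ true → Eqv (suc i) x y ≡ false → adjH x y ≡ M (ℓ i x) (ℓ i y)
  separated-adj i {x} {y} ux uy e ne = xor-differ (≢true⇒false λ d →
    true≢false (AtLevel.component i (good i) {1} (flipped-intro ux uy e d ▸ stop)) ne)

  constant : ℕ → ℕ → Fin h → Bool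
  constant i m y = allFin h (λ x → not (Eqv i y x) ∨ ⌊ t m x ≟ₜ t m y ⌋)

  constant-elim : ∀ i m y → constant i m y ≡ true → ∀ {x} → Eqv i y x ≡ true → t m x ≡ t m y
  constant-elim i m y c {x} e with ∨-elim {not (Eqv i y x)} (allFin-elim (λ x → not (Eqv i y x) ∨ ⌊ t m x ≟ₜ t m y ⌋) c x)
  ... | inj₁ f = ⊥-elim (true≢false e (not-true⇒false f))
  ... | inj₂ f = ⌊⌋-sound (t m x ≟ₜ t m y) f

  constant-intro : ∀ i m y → (∀ {x} → Eqv i y x ≡ true → t m x ≡ t m y) → constant i m y ≡ true
  constant-intro i m y f = allFin-intro _ go
    where
    go : ∀ x → (not (Eqv i y x) ∨ ⌊ t m x ≟ₜ t m y ⌋) ≡ true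
    go x with bool-cases (Eqv i y x)
    ... | inj₁ e = ∨-introʳ {not (Eqv i y x)} (⌊⌋-complete (t m x ≟ₜ t m y) (f e))
    ... | inj₂ e = ∨-introˡ (not-true e)

  greatest : (ℕ → Bool) → ℕ → ℕ
  greatest P zero    = 0
  greatest P (suc k) = if P (suc k) then suc k else greatest P k

  greatest-≤ : ∀ (P : ℕ → Bool) k → greatest P k ≤ k
  greatest-≤ P zero = z≤n
  greatest-≤ P (suc k) with P (suc k)
  ... | true  = ℕₚ.≤-refl
  ... | false = ℕₚ.m≤n⇒m≤1+n (greatest-≤ P k)

  greatest-sat : ∀ (P : ℕ → Bool) k → P 0 ≡ true → P (greatest P k) ≡ true
  greatest-sat P zero p = p
  greatest-sat P (suc k) p with P (suc k) in e
  ... | true  = e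
  ... | false = greatest-sat P k p

  greatest-max : ∀ (P : ℕ → Bool) k {m} → m ≤ k → P m ≡ true → m ≤ greatest P k
  greatest-max P zero    l p = l
  greatest-max P (suc k) {m} l p with P (suc k) in e
  ... | true  = l
  ... | false with ℕₚ.m≤n⇒m<n∨m≡n l
  ...   | inj₁ (s≤s l′) = greatest-max P k l′ p
  ...   | inj₂ refl = ⊥-elim (true≢false p e)

  opaque
    -- The deepest level at which a single node holds the whole class of `y`. The vertices below
    -- that node form its cluster, a connected set of bounded radius that contains the class.
    level : ℕ → Fin h → ℕ
    level i y = greatest (λ m → constant i m y) q

    level-≤ : ∀ i y → level i y ≤ q
    level-≤ i y = greatest-≤ _ q

    level-constant : ∀ i y {x} → Eqv i y x ≡ true → t (level i y) x ≡ t (level i y) y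
    level-constant i y {x} = constant-elim i (level i y) y (greatest-sat (λ m → constant i m y) q (constant-intro i 0 y (λ {x} _ → t-zero x y))) {x}

    level-max : ∀ i y {m} → m ≤ q → (∀ {x} → Eqv i y x ≡ true → t m x ≡ t m y) → m ≤ level i y
    level-max i y {m} l f = greatest-max (λ m → constant i m y) q l (constant-intro i m y f)

  level-≥ : ∀ i y → i ≤ q → i ≤ level i y
  level-≥ i y l = level-max i y l (λ e → sym (E.e-t i e))

  node-just : ∀ i y → suc i ≤ q → U y ≡ true → ∃[ u ] t (level (suc i) y) y ≡ just u
  node-just i y l uy with level (suc i) y | level-≥ (suc i) y l
  ... | suc m | _ = t-just m y uy

  below : Maybe (Fin n) → Fin n → Bool
  below nothing  z = false
  below (just u) z = Cl u z

  cluster : ℕ → Fin h → Fin n → Bool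
  cluster i y = below (t (level i y) y)

  cluster-class : ∀ i {y x} → suc i ≤ q → U y ≡ true → Eqv (suc i) y x ≡ true → cluster (suc i) y (ι x) ≡ true
  cluster-class i {y} {x} l uy e with node-just i y l uy
  ... | u , eu = subst (λ o → below o (ι x) ≡ true) (sym eu) (Cl-t (trans (level-constant (suc i) y e) eu))

  below-conn : ∀ o {z z′} → Sym â → below o z ≡ true → below o z′ ≡ true → Path (restrict â (below o)) (ρ + ρ) z z′
  below-conn (just u) s c c′ = Cl-conn c ▹▹ reverse (restrict-sym s) (Cl-conn c′)

  private
    T = #types K

    record Cross (i m : ℕ) (u : Fin n) (Z : Fin h) (τ : Fin T) (x y : Fin h) : Set where
      constructor cross
      field
        tx : t m x ≡ just u
        ty : t m y ≡ just u
        lt : ord (t (suc m) x) < ord (t (suc m) y)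
        rx : rep i x ≡ Z
        ed : hb i x y ≡ true
        ty≡ : type i m x y ≡ τ

    isCross : ∀ i m u Z τ → Rel h
    isCross i m u Z τ x y = ((⌊ t m x ≟ₜ just u ⌋ ∧ ⌊ t m y ≟ₜ just u ⌋) ∧ (⌊ ord (t (suc m) x) <? ord (t (suc m) y) ⌋ ∧ (rep i x == Z))) ∧ (hb i x y ∧ (type i m x y == τ))

    isCross-sound : ∀ i m u Z τ {x y} → isCross i m u Z τ x y ≡ true → Cross i m u Z τ x y
    isCross-sound i m u Z τ {x} {y} e with ∧-elim {(⌊ t m x ≟ₜ just u ⌋ ∧ ⌊ t m y ≟ₜ just u ⌋) ∧ (⌊ ord (t (suc m) x) <? ord (t (suc m) y) ⌋ ∧ (rep i x == Z))} e
    ... | e₁ , e₂ with ∧-elim {⌊ t m x ≟ₜ just u ⌋ ∧ ⌊ t m y ≟ₜ just u ⌋} e₁ | ∧-elim {hb i x y} e₂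
    ...   | e₃ , e₄ | f , g with ∧-elim {⌊ t m x ≟ₜ just u ⌋} e₃ | ∧-elim {⌊ ord (t (suc m) x) <? ord (t (suc m) y) ⌋} e₄
    ...     | a , b | c , d = cross (⌊⌋-sound (t m x ≟ₜ just u) a) (⌊⌋-sound (t m y ≟ₜ just u) b) (⌊⌋-sound (ord (t (suc m) x) <? ord (t (suc m) y)) c) (==-sound d) f (==-sound g)

    isCross-complete : ∀ i m u Z τ {x y} → Cross i m u Z τ x y → isCross i m u Z τ x y ≡ true
    isCross-complete i m u Z τ {x} {y} (cross a b c d f g) = ∧-intro
      (∧-intro (∧-intro (⌊⌋-complete (t m x ≟ₜ just u) a) (⌊⌋-complete (t m y ≟ₜ just u) b))
               (∧-intro (⌊⌋-complete (ord (t (suc m) x) <? ord (t (suc m) y)) c) (⌊⌋-complete (rep i x ≟ Z) d)))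
      (∧-intro f (⌊⌋-complete (type i m x y ≟ τ) g))

  found : ∀ i m u Z (τ : Fin (#types K)) → Maybe (Fin h)
  found i m u Z τ = Maybe.map (rep (suc i)) (first (λ x → anyFin h (isCross i m u Z τ x)))

  private
    -- By `crossing-swap` two crossings of one type below the same node and in the same class of
    -- stage `i` are linked by a third edge. Hence node, level, previous class and type determine
    -- the component.
    same-class : ∀ i m u Z τ {x y x′ y′} → Cross i m u Z τ x y → Cross i m u Z τ x′ y′ → Eqv (suc i) x x′ ≡ true
    same-class i m u Z τ {x} {y} {x′} {y′} (cross tx ty lt rx ed e) (cross tx′ ty′ lt′ rx′ ed′ e′)
      with AtLevel.crossing-swap i (good i) m (trans tx (sym ty)) (trans tx (sym tx′)) (trans tx (sym ty′)) lt lt′ (trans e (sym e′)) (rep-Eqv i (trans rx (sym rx′))) ed ed′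
    ... | inj₁ a = AtLevel.component i (good i) {2} (a ▸ (trans (AtLevel.hb-sym i (good i) y′ x′) ed′ ▸ stop))
    ... | inj₂ a = AtLevel.component i (good i) {2} (ed ▸ (trans (AtLevel.hb-sym i (good i) y x′) a ▸ stop))

    found-complete : ∀ i m u Z τ {x y} → Cross i m u Z τ x y → found i m u Z τ ≡ just (rep (suc i) x)
    found-complete i m u Z τ {x} {y} c with first-complete (λ x → anyFin h (isCross i m u Z τ x)) x (anyFin-intro _ y (isCross-complete i m u Z τ c))
    ... | x′ , e with anyFin-elim (isCross i m u Z τ x′) (first-sound (λ x → anyFin h (isCross i m u Z τ x)) e)
    ...   | y′ , c′ = trans (cong (Maybe.map (rep (suc i))) e) (cong just (rep-cong (suc i) (same-class i m u Z τ (isCross-sound i m u Z τ {x′} {y′} c′) c)))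

    levels : List (Fin q)
    levels = elems {q} (λ _ → true)
    types : List (Fin T)
    types = elems {T} (λ _ → true)

    -- Candidates for the representatives of the components whose cluster contains `z`. The least
    -- node `u` holding such a component is in `cand z`. Either it is a leaf and the component is
    -- one vertex, or the component crosses between children of `u` and `found` recovers it; its
    -- previous class also has `u` in its cluster, hence the recursion.
    decode : ℕ → Fin n → List (Fin h)
    decodeAt : ℕ → Fin n → List (Fin h)
    decodeLevel : ℕ → Fin n → Fin q → List (Fin h)
    decodeIn : ℕ → Fin n → Fin q → Fin h → List (Fin h)
    decode zero    z = maybeList (first {h} (λ _ → true))
    decode (suc i) z = concatMap (decodeAt i) (cand z)
    decodeAt i u = maybeList (first (λ y → ι y == u)) ++ concatMap (decodeLevel i u) levels
    decodeLevel i u m = concatMap (decodeIn i u m) (decode i u)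
    decodeIn i u m Z = concatMap (λ τ → maybeList (found i (toℕ m) u Z τ)) types

    decode-len : ∀ i z → length (decode i z) ≤ decodeBound q K i
    decode-len zero    z = maybeList-len (first {h} (λ _ → true))
    decode-len (suc i) z = ℕₚ.≤-trans (length-concatMap-≤ (decodeAt i) (cand z) (λ u _ → at-len u)) (ℕₚ.*-monoˡ-≤ _ (cand-len z))
      where
      in-len : ∀ u m Z → length (decodeIn i u m Z) ≤ T
      in-len u m Z = ℕₚ.≤-trans (length-concatMap-≤ (λ τ → maybeList (found i (toℕ m) u Z τ)) types (λ τ _ → maybeList-len (found i (toℕ m) u Z τ)))
        (ℕₚ.≤-reflexive (trans (ℕₚ.*-identityʳ _) (elems-all-len T)))
      level-len : ∀ u m → length (decodeLevel i u m) ≤ decodeBound q K i * T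
      level-len u m = ℕₚ.≤-trans (length-concatMap-≤ (decodeIn i u m) (decode i u) (λ Z _ → in-len u m Z)) (ℕₚ.*-monoˡ-≤ T (decode-len i u))
      at-len : ∀ u → length (decodeAt i u) ≤ suc (q * (decodeBound q K i * T))
      at-len u = subst (_≤ suc (q * (decodeBound q K i * T))) (sym (Listₚ.length-++ (maybeList (first (λ y → ι y == u)))))
        (ℕₚ.+-mono-≤ (maybeList-len (first (λ y → ι y == u)))
          (ℕₚ.≤-trans (length-concatMap-≤ (decodeLevel i u) levels (λ m _ → level-len u m)) (ℕₚ.≤-reflexive (cong (_* (decodeBound q K i * T)) (elems-all-len q)))))

    -- Stage 0 has a single class, whose least node may be the missing root, so no cluster is asked
    -- for there.
    Decodes : ℕ → Set
    Decodes i = ∀ y z → U y ≡ true → (1 ≤ i → cluster i y z ≡ true) → rep i y ∈ decode i z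

    decode-zero : Decodes 0
    decode-zero y z uy _ with first-complete {h} (λ _ → true) y refl
    ... | w , e = subst (λ o → rep 0 y ∈ maybeList o) (sym e) (here (trans (rep-first y) refl))
      where
      rep-first : ∀ y → rep 0 y ≡ w
      rep-first y = trans (rep-cong 0 {y} {w} refl) (first-const e)
        where
        opaque
          unfolding rep
          first-const : first {h} (λ _ → true) ≡ just w → rep 0 w ≡ w
          first-const e = cong (Maybe.fromMaybe w) e

    module DecodeSuc (i : ℕ) (l : suc i ≤ q) (ih : Decodes i) (y : Fin h) (z : Fin n) (uy : U y ≡ true) (c : cluster (suc i) y z ≡ true) where

      lv = level (suc i) y
      u = proj₁ (node-just i y l uy)
      tm : t lv y ≡ just u
      tm = proj₂ (node-just i y l uy)
      u-cand : u ∈ cand z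
      u-cand = cand-cov (subst (λ o → below o z ≡ true) tm c)

      Z-decoded : rep i y ∈ decode i u
      Z-decoded = ih y u uy λ { (s≤s {n = i′} _) → inner i′ refl }
        where
        inner : ∀ i′ → i ≡ suc i′ → cluster i y u ≡ true
        inner i′ refl with node-just i′ y (ℕₚ.<⇒≤ l) uy
        -- Classes shrink from stage to stage, so the least node can only move down; `u` therefore
        -- lies in the cluster of the previous class.
        ... | u′ , e′ = subst (λ o → below o u ≡ true) (sym e′) (Cl-nest (level-max (suc i) y (level-≤ i y) (λ e → level-constant i y (Eqv-down i e))) tm e′)

      alone : lv ≡ q → rep (suc i) y ∈ decodeAt i u
      alone e = ∈ₚ.∈-++⁺ˡ (subst (λ o → rep (suc i) y ∈ maybeList o) (sym pre) (here self))
        where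
        ιy : ι y ≡ u
        ιy = just-injective (trans (sym (t-top y uy)) (subst (λ lv → t lv y ≡ just u) e tm))
        pre : first (λ y → ι y == u) ≡ just y
        pre with first-complete (λ y → ι y == u) y (⌊⌋-complete (ι y ≟ u) ιy)
        ... | y′ , f = trans f (cong just (ι-inj y′ y (trans (==-sound (first-sound (λ y → ι y == u) f)) (sym ιy))))
        self : rep (suc i) y ≡ y
        self = ι-inj _ _ (just-injective (trans (sym (t-top _ (Eqv-U i (rep-class (suc i) y) uy)))
          (trans (subst (λ lv → t lv (rep (suc i) y) ≡ t lv y) e (level-constant (suc i) y (rep-class (suc i) y))) (t-top y uy))))

      crossing : lv < q → rep (suc i) y ∈ decodeAt i u
      crossing lv<q with find (λ x → Eqv (suc i) y x ∧ not ⌊ t (suc lv) x ≟ₜ t (suc lv) y ⌋)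
      ... | inj₂ none = ⊥-elim (ℕₚ.1+n≰n (level-max (suc i) y lv<q λ {x} e → decide x e (t (suc lv) x ≟ₜ t (suc lv) y)))
        where
        decide : ∀ x → Eqv (suc i) y x ≡ true → Dec (t (suc lv) x ≡ t (suc lv) y) → t (suc lv) x ≡ t (suc lv) y
        decide x e (yes p) = p
        decide x e (no ne) = ⊥-elim (true≢false (∧-intro e (not-true (⌊⌋-false (t (suc lv) x ≟ₜ t (suc lv) y) ne))) (none x))
      ... | inj₁ (x , f) with ∧-elim {Eqv (suc i) y x} f
      ...   | e , ne with changesAt _≟ₜ_ (t (suc lv)) (AtLevel.component⁻ i (good i) e) (λ eq → ⌊⌋-refute (t (suc lv) x ≟ₜ t (suc lv) y) (not-true⇒false ne) (sym eq))
      ...     | s , s< , differ = orient (ℕₚ.<-cmp (ord (t (suc lv) a)) (ord (t (suc lv) b)))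
        where
        w = AtLevel.component⁻ i (good i) e
        a = at w s
        b = at w (suc s)
        ab : hb i a b ≡ true
        ab = at-edge w s s<
        inClass : ∀ s → Eqv (suc i) y (at w s) ≡ true
        inClass s = AtLevel.component i (good i) (prefix w s)
        tmAt : ∀ s → t lv (at w s) ≡ just u
        tmAt s = trans (level-constant (suc i) y (inClass s)) tm
        repAt : ∀ s → rep i (at w s) ≡ rep i y
        repAt s = sym (rep-cong i (Eqv-down i (inClass s)))
        use : ∀ {x y′} → Eqv (suc i) y x ≡ true → (τ : Fin T) → Cross i lv u (rep i y) τ x y′ → rep (suc i) y ∈ decodeAt i u
        use {x} yx τ cr = ∈ₚ.∈-++⁺ʳ (maybeList (first (λ y → ι y == u))) (∈-concatMap (decodeLevel i u) levels (elems-complete (λ _ → true) mᶠ refl)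
          (∈-concatMap (decodeIn i u mᶠ) (decode i u) Z-decoded (∈-concatMap (λ τ → maybeList (found i (toℕ mᶠ) u (rep i y) τ)) types (elems-complete (λ _ → true) τ refl)
            (subst (λ k → rep (suc i) y ∈ maybeList (found i k u (rep i y) τ)) (sym (Finₚ.toℕ-fromℕ< lv<q))
              (subst (λ o → rep (suc i) y ∈ maybeList o) (sym (found-complete i lv u (rep i y) τ cr)) (here (rep-cong (suc i) yx)))))))
          where
          mᶠ : Fin q
          mᶠ = fromℕ< lv<q
        orient : _ → rep (suc i) y ∈ decodeAt i u
        orient (Relation.Binary.tri< lt _ _) = use (inClass s) (type i lv a b) (cross (tmAt s) (tmAt (suc s)) lt (repAt s) ab refl)
        orient (Relation.Binary.tri> _ _ lt) = use (inClass (suc s)) (type i lv b a) (cross (tmAt (suc s)) (tmAt s) lt (repAt (suc s)) (trans (AtLevel.hb-sym i (good i) b a) ab) refl)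
        orient (Relation.Binary.tri≈ _ eq _) = ⊥-elim (differ (ord-inj _ _ eq))

      decoded : rep (suc i) y ∈ decode (suc i) z
      decoded = ∈-concatMap (decodeAt i) (cand z) u-cand (pick (ℕₚ.m≤n⇒m<n∨m≡n (level-≤ (suc i) y)))
        where
        pick : lv < q ⊎ lv ≡ q → rep (suc i) y ∈ decodeAt i u
        pick (inj₁ lt) = crossing lt
        pick (inj₂ e)  = alone e

    decodes : ∀ i → i ≤ q → Decodes i
    decodes zero    l = decode-zero
    decodes (suc i) l y z uy c = DecodeSuc.decoded i l (decodes i (ℕₚ.<⇒≤ l)) y z uy (c (s≤s z≤n))

  cluster-code : ∀ i → suc i ≤ q → Σ (Fin n → List (Fin h)) λ code →
    (∀ z → length (code z) ≤ decodeBound q K (suc i)) × (∀ y z → U y ≡ true → cluster (suc i) y z ≡ true → rep (suc i) y ∈ code z)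
  cluster-code i l = decode (suc i) , decode-len (suc i) , λ y z uy c → decodes (suc i) l y z uy (λ _ → c)

-- Formulas

lift : ∀ {k l} → (Fin k → Fin l) → Fin (suc k) → Fin (suc l)
lift f zero    = zero
lift f (suc i) = suc (f i)

ren : ∀ {c k l} → (Fin k → Fin l) → Formula c k → Formula c l
ren f (edge i j)  = edge (f i) (f j)
ren f (equal i j) = equal (f i) (f j)
ren f (color p i) = color p (f i)
ren f (neg φ)     = neg (ren f φ)
ren f (or φ ψ)    = or (ren f φ) (ren f ψ)
ren f (and φ ψ)   = and (ren f φ) (ren f ψ)
ren f (ex φ)      = ex (ren (lift f) φ)
ren f (all φ)     = all (ren (lift f) φ)

eval-ren : ∀ {c k l} (H : Graph) (col : Fin c → Fin (size H) → Bool) (f : Fin k → Fin l) (φ : Formula c k) ρ σ →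
           (∀ i → ρ (f i) ≡ σ i) → eval H col (ren f φ) ρ ≡ eval H col φ σ
eval-ren H col f (edge i j)  ρ σ e = cong₂ (adj H) (e i) (e j)
eval-ren H col f (equal i j) ρ σ e = cong₂ _==_ (e i) (e j)
eval-ren H col f (color p i) ρ σ e = cong (col p) (e i)
eval-ren H col f (neg φ)     ρ σ e = cong not (eval-ren H col f φ ρ σ e)
eval-ren H col f (or φ ψ)    ρ σ e = cong₂ _∨_ (eval-ren H col f φ ρ σ e) (eval-ren H col f ψ ρ σ e)
eval-ren H col f (and φ ψ)   ρ σ e = cong₂ _∧_ (eval-ren H col f φ ρ σ e) (eval-ren H col f ψ ρ σ e)
eval-ren H col f (ex φ)      ρ σ e = any-cong λ v → eval-ren H col (lift f) φ (ext v ρ) (ext v σ) λ { zero → refl ; (suc i) → e i }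
eval-ren H col f (all φ)     ρ σ e = all-cong λ v → eval-ren H col (lift f) φ (ext v ρ) (ext v σ) λ { zero → refl ; (suc i) → e i }

boolF : ∀ {c k} → Fin k → Bool → Formula c k
boolF v true  = equal v v
boolF v false = neg (equal v v)

eval-boolF : ∀ {c k} (H : Graph) (col : Fin c → Fin (size H) → Bool) (v : Fin k) b ρ → eval H col (boolF v b) ρ ≡ b
eval-boolF H col v true  ρ = ==-refl (ρ v)
eval-boolF H col v false ρ = cong not (==-refl (ρ v))

someF : ∀ {c k} → Fin k → (m : ℕ) → (Fin m → Formula c k) → Formula c k
someF v zero    f = boolF v false
someF v (suc m) f = or (f zero) (someF v m (λ i → f (suc i)))

eval-someF : ∀ {c k} (H : Graph) (col : Fin c → Fin (size H) → Bool) (v : Fin k) m (f : Fin m → Formula c k) ρ →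
             eval H col (someF v m f) ρ ≡ anyFin m (λ i → eval H col (f i) ρ)
eval-someF H col v zero    f ρ = eval-boolF H col v false ρ
eval-someF H col v (suc m) f ρ = cong (eval H col (f zero) ρ ∨_) (eval-someF H col v m (λ i → f (suc i)) ρ)

-- A vertex labelling ξ is presented to formulas by one unary predicate per label.
oneHot : ∀ {n Q} → (Fin n → Fin Q) → Fin Q → Fin n → Bool
oneHot ξ c x = ξ x == c

caseF : ∀ {Q k} → Fin k → (Fin Q → Formula Q k) → Formula Q k
caseF {Q} v f = someF v Q (λ c → and (color c v) (f c))

eval-caseF : ∀ {Q k} (H : Graph) (ξ : Fin (size H) → Fin Q) (v : Fin k) (f : Fin Q → Formula Q k) ρ →
             eval H (oneHot ξ) (caseF v f) ρ ≡ eval H (oneHot ξ) (f (ξ (ρ v))) ρ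
eval-caseF {Q} H ξ v f ρ = trans (eval-someF H (oneHot ξ) v Q _ ρ) (iff⇒≡ to λ e → anyFin-intro (λ c → (ξ (ρ v) == c) ∧ eval H (oneHot ξ) (f c) ρ) (ξ (ρ v)) (∧-intro (==-refl _) e))
  where
  to : anyFin Q (λ c → (ξ (ρ v) == c) ∧ eval H (oneHot ξ) (f c) ρ) ≡ true → eval H (oneHot ξ) (f (ξ (ρ v))) ρ ≡ true
  to e with anyFin-elim (λ c → (ξ (ρ v) == c) ∧ eval H (oneHot ξ) (f c) ρ) e
  ... | c , t with ∧-elim {ξ (ρ v) == c} t
  ...   | q , r = subst (λ c → eval H (oneHot ξ) (f c) ρ ≡ true) (sym (==-sound q)) r

case₂F : ∀ {Q k} → Fin k → Fin k → (Fin Q → Fin Q → Formula Q k) → Formula Q k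
case₂F u v f = caseF u (λ c → caseF v (f c))

eval-case₂F : ∀ {Q k} (H : Graph) (ξ : Fin (size H) → Fin Q) (u v : Fin k) (f : Fin Q → Fin Q → Formula Q k) ρ →
              eval H (oneHot ξ) (case₂F u v f) ρ ≡ eval H (oneHot ξ) (f (ξ (ρ u)) (ξ (ρ v))) ρ
eval-case₂F H ξ u v f ρ = trans (eval-caseF H ξ u _ ρ) (eval-caseF H ξ v (f (ξ (ρ u))) ρ)

reachF : ∀ {c} → Formula c 2 → ℕ → Formula c 2
reachF s zero    = equal zero (suc zero)
reachF s (suc r) = or (equal zero (suc zero)) (ex (and (ren (pair (suc zero) zero) s) (ren (pair zero (suc (suc zero))) (reachF s r))))

opaque
  unfolding near
  eval-reachF : ∀ {c} (H : Graph) (col : Fin c → Fin (size H) → Bool) (s : Formula c 2) (a : Rel (size H)) →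
    (∀ x y → eval H col s (pair x y) ≡ a x y) → ∀ r x z → eval H col (reachF s r) (pair x z) ≡ near a r x z
  eval-reachF H col s a h zero    x z = refl
  eval-reachF H col s a h (suc r) x z = cong ((x == z) ∨_) (any-cong λ y → cong₂ _∧_
    (trans (eval-ren H col (pair (suc zero) zero) s _ (pair x y) λ { zero → refl ; (suc zero) → refl }) (h x y))
    (trans (eval-ren H col (pair zero (suc (suc zero))) (reachF s r) _ (pair y z) λ { zero → refl ; (suc zero) → refl }) (eval-reachF H col s a h r y z)))

xorF : ∀ {c k} → Formula c k → Formula c k → Formula c k
xorF φ ψ = or (and φ (neg ψ)) (and (neg φ) ψ)

xor-formula : ∀ a b → ((a ∧ not b) ∨ (not a ∧ b)) ≡ (a xor b)
xor-formula true  true  = refl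
xor-formula true  false = refl
xor-formula false b     = refl

module ComponentFormula {Q K} (Uc : Fin Q → Bool) (ℓc : ℕ → Fin Q → Fin K) (M : Fin K → Fin K → Bool) (L : ℕ) where

  eqvF : ℕ → Formula Q 2
  hbF  : ℕ → Formula Q 2
  eqvF zero    = boolF zero true
  eqvF (suc i) = reachF (hbF i) L
  hbF i = and (case₂F zero (suc zero) (λ c d → boolF zero (Uc c ∧ Uc d)))
              (and (eqvF i) (xorF (edge zero (suc zero)) (case₂F zero (suc zero) (λ c d → boolF zero (M (ℓc i c) (ℓc i d))))))

  -- Formulas cannot pick the least element of a class, so representatives are marked by the
  -- colouring and only membership in the class is expressed.
  nodeF : ℕ → (Fin Q → Bool) → Formula Q 2
  nodeF i isRep = and (case₂F zero (suc zero) (λ c d → boolF zero (Uc c ∧ isRep d))) (eqvF i)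

module EvalComponents (H : Graph) {n} {â : Rel n} {ι : Fin (size H) → Fin n} (ι-inj : ∀ x y → ι x ≡ ι y → x ≡ y)
  {q ρ K} {M : Fin K → Fin K → Bool} (M-sym : ∀ α β → M α β ≡ M β α) (TM : TreeModel (adj H) â ι q ρ K M)
  {Q} (ξ : Fin (size H) → Fin Q) (Uc : Fin Q → Bool) (ℓc : ℕ → Fin Q → Fin K)
  (Uc-ξ : ∀ x → Uc (ξ x) ≡ TreeModel.U TM x) (ℓc-ξ : ∀ i → i < q → ∀ x → ℓc i (ξ x) ≡ TreeModel.ℓ TM i x) where

  open TreeModel TM
  open Components (adj H) (adj-sym H) ι-inj M-sym TM
  open ComponentClusters (adj H) (adj-sym H) ι-inj M-sym TM
  open ComponentFormula Uc ℓc M L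

  private
    evalH : ∀ {k} → Formula Q k → (Fin k → Fin (size H)) → Bool
    evalH = eval H (oneHot ξ)

  opaque
    unfolding flipped
    eval-eqvF : ∀ i → i ≤ q → ∀ x y → evalH (eqvF i) (pair x y) ≡ Eqv i x y
    eval-hbF  : ∀ i → i < q → ∀ x y → evalH (hbF i) (pair x y) ≡ hb i x y
    eval-eqvF zero    l x y = eval-boolF H (oneHot ξ) zero true (pair x y)
    eval-eqvF (suc i) l x y = eval-reachF H (oneHot ξ) (hbF i) (hb i) (eval-hbF i l) L x y
    eval-hbF i l x y = cong₂ _∧_
      (trans (eval-case₂F H ξ zero (suc zero) (λ c d → boolF zero (Uc c ∧ Uc d)) (pair x y))
        (trans (eval-boolF H (oneHot ξ) zero _ (pair x y)) (cong₂ _∧_ (Uc-ξ x) (Uc-ξ y))))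
      (cong₂ _∧_ (eval-eqvF i (ℕₚ.<⇒≤ l) x y)
        (trans (xor-formula (adj H x y) _) (cong (adj H x y xor_)
          (trans (eval-case₂F H ξ zero (suc zero) (λ c d → boolF zero (M (ℓc i c) (ℓc i d))) (pair x y))
            (trans (eval-boolF H (oneHot ξ) zero _ (pair x y)) (cong₂ M (ℓc-ξ i l x) (ℓc-ξ i l y)))))))

  eval-nodeF : ∀ i → i ≤ q → (isRep : Fin Q → Bool) → (∀ x → isRep (ξ x) ≡ (rep i x == x)) → ∀ x y →
               evalH (nodeF i isRep) (pair x y) ≡ (U x ∧ (rep i x == y))
  eval-nodeF i l isRep isRep-ξ x y = trans (cong₂ _∧_
      (trans (eval-case₂F H ξ zero (suc zero) (λ c d → boolF zero (Uc c ∧ isRep d)) (pair x y))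
        (trans (eval-boolF H (oneHot ξ) zero _ (pair x y)) (cong₂ _∧_ (Uc-ξ x) (isRep-ξ y))))
      (eval-eqvF i l x y)) (iff⇒≡ to from)
    where
    to : ((U x ∧ (rep i y == y)) ∧ Eqv i x y) ≡ true → (U x ∧ (rep i x == y)) ≡ true
    to e with ∧-elim {U x ∧ (rep i y == y)} e
    ... | e₁ , e₂ with ∧-elim {U x} e₁
    ...   | u , r = ∧-intro u (⌊⌋-complete (rep i x ≟ y) (trans (rep-cong i e₂) (==-sound r)))
    from : (U x ∧ (rep i x == y)) ≡ true → ((U x ∧ (rep i y == y)) ∧ Eqv i x y) ≡ true
    from e with ∧-elim {U x} e
    ... | u , r with ==-sound r
    ...   | refl = ∧-intro (∧-intro u (⌊⌋-complete (rep i (rep i x) ≟ rep i x) (sym (rep-cong i (rep-class i x))))) (rep-class i x)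

-- The graph of a family of functions, and its almost-wideness

count-+ : ∀ m n (A : Fin (m + n) → Bool) → countFin (m + n) A ≡ countFin m (λ i → A (i Fin.↑ˡ n)) + countFin n (λ j → A (m Fin.↑ʳ j))
count-+ zero    n A = refl
count-+ (suc m) n A = trans (cong (indicator (A zero) +_) (count-+ m n (λ i → A (suc i)))) (sym (ℕₚ.+-assoc (indicator (A zero)) _ _))

count-* : ∀ m n (A : Fin (m * n) → Bool) → countFin (m * n) A ≡ ∑ m (λ c → countFin n (λ x → A (combine c x)))
count-* zero    n A = refl
count-* (suc m) n A = trans (count-+ n (m * n) A) (cong (countFin n (λ x → A (x Fin.↑ˡ (m * n))) +_) (count-* m n (λ j → A (n Fin.↑ʳ j))))

large-copy : ∀ m n (A : Fin (m * n) → Bool) N → m * N < countFin (m * n) A → ∃[ c ] N ≤ countFin n (λ x → A (combine c x))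
large-copy m n A N lt with find (λ c → ⌊ N ≤? countFin n (λ x → A (combine {m} c x)) ⌋)
... | inj₁ (c , h) = c , ⌊⌋-sound (N ≤? countFin n (λ x → A (combine {m} c x))) h
... | inj₂ none = ⊥-elim (ℕₚ.<⇒≱ lt (subst (_≤ m * N) (sym (count-* m n A))
  (∑-bound λ c → ℕₚ.<⇒≤ (ℕₚ.≰⇒> (⌊⌋-refute (N ≤? countFin n (λ x → A (combine {m} c x))) (none c))))))

module NodeGraph {h Θ} (rel : Fin Θ → Rel h) where

  -- Copy `zero` holds the vertices of H, copy `suc θ` the nodes of the function `θ`, named by
  -- vertices of H. Names that are not values stay isolated, so the vertex set is a plain product.
  link : Fin (suc Θ) → Fin h → Fin (suc Θ) → Fin h → Bool
  link zero    x zero     y = false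
  link zero    x (suc θ)  y = rel θ x y
  link (suc θ) x zero     y = rel θ y x
  link (suc θ) x (suc θ′) y = false

  link-sym : ∀ c x c′ y → link c x c′ y ≡ link c′ y c x
  link-sym zero    x zero     y = refl
  link-sym zero    x (suc θ)  y = refl
  link-sym (suc θ) x zero     y = refl
  link-sym (suc θ) x (suc θ′) y = refl

  link-irr : ∀ c x → link c x c x ≡ false
  link-irr zero    x = refl
  link-irr (suc θ) x = refl

  copy : Fin (suc Θ * h) → Fin (suc Θ)
  copy u = proj₁ (remQuot {suc Θ} h u)

  base : Fin (suc Θ * h) → Fin h
  base u = proj₂ (remQuot {suc Θ} h u)

  copy-combine : ∀ c x → copy (combine c x) ≡ c
  copy-combine c x = cong proj₁ (Finₚ.remQuot-combine c x)

  base-combine : ∀ (c : Fin (suc Θ)) x → base (combine c x) ≡ x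
  base-combine c x = cong proj₂ (Finₚ.remQuot-combine c x)

  combine-copy-base : ∀ u → combine (copy u) (base u) ≡ u
  combine-copy-base u = Finₚ.combine-remQuot {suc Θ} h u

  nodeGraph : Graph
  nodeGraph = record
    { size = suc Θ * h
    ; adj = λ u v → link (copy u) (base u) (copy v) (base v)
    ; adj-sym = λ u v → link-sym (copy u) (base u) (copy v) (base v)
    ; adj-irr = λ u → link-irr (copy u) (base u) }

-- Let B be scattered for m.  A label is spread if it occurs near two elements of B.  A vertex far
-- from x is far from one of two witnesses of the label of x, so an edge of the node graph between
-- far vertices leads to a node determined by such a witness; these nodes form the set S.  Each label
-- that is not spread costs one element of B.
module Spread {h Θ} (rel : Fin Θ → Rel h) (rel-fun : ∀ θ x y y′ → rel θ x y ≡ true → rel θ x y′ ≡ true → y ≡ y′)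
  (m : Rel h) (msym : Sym m) (R₀ K : ℕ) (lam : Fin h → Fin K)
  (lam-det : ∀ θ x y x′ y′ → ¬ Path m R₀ x y → ¬ Path m R₀ x′ y′ → lam x ≡ lam x′ → lam y ≡ lam y′ → rel θ x y ≡ rel θ x′ y′)
  (r : ℕ) (B : Fin h → Bool) (B-far : ∀ b b′ → B b ≡ true → B b′ ≡ true → b ≢ b′ → ¬ Path m ((r * R₀ + R₀) + (R₀ + r * R₀)) b b′) where

  open NodeGraph rel

  private
    Rb = r * R₀

    touches : Fin K → Fin h → Fin h → Bool
    touches α b x = (B b ∧ (lam x == α)) ∧ near m Rb b x

    touches-elim : ∀ {α b x} → touches α b x ≡ true → B b ≡ true × lam x ≡ α × Path m Rb b x
    touches-elim {α} {b} {x} e with ∧-elim {B b ∧ (lam x == α)} e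
    ... | e₁ , e₂ with ∧-elim {B b} e₁
    ...   | p , q = p , ==-sound q , near-sound Rb e₂

    record Witnesses (α : Fin K) : Set where
      field
        b₁ b₂ x₁ x₂ : Fin h
        b≢ : b₁ ≢ b₂
        t₁ : touches α b₁ x₁ ≡ true
        t₂ : touches α b₂ x₂ ≡ true

    Only : Fin K → Set
    Only α = Σ (Maybe (Fin h)) λ o → ∀ b x → touches α b x ≡ true → o ≡ just b

    spread? : ∀ α → Witnesses α ⊎ Only α
    spread? α with find₂ (touches α)
    ... | inj₂ none = inj₂ (nothing , λ b x e → ⊥-elim (true≢false e (none b x)))
    ... | inj₁ (b , x , e) with find₂ (λ b′ x′ → not (b′ == b) ∧ touches α b′ x′)
    ...   | inj₁ (b′ , x′ , e′) with ∧-elim {not (b′ == b)} e′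
    ...     | ne , f = inj₁ record { b₁ = b ; b₂ = b′ ; x₁ = x ; x₂ = x′ ; b≢ = λ q → ⌊⌋-refute (b′ ≟ b) (not-true⇒false ne) (sym q) ; t₁ = e ; t₂ = f }
    spread? α | inj₁ (b , x , e) | inj₂ none = inj₂ (just b , λ b′ x′ e′ → cong just (same b′ x′ e′ (b′ ≟ b)))
      where
      same : ∀ b′ x′ → touches α b′ x′ ≡ true → Dec (b′ ≡ b) → b ≡ b′
      same b′ x′ e′ (yes q) = sym q
      same b′ x′ e′ (no ne) = ⊥-elim (true≢false (∧-intro (not-true (⌊⌋-false (b′ ≟ b) ne)) e′) (none b′ x′))

    witnesses : Fin K → List (Fin h)
    witnesses α with spread? α
    ... | inj₁ w = Witnesses.x₁ w ∷ Witnesses.x₂ w ∷ []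
    ... | inj₂ _ = []

    lonely : Fin K → List (Fin h)
    lonely α with spread? α
    ... | inj₁ _ = []
    ... | inj₂ (just b , _) = b ∷ []
    ... | inj₂ (nothing , _) = []

    nodesAt : Fin Θ → Fin h → List (Fin h)
    nodesAt θ x = x ∷ maybeList (first (rel θ x))

    labels : List (Fin K)
    labels = elems {K} (λ _ → true)

    nodesFor : Fin Θ → Fin K → List (Fin (suc Θ * h))
    nodesFor θ α = concatMap (λ x → map (combine (suc θ)) (nodesAt θ x)) (witnesses α)

    deletedNodes : List (Fin (suc Θ * h))
    deletedNodes = concatMap (λ θ → concatMap (nodesFor θ) labels) (elems {Θ} (λ _ → true))

    deletedNodes-len : length deletedNodes ≤ Θ * (K * 4)
    deletedNodes-len = ℕₚ.≤-trans (length-concatMap-≤ (λ θ → concatMap (nodesFor θ) labels) (elems {Θ} (λ _ → true)) (λ θ _ → per-θ θ)) (ℕₚ.≤-reflexive (cong (_* (K * 4)) (elems-all-len Θ)))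
      where
      per-x : ∀ θ x → length (map (combine {suc Θ} {h} (suc θ)) (nodesAt θ x)) ≤ 2
      per-x θ x = subst (_≤ 2) (sym (Listₚ.length-map (combine {suc Θ} {h} (suc θ)) (nodesAt θ x))) (s≤s (maybeList-len (first (rel θ x))))
      two : ∀ α → length (witnesses α) ≤ 2
      two α with spread? α
      ... | inj₁ _ = ℕₚ.≤-refl
      ... | inj₂ _ = z≤n
      per-θ : ∀ θ → length (concatMap (nodesFor θ) labels) ≤ K * 4
      per-θ θ = ℕₚ.≤-trans (length-concatMap-≤ (nodesFor θ) labels (λ α _ →
        ℕₚ.≤-trans (length-concatMap-≤ (λ x → map (combine (suc θ)) (nodesAt θ x)) (witnesses α) (λ x _ → per-x θ x)) (ℕₚ.*-monoˡ-≤ 2 (two α))))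
        (ℕₚ.≤-reflexive (cong (_* 4) (elems-all-len K)))

    lonelyAll : List (Fin h)
    lonelyAll = concatMap lonely labels

    lonelyAll-len : length lonelyAll ≤ K
    lonelyAll-len = ℕₚ.≤-trans (length-concatMap-≤ lonely labels (λ α _ → one α)) (ℕₚ.≤-reflexive (trans (ℕₚ.*-identityʳ _) (elems-all-len K)))
      where
      one : ∀ α → length (lonely α) ≤ 1
      one α with spread? α
      ... | inj₁ _ = z≤n
      ... | inj₂ (just b , _) = ℕₚ.≤-refl
      ... | inj₂ (nothing , _) = z≤n

    deleted-∈ : ∀ θ α x y → x ∈ witnesses α → y ∈ nodesAt θ x → combine (suc θ) y ∈ deletedNodes
    deleted-∈ θ α x y wx ny = ∈-concatMap (λ θ → concatMap (nodesFor θ) labels) (elems {Θ} (λ _ → true)) (elems-complete (λ _ → true) θ refl)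
      (∈-concatMap (nodesFor θ) labels (elems-complete (λ _ → true) α refl)
        (∈-concatMap (λ x → map (combine (suc θ)) (nodesAt θ x)) (witnesses α) wx (∈ₚ.∈-map⁺ (combine (suc θ)) ny)))

    target-∈ : ∀ θ x y → rel θ x y ≡ true → y ∈ nodesAt θ x
    target-∈ θ x y e with first-complete (rel θ x) y e
    ... | y′ , f = there (subst (λ o → y ∈ maybeList o) (sym f) (here (rel-fun θ x y y′ e (first-sound (rel θ x) f))))

    far-witness : ∀ {b x} → B b ≡ true → Path m Rb b x → ¬ (b ∈ lonelyAll) → ∀ y → ∃[ w ] (w ∈ witnesses (lam x) × lam w ≡ lam x × ¬ Path m R₀ w y)
    far-witness {b} {x} Bb p nl y = go (spread? (lam x)) refl
      where
      touch : touches (lam x) b x ≡ true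
      touch = ∧-intro (∧-intro Bb (==-refl (lam x))) (near-complete p)
      go : (s : Witnesses (lam x) ⊎ Only (lam x)) → spread? (lam x) ≡ s → ∃[ w ] (w ∈ witnesses (lam x) × lam w ≡ lam x × ¬ Path m R₀ w y)
      go (inj₂ (o , only)) e with only b x touch
      ... | refl = ⊥-elim (nl (∈-concatMap lonely labels (elems-complete (λ _ → true) (lam x) refl) here′))
        where
        here′ : b ∈ lonely (lam x)
        here′ rewrite e = here refl
      go (inj₁ w) e with bool-cases (near m R₀ (Witnesses.x₁ w) y)
      ... | inj₂ f = Witnesses.x₁ w , in₁ , proj₁ (proj₂ (touches-elim (Witnesses.t₁ w))) , far⇒¬Path f
        where
        in₁ : Witnesses.x₁ w ∈ witnesses (lam x)
        in₁ rewrite e = here refl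
      ... | inj₁ f = Witnesses.x₂ w , in₂ , proj₁ (proj₂ (touches-elim (Witnesses.t₂ w))) , λ p₂ →
              B-far _ _ (proj₁ (touches-elim (Witnesses.t₁ w))) (proj₁ (touches-elim (Witnesses.t₂ w))) (Witnesses.b≢ w)
                ((proj₂ (proj₂ (touches-elim (Witnesses.t₁ w))) ▹▹ near-sound R₀ f) ▹▹ (reverse msym p₂ ▹▹ reverse msym (proj₂ (proj₂ (touches-elim (Witnesses.t₂ w))))))
        where
        in₂ : Witnesses.x₂ w ∈ witnesses (lam x)
        in₂ rewrite e = there (here refl)

  S : Subset (suc Θ * h)
  S u = memb u deletedNodes

  -- Two witnesses per label and, for each function, the node named by the witness and the node it
  -- is mapped to. The bound does not involve `r`, as uniformity requires.
  S-small : ∣ S ∣ ≤ Θ * (K * 4)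
  S-small = ℕₚ.≤-trans (count-≤-list S deletedNodes (λ u e → memb-sound e)) deletedNodes-len

  private
    kept : ∀ {u} → S u ≡ false → ¬ (u ∈ deletedNodes)
    kept e i = true≢false (memb-complete i) e

    -- For an edge between far vertices, a witness `w` with the label of `x` also satisfies the
    -- relation. From vertex to node, the node is the target of `w`; from node to vertex,
    -- functionality gives `w` equal to the name of the node. Either way the node was deleted.
    near-step : ∀ {b} → B b ≡ true → ¬ (b ∈ lonelyAll) → ∀ c x c′ y → Path m Rb b x → link c x c′ y ≡ true →
      S (combine c x) ≡ false → S (combine c′ y) ≡ false → Path m R₀ x y
    near-step Bb nl c x c′ y p e sx sy with bool-cases (near m R₀ x y)
    ... | inj₁ f = near-sound R₀ f
    near-step Bb nl zero x (suc θ) y p e sx sy | inj₂ f with far-witness Bb p nl y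
    ... | w , w∈ , lw , fw = ⊥-elim (kept sy (deleted-∈ θ (lam x) w y w∈ (target-∈ θ w y
            (trans (lam-det θ w y x y fw (far⇒¬Path f) lw refl) e))))
    near-step Bb nl (suc θ) x zero y p e sx sy | inj₂ f with far-witness Bb p nl y
    ... | w , w∈ , lw , fw with rel-fun θ y w x (trans (lam-det θ y w y x (λ q → fw (reverse msym q)) (λ q → far⇒¬Path f (reverse msym q)) refl lw) e) e
    ...   | refl = ⊥-elim (kept sx (deleted-∈ θ (lam x) w w w∈ (here refl)))

    walk-near : ∀ {b} → B b ≡ true → ¬ (b ∈ lonelyAll) → ∀ i k → i + k ≤ r → ∀ {u v} → Path m (i * R₀) b (base u) → S u ≡ false →
      Walk (adj nodeGraph) (λ v → S v ≡ false) k u v → Path m ((i + k) * R₀) b (base v)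
    walk-near Bb nl i k le p su here = weaken (ℕₚ.*-monoˡ-≤ R₀ (ℕₚ.m≤m+n i k)) p
    walk-near {b} Bb nl i (suc k) le {u} {v} p su (step {y = w} e sw q) = subst (λ l → Path m (l * R₀) b (base v)) (sym (ℕₚ.+-suc i k))
      (walk-near Bb nl (suc i) k (subst (_≤ r) (ℕₚ.+-suc i k) le)
        (subst (λ l → Path m l b (base w)) (ℕₚ.+-comm (i * R₀) R₀) (p ▹▹ near-step Bb nl (copy u) (base u) (copy w) (base w)
          (weaken (ℕₚ.*-monoˡ-≤ R₀ (ℕₚ.≤-trans (ℕₚ.m≤m+n i (suc k)) le)) p) e
          (subst (λ z → S z ≡ false) (sym (combine-copy-base u)) su) (subst (λ z → S z ≡ false) (sym (combine-copy-base w)) sw))) sw q)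

  keep : Fin (suc Θ) → Fin h → Bool
  keep c b = B b ∧ not (memb b lonelyAll ∨ S (combine c b))

  keep-elim : ∀ c b → keep c b ≡ true → B b ≡ true × ¬ (b ∈ lonelyAll) × S (combine c b) ≡ false
  keep-elim c b e with ∧-elim {B b} e
  ... | Bb , f = Bb , (λ i → true≢false (∨-introˡ (memb-complete i)) (not-true⇒false f)) , ≢true⇒false λ s → true≢false (∨-introʳ {memb b lonelyAll} s) (not-true⇒false f)

  Bnodes : Fin (suc Θ) → Subset (suc Θ * h)
  Bnodes c u = (copy u == c) ∧ keep c (base u)

  Bnodes-elim : ∀ c u → Bnodes c u ≡ true → combine c (base u) ≡ u × keep c (base u) ≡ true
  Bnodes-elim c u e with ∧-elim {copy u == c} e
  ... | p , q = trans (cong (λ c → combine c (base u)) (sym (==-sound p))) (combine-copy-base u) , q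

  Bnodes-count : ∀ c → countFin h B ≤ ∣ Bnodes c ∣ + (K + Θ * (K * 4))
  Bnodes-count c = begin
    countFin h B                                                        ≤⟨ count-≤-∪ B (keep c) (lonelyAll ++ map base deletedNodes) split ⟩
    countFin h (keep c) + length (lonelyAll ++ map base deletedNodes)   ≤⟨ ℕₚ.+-mono-≤ embed (subst (_≤ K + Θ * (K * 4)) (sym (trans (Listₚ.length-++ lonelyAll) (cong (length lonelyAll +_) (Listₚ.length-map base deletedNodes)))) (ℕₚ.+-mono-≤ lonelyAll-len deletedNodes-len)) ⟩
    ∣ Bnodes c ∣ + (K + Θ * (K * 4))                                    ∎
    where
    open ℕₚ.≤-Reasoning
    embed : countFin h (keep c) ≤ ∣ Bnodes c ∣
    embed = count-injection (keep c) (Bnodes c) (combine c) (λ i j e → proj₂ (Finₚ.combine-injective c i c j e))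
      λ b k → ∧-intro (subst (λ z → (z == c) ≡ true) (sym (copy-combine c b)) (==-refl c)) (subst (λ z → keep c z ≡ true) (sym (base-combine c b)) k)
    split : ∀ b → B b ≡ true → keep c b ≡ true ⊎ b ∈ lonelyAll ++ map base deletedNodes
    split b Bb with bool-cases (memb b lonelyAll) | bool-cases (S (combine c b))
    ... | inj₁ e | _ = inj₂ (∈ₚ.∈-++⁺ˡ (memb-sound e))
    ... | inj₂ _ | inj₁ e = inj₂ (∈ₚ.∈-++⁺ʳ lonelyAll (subst (_∈ map base deletedNodes) (base-combine c b) (∈ₚ.∈-map⁺ base (memb-sound e))))
    ... | inj₂ e | inj₂ e′ = inj₁ (∧-intro Bb (not-true (subst₂ (λ p q → (p ∨ q) ≡ false) (sym e) (sym e′) refl)))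

  Bnodes-indep : ∀ c → IndepIn (adj nodeGraph) (λ v → S v ≡ false) r (Bnodes c)
  Bnodes-indep c u v Bu Bv ne w with Bnodes-elim c u Bu | Bnodes-elim c v Bv
  ... | eu , ku | ev , kv with keep-elim c (base u) ku | keep-elim c (base v) kv
  ...   | Bb , nl , s | Bb′ , _ , _ = B-far (base u) (base v) Bb Bb′ (λ e → ne (trans (sym eu) (trans (cong (combine c) e) ev)))
          (weaken (ℕₚ.≤-trans (ℕₚ.m≤m+n Rb R₀) (ℕₚ.m≤m+n _ _)) (walk-near Bb nl 0 r ℕₚ.≤-refl stop (subst (λ z → S z ≡ false) eu s) w))

-- Locality relative to flips, and almost-wideness of the node graph

#flipLabels : ℕ → ℕ
#flipLabels zero    = 1
#flipLabels (suc s) = (2 * 2) * #flipLabels s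

flipLabel : ∀ {n} s → List (Flip n) → Fin n → Fin (#flipLabels s)
flipLabel zero    Fs             x = zero
flipLabel (suc s) []             x = combine (combine (bit false) (bit false)) (flipLabel s [] x)
flipLabel (suc s) ((A , B) ∷ Fs) x = combine (combine (bit (A x)) (bit (B x))) (flipLabel s Fs x)

togglesAll : ∀ {n} → List (Flip n) → Rel n
togglesAll []       x y = false
togglesAll (F ∷ Fs) x y = toggles F x y xor togglesAll Fs x y

flipsAdj-toggles : ∀ {n} (Fs : List (Flip n)) (a : Rel n) x y → flipsAdj Fs a x y ≡ a x y xor togglesAll Fs x y
flipsAdj-toggles []             a x y = sym (xor-false (a x y))
flipsAdj-toggles ((A , B) ∷ Fs) a x y = trans (flipsAdj-toggles Fs (flipAdj (A , B) a) x y)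
  (Data.Bool.Properties.xor-assoc (a x y) (toggles (A , B) x y) (togglesAll Fs x y))

togglesAll-labels : ∀ {n} s (Fs : List (Flip n)) → length Fs ≤ s → ∀ x y x′ y′ → flipLabel s Fs x ≡ flipLabel s Fs x′ → flipLabel s Fs y ≡ flipLabel s Fs y′ →
                    togglesAll Fs x y ≡ togglesAll Fs x′ y′
togglesAll-labels s       []             l       x y x′ y′ e e′ = refl
togglesAll-labels (suc s) ((A , B) ∷ Fs) (s≤s l) x y x′ y′ e e′ with parts x x′ e | parts y y′ e′
  where
  parts : ∀ x x′ → flipLabel (suc s) ((A , B) ∷ Fs) x ≡ flipLabel (suc s) ((A , B) ∷ Fs) x′ → A x ≡ A x′ × B x ≡ B x′ × flipLabel s Fs x ≡ flipLabel s Fs x′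
  parts x x′ e with Finₚ.combine-injective (combine (bit (A x)) (bit (B x))) (flipLabel s Fs x) (combine (bit (A x′)) (bit (B x′))) (flipLabel s Fs x′) e
  ... | f , g with Finₚ.combine-injective (bit (A x)) (bit (B x)) (bit (A x′)) (bit (B x′)) f
  ...   | p , q = bit-injective p , bit-injective q , g
... | ax , bx , gx | ay , by , gy = cong₂ _xor_ (cong₂ _∨_ (cong₂ _∧_ ax by) (cong₂ _∧_ bx ay)) (togglesAll-labels s Fs l x y x′ y′ gx gy)

flipsAdj-sym : ∀ {n} (Fs : List (Flip n)) {a : Rel n} → Sym a → Sym (flipsAdj Fs a)
flipsAdj-sym []             as = as
flipsAdj-sym ((A , B) ∷ Fs) as = flipsAdj-sym Fs λ x y → cong₂ _xor_ (as x y)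
  (trans (Data.Bool.Properties.∨-comm (A x ∧ B y) (B x ∧ A y)) (cong₂ _∨_ (Data.Bool.Properties.∧-comm (B x) (A y)) (Data.Bool.Properties.∧-comm (A x) (B y))))

-- On a pair that is not adjacent after the flips, adjacency in H is the parity of the flips that
-- toggle it, and membership in the flipped sets determines this parity.
flipContext : ∀ {c} (H : Graph) (col : Fin c → Fin (size H) → Bool) s (Fs : List (Flip (size H))) → length Fs ≤ s → Context c (#flipLabels s)
flipContext H col s Fs l = record
  { G = H ; col = col ; m = flipsAdj Fs (adj H) ; msym = flipsAdj-sym Fs (adj-sym H) ; κ = flipLabel s Fs
  ; κ-adj = λ x y x′ y′ f f′ e e′ _ _ → trans (undo x y f) (trans (togglesAll-labels s Fs l x y x′ y′ e e′) (sym (undo x′ y′ f′))) }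
  where
  undo : ∀ x y → flipsAdj Fs (adj H) x y ≡ false → adj H x y ≡ togglesAll Fs x y
  undo x y f = xor-differ (trans (sym (flipsAdj-toggles Fs (adj H) x y)) f)

AlmostWideAt : Graph → ℕ → ℕ → ℕ → ℕ → Set
AlmostWideAt G s N r k = ∀ (A : Subset (size G)) → ∣ A ∣ ≥ N → Σ (Subset (size G)) λ S → ∣ S ∣ ≤ s × Σ (Subset (size G)) λ B →
  (∀ v → B v ≡ true → A v ≡ true × S v ≡ false) × ∣ B ∣ > k × IndepIn (adj G) (λ v → S v ≡ false) r B

FlipLabels : (H : Graph) {Θ : ℕ} → (Fin Θ → Rel (size H)) → (s R₀ K : ℕ) → Set
FlipLabels H {Θ} rel s R₀ K = ∀ (F : List (Flip (size H))) → length F ≤ s → Σ (Fin (size H) → Fin K) λ lam →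
  ∀ θ x y x′ y′ → ¬ Path (flipsAdj F (adj H)) R₀ x y → ¬ Path (flipsAdj F (adj H)) R₀ x′ y′ → lam x ≡ lam x′ → lam y ≡ lam y′ → rel θ x y ≡ rel θ x′ y′

-- The factor `suc Θ` finds one copy with many vertices. Of the elements scattered in that copy, at
-- most `K` are lost to labels that are not spread and `Θ * (K * 4)` to deleted nodes.
nodeThreshold : (Θ R₀ K : ℕ) → (ℕ → ℕ → ℕ) → ℕ → ℕ → ℕ
nodeThreshold Θ R₀ K N r k = suc (suc Θ * N ((r * R₀ + R₀) + (R₀ + r * R₀)) (suc k + (K + Θ * (K * 4))))

node-wide : ∀ (H : Graph) {Θ} (rel : Fin Θ → Rel (size H)) → (∀ θ x y y′ → rel θ x y ≡ true → rel θ x y′ ≡ true → y ≡ y′) →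
  ∀ s R₀ K → FlipLabels H rel s R₀ K → (N : ℕ → ℕ → ℕ) →
  (∀ r k (A : Subset (size H)) → ∣ A ∣ ≥ N r k → Σ (List (Flip (size H))) λ F → length F ≤ s ×
    Σ (Subset (size H)) λ B → B ⊆ A × ∣ B ∣ ≥ k × IndepIn (flipsAdj F (adj H)) (λ _ → ⊤) r B) →
  ∀ r k → AlmostWideAt (NodeGraph.nodeGraph rel) (Θ * (K * 4)) (nodeThreshold Θ R₀ K N r k) r k
node-wide H {Θ} rel rel-fun s R₀ K labels N flat r k A big with large-copy (suc Θ) (size H) A (N ((r * R₀ + R₀) + (R₀ + r * R₀)) (suc k + (K + Θ * (K * 4)))) big
... | c , bigc with flat ((r * R₀ + R₀) + (R₀ + r * R₀)) (suc k + (K + Θ * (K * 4))) (λ x → A (combine c x)) bigc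
...   | F , lF , B , B⊆A , bigB , indep = S , S-small , Bnodes c , inside ,
          ℕₚ.+-cancelʳ-≤ (K + Θ * (K * 4)) (suc k) ∣ Bnodes c ∣ (ℕₚ.≤-trans bigB (Bnodes-count c)) , Bnodes-indep c
  where
  open NodeGraph rel
  toWalk : ∀ {r x y} → Path (flipsAdj F (adj H)) r x y → Walk (flipsAdj F (adj H)) (λ _ → ⊤) r x y
  toWalk stop = here
  toWalk (e ▸ w) = step e tt (toWalk w)
  open Spread rel rel-fun (flipsAdj F (adj H)) (flipsAdj-sym F (adj-sym H)) R₀ K (proj₁ (labels F lF)) (proj₂ (labels F lF)) r B
    (λ b b′ Bb Bb′ ne w → indep b b′ Bb Bb′ ne (toWalk w))
  inside : ∀ v → Bnodes c v ≡ true → A v ≡ true × S v ≡ false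
  inside v e with Bnodes-elim c v e
  ... | ev , kv with keep-elim c (base v) kv
  ...   | Bb , _ , sv = subst (λ v → A v ≡ true) ev (B⊆A (base v) Bb) , subst (λ v → S v ≡ false) ev sv

-- Covering the pairs of vertices of a transduced graph by tree models

record Cover (H : Graph) (q′ ρ K : ℕ) (M : Fin K → Fin K → Bool) (g : ℕ → ℕ) : Set where
  q : ℕ
  q = suc q′
  field
    n       : ℕ
    â       : Rel n
    âsym    : Sym â
    â-wcol  : ∀ r → WCol â r (g r)
    ι       : Fin (size H) → Fin n
    ι-inj   : ∀ x y → ι x ≡ ι y → x ≡ y
    TM      : Fin (#Sets q) → TreeModel (adj H) â ι q ρ K M
    colours : Fin (size H) → Fin q → Bool
  piece : (Fin q → Bool) → (Fin q → Bool) → Fin (#Sets q)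
  piece A B = toSet q (λ c → A c ∨ B c)
  field
    coveredˡ : ∀ x y → TreeModel.U (TM (piece (colours x) (colours y))) x ≡ true
    coveredʳ : ∀ x y → TreeModel.U (TM (piece (colours x) (colours y))) y ≡ true

-- W(x) is the set of vertices weakly R-reached by x.  In hat, x is adjacent to W(x); a pair x, y is
-- covered by the piece induced by the at most 2w colours occurring in W(x) ∪ W(y).
module CoverOf {c} (ψ : Formula c 2) (g : ℕ → ℕ) where

  R w p q′ q K₀ : ℕ
  R = radius ψ
  w = g R
  p = w + w
  ĝ : ℕ → ℕ
  ĝ r = g ((R + R) * suc r) * w
  q′ = ĝ (2 ^ p)
  q = suc q′
  K₀ = proj₁ (pairLocality ψ (#Sets q * #Sets q))

  module _ (G : Graph) (wcolG : ∀ r → WCol (adj G) r (g r)) (col : Fin c → Fin (size G) → Bool)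
    (H : Graph) (ι : Fin (size H) → Fin (size G)) (ι-inj : ∀ x y → ι x ≡ ι y → x ≡ y)
    (ι-adj : ∀ i j → i ≢ j → adj H i j ≡ (eval G col ψ (pair (ι i) (ι j)) ∨ eval G col ψ (pair (ι j) (ι i)))) where

    private
      open Hat (adj G) (adj-sym G) R w (wcolG R)
      module W₁ = WCol (wcolG R)
      hatW : ∀ r → WCol hat r (ĝ r)
      hatW r = hat-wcol r (g ((R + R) * suc r)) (wcolG ((R + R) * suc r))
      module W₂ = WCol (hatW (2 ^ p))

      colouring = Colouring.proper-colouring W₂.rk W₂.reach q′ W₂.reach-len
      χ : Fin (size G) → Fin q
      χ = proj₁ colouring

      χ-proper : ∀ {x u} → Path (up hat W₂.rk u) (2 ^ p) x u → x ≢ u → χ x ≢ χ u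
      χ-proper {x} {u} path ne = proj₂ colouring x u (W₂.reach-cov path) (ℕₚ.≤∧≢⇒< (up-start path) λ e → ne (W₂.rk-inj x u (sym e)))

      J : Fin (#Sets q) → Fin q → Bool
      -- Sets of more than `p` colours are replaced by the empty set, so that every index has a
      -- forest.
      J j c = ⌊ countFin q (member q j) ≤? p ⌋ ∧ member q j c

      J-small : ∀ j → countFin q (J j) ≤ p
      J-small j with countFin q (member q j) ≤? p
      ... | yes l = l
      ... | no _  = subst (_≤ p) (sym (count-empty {q} (λ _ → false) (λ _ → refl))) z≤n

      forest : ∀ j → Forest hat q (2 ^ p)
      forest j = BuildForest.forest hat hat-sym p W₂.rk W₂.rk-inj χ χ-proper (J j) (J-small j)

      palette : Fin (size G) → Fin q → Bool
      palette x c = anyFin (size G) (λ z → reaches x z ∧ (χ z == c))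

      palette-intro : ∀ {x z} → reaches x z ≡ true → palette x (χ z) ≡ true
      palette-intro {x} {z} e = anyFin-intro (λ z′ → reaches x z′ ∧ (χ z′ == χ z)) z (∧-intro e (==-refl (χ z)))

      palette-list : ∀ x c → palette x c ≡ true → c ∈ map χ (W₁.reach x)
      palette-list x c e with anyFin-elim (λ z → reaches x z ∧ (χ z == c)) e
      ... | z , t with ∧-elim {reaches x z} t
      ...   | r , s = subst (_∈ map χ (W₁.reach x)) (==-sound s) (∈ₚ.∈-map⁺ χ (W₁.reach-cov (near-sound R r)))

      list-len : ∀ x → length (map χ (W₁.reach x)) ≤ w
      list-len x = subst (_≤ w) (sym (Listₚ.length-map χ (W₁.reach x))) (W₁.reach-len x)

      union-small : ∀ x y → countFin q (λ c → palette x c ∨ palette y c) ≤ p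
      union-small x y = ℕₚ.≤-trans (count-≤-list _ (map χ (W₁.reach x) ++ map χ (W₁.reach y)) mem)
        (subst (_≤ p) (sym (Listₚ.length-++ (map χ (W₁.reach x)))) (ℕₚ.+-mono-≤ (list-len x) (list-len y)))
        where
        mem : ∀ c → (palette x c ∨ palette y c) ≡ true → c ∈ map χ (W₁.reach x) ++ map χ (W₁.reach y)
        mem c e with ∨-elim {palette x c} e
        ... | inj₁ a = ∈ₚ.∈-++⁺ˡ (palette-list x c a)
        ... | inj₂ b = ∈ₚ.∈-++⁺ʳ (map χ (W₁.reach x)) (palette-list y c b)

      U : Fin (#Sets q) → Fin (size H) → Bool
      U j i = allFin q (λ c → not (palette (ι i) c) ∨ J j c)

      U-elim : ∀ j i → U j i ≡ true → ∀ c → palette (ι i) c ≡ true → J j c ≡ true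
      U-elim j i u c e with ∨-elim {not (palette (ι i) c)} (allFin-elim (λ c → not (palette (ι i) c) ∨ J j c) u c)
      ... | inj₁ f = ⊥-elim (true≢false e (not-true⇒false f))
      ... | inj₂ f = f

      U-intro : ∀ j i → (∀ c → palette (ι i) c ≡ true → J j c ≡ true) → U j i ≡ true
      U-intro j i f = allFin-intro _ go
        where
        go : ∀ c → (not (palette (ι i) c) ∨ J j c) ≡ true
        go c with bool-cases (palette (ι i) c)
        ... | inj₁ e = ∨-introʳ {not (palette (ι i) c)} (f c e)
        ... | inj₂ e = ∨-introˡ (not-true e)

      covered : ∀ A → countFin q A ≤ p → ∀ i → (∀ c → palette (ι i) c ≡ true → A c ≡ true) → U (toSet q A) i ≡ true
      covered A small i sub = U-intro (toSet q A) i λ c e → ∧-intro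
        (⌊⌋-complete (countFin q (member q (toSet q A)) ≤? p) (subst (_≤ p) (count-cong {p = A} {member q (toSet q A)} (λ c → sym (member-toSet q A c))) small))
        (trans (member-toSet q A c) (sub c e))

    cover : Cover H q′ (2 ^ p) (K₀ * #Sets (K₀ * K₀)) (modelTable K₀) ĝ
    cover = record
      { n = size G ; â = hat ; âsym = hat-sym ; â-wcol = hatW ; ι = ι ; ι-inj = ι-inj
      ; TM = λ j → TreeModelOf.treeModel G col ψ w (wcolG R) q (2 ^ p) (forest j) H ι ι-adj (U j)
          (λ i u → U-elim j i u (χ (ι i)) (palette-intro (near-complete stop)))
          (λ i z u e → U-elim j i u (χ z) (palette-intro e))
          K₀ (proj₂ (pairLocality ψ (#Sets q * #Sets q)))
      ; colours = λ x → palette (ι x)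
      ; coveredˡ = λ x y → covered (λ c → palette (ι x) c ∨ palette (ι y) c) (union-small (ι x) (ι y)) x (λ c e → ∨-introˡ e)
      ; coveredʳ = λ x y → covered (λ c → palette (ι x) c ∨ palette (ι y) c) (union-small (ι x) (ι y)) y (λ c e → ∨-introʳ {palette (ι x) c} e) }

-- Sparsification: the graph of the component representatives

∑-≥ : ∀ k (f : Fin k → ℕ) i → f i ≤ ∑ k f
∑-≥ (suc k) f zero    = ℕₚ.m≤m+n _ _
∑-≥ (suc k) f (suc i) = ℕₚ.≤-trans (∑-≥ k (λ i → f (suc i)) i) (ℕₚ.m≤n+m _ _)

module Sparsification (q′ ρ K : ℕ) (M : Fin K → Fin K → Bool) (M-sym : ∀ α β → M α β ≡ M β α) (g : ℕ → ℕ) where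

  q #pieces Θ #labels Q : ℕ
  q = suc q′
  #pieces = #Sets q
  Θ = #pieces * q
  #labels = ΠFin Θ (λ _ → K)
  Q = #pieces * (#Sets #pieces * (#labels * #Sets Θ))

  opaque
    encode : Fin #pieces → Fin (#Sets #pieces) → Fin #labels → Fin (#Sets Θ) → Fin Q
    encode a b c d = combine a (combine b (combine c d))

    decode₁ : Fin Q → Fin #pieces
    decode₁ x = proj₁ (remQuot {#pieces} (#Sets #pieces * (#labels * #Sets Θ)) x)

    decode₂ : Fin Q → Fin (#Sets #pieces)
    decode₂ x = proj₁ (remQuot {#Sets #pieces} (#labels * #Sets Θ) (proj₂ (remQuot {#pieces} (#Sets #pieces * (#labels * #Sets Θ)) x)))

    decode₃₄ : Fin Q → Fin #labels × Fin (#Sets Θ)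
    decode₃₄ x = remQuot {#labels} (#Sets Θ) (proj₂ (remQuot {#Sets #pieces} (#labels * #Sets Θ) (proj₂ (remQuot {#pieces} (#Sets #pieces * (#labels * #Sets Θ)) x))))

    decode₁-encode : ∀ a b c d → decode₁ (encode a b c d) ≡ a
    decode₁-encode a b c d = cong proj₁ (Finₚ.remQuot-combine a (combine b (combine c d)))

    decode₂-encode : ∀ a b c d → decode₂ (encode a b c d) ≡ b
    decode₂-encode a b c d = trans (cong (λ z → proj₁ (remQuot {#Sets #pieces} (#labels * #Sets Θ) (proj₂ z))) (Finₚ.remQuot-combine a (combine b (combine c d))))
      (cong proj₁ (Finₚ.remQuot-combine b (combine c d)))

    decode₃₄-encode : ∀ a b c d → decode₃₄ (encode a b c d) ≡ (c , d)
    decode₃₄-encode a b c d = trans (cong (λ z → remQuot {#labels} (#Sets Θ) (proj₂ (remQuot {#Sets #pieces} (#labels * #Sets Θ) (proj₂ z)))) (Finₚ.remQuot-combine a (combine b (combine c d))))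
      (trans (cong (λ z → remQuot {#labels} (#Sets Θ) (proj₂ z)) (Finₚ.remQuot-combine b (combine c d))) (Finₚ.remQuot-combine c d))

  clip : ℕ → Fin q
  clip i with i <? q
  ... | yes l = fromℕ< l
  ... | no _  = zero

  toℕ-clip : ∀ {i} → i < q → toℕ (clip i) ≡ i
  toℕ-clip {i} l with i <? q
  ... | yes l′ = Finₚ.toℕ-fromℕ< l′
  ... | no n   = ⊥-elim (n l)

  pieceOf : Fin Θ → Fin #pieces
  pieceOf θ = proj₁ (remQuot {#pieces} q θ)

  levelOf : Fin Θ → ℕ
  levelOf θ = toℕ (proj₂ (remQuot {#pieces} q θ))

  levelOf-< : ∀ θ → levelOf θ < q
  levelOf-< θ = Finₚ.toℕ<n (proj₂ (remQuot {#pieces} q θ))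

  Uc : Fin #pieces → Fin Q → Bool
  Uc j c = member #pieces (decode₂ c) j

  ℓc : Fin #pieces → ℕ → Fin Q → Fin K
  ℓc j i c = unpack Θ (λ _ → K) (proj₁ (decode₃₄ c)) (combine j (clip i))

  repc : Fin Θ → Fin Q → Bool
  repc θ c = member Θ (proj₂ (decode₃₄ c)) θ

  opaque
    relF : Fin Θ → Formula Q 2
    relF θ = ComponentFormula.nodeF (Uc (pieceOf θ)) (ℓc (pieceOf θ)) M (diamBound K q) (suc (levelOf θ)) (repc θ)

  codeBound : ℕ
  codeBound = suc Θ + Θ * ∑ q (λ i → decodeBound q K (suc (toℕ i)))

  nodeBound : ℕ → ℕ
  nodeBound r = g ((ρ + ρ) * suc r) * codeBound

  module _ (H : Graph) (cov : Cover H q′ ρ K M g) where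

    open Cover cov using (n; â; âsym; â-wcol; ι; ι-inj; TM; piece; coveredˡ; coveredʳ) renaming (colours to palette)
    private
      h = size H
      module TMj j = TreeModel (TM j)
      module CC j = ComponentClusters (adj H) (adj-sym H) ι-inj M-sym (TM j)
      module CO j = Components (adj H) (adj-sym H) ι-inj M-sym (TM j)

    -- Level `i` stands for the classes of stage `i + 1`, as stage 0 has only one class.
    repθ : Fin Θ → Fin h → Fin h
    repθ θ = CC.rep (pieceOf θ) (suc (levelOf θ))

    rel : Fin Θ → Rel h
    rel θ x y = TMj.U (pieceOf θ) x ∧ (repθ θ x == y)

    rel-fun : ∀ θ x y y′ → rel θ x y ≡ true → rel θ x y′ ≡ true → y ≡ y′
    rel-fun θ x y y′ e e′ = trans (sym (==-sound (proj₂ (∧-elim {TMj.U (pieceOf θ) x} e)))) (==-sound (proj₂ (∧-elim {TMj.U (pieceOf θ) x} e′)))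

    ξ : Fin h → Fin Q
    ξ x = encode (toSet q (palette x)) (toSet #pieces (λ j → TMj.U j x)) (pack Θ (λ _ → K) (λ θ → TMj.ℓ (pieceOf θ) (levelOf θ) x)) (toSet Θ (λ θ → repθ θ x == x))

    Uc-ξ : ∀ j x → Uc j (ξ x) ≡ TMj.U j x
    Uc-ξ j x = trans (cong (λ s → member #pieces s j) (decode₂-encode _ _ _ _)) (member-toSet #pieces (λ j → TMj.U j x) j)

    ℓc-ξ : ∀ j i → i < q → ∀ x → ℓc j i (ξ x) ≡ TMj.ℓ j i x
    ℓc-ξ j i l x = trans (cong (λ s → unpack Θ (λ _ → K) (proj₁ s) (combine j (clip i))) (decode₃₄-encode _ _ _ _))
      (trans (unpack-pack Θ (λ _ → K) (λ θ → TMj.ℓ (pieceOf θ) (levelOf θ) x) (combine j (clip i)))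
        (trans (cong (λ jk → TMj.ℓ (proj₁ jk) (toℕ (proj₂ jk)) x) (Finₚ.remQuot-combine j (clip i))) (cong (λ i → TMj.ℓ j i x) (toℕ-clip l))))

    repc-ξ : ∀ θ x → repc θ (ξ x) ≡ (repθ θ x == x)
    repc-ξ θ x = trans (cong (λ s → member Θ (proj₂ s) θ) (decode₃₄-encode _ _ _ _)) (member-toSet Θ (λ θ → repθ θ x == x) θ)

    opaque
      unfolding relF
      eval-relF : ∀ θ x y → eval H (oneHot ξ) (relF θ) (pair x y) ≡ rel θ x y
      eval-relF θ x y = EvalComponents.eval-nodeF H ι-inj M-sym (TM (pieceOf θ)) ξ (Uc (pieceOf θ)) (ℓc (pieceOf θ)) (Uc-ξ (pieceOf θ)) (ℓc-ξ (pieceOf θ))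
        (suc (levelOf θ)) (levelOf-< θ) (repc θ) (repc-ξ θ) x y

    open NodeGraph rel

    private
      own : Fin Θ → Fin h → Bool
      own θ y = TMj.U (pieceOf θ) y ∧ (repθ θ y == y)

      -- Names that represent no component still need a nonempty connected cluster; a singleton adds
      -- only a constant to the congestion.
      X′ : Fin (suc Θ) → Fin h → Fin n → Bool
      X′ zero    y z = ι y == z
      X′ (suc θ) y z = if own θ y then CC.cluster (pieceOf θ) (suc (levelOf θ)) y z else (ι y == z)

      class-in : ∀ θ {y x} → own θ y ≡ true → CO.Eqv (pieceOf θ) (suc (levelOf θ)) y x ≡ true → X′ (suc θ) y (ι x) ≡ true
      class-in θ {y} o e rewrite o = CC.cluster-class (pieceOf θ) (levelOf θ) (levelOf-< θ) (proj₁ (∧-elim {TMj.U (pieceOf θ) y} o)) e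

      X′-base : ∀ c y → X′ c y (ι y) ≡ true
      X′-base zero y = ==-refl (ι y)
      X′-base (suc θ) y with bool-cases (own θ y)
      ... | inj₁ o = class-in θ o (CO.Good.e-refl (CO.good (pieceOf θ) (suc (levelOf θ))) y)
      ... | inj₂ o rewrite o = ==-refl (ι y)

      X′-conn : ∀ c y z z′ → X′ c y z ≡ true → X′ c y z′ ≡ true → Path (restrict â (X′ c y)) (ρ + ρ) z z′
      X′-conn zero y z z′ e e′ = subst₂ (Path _ (ρ + ρ)) (==-sound e) (==-sound e′) stop
      X′-conn (suc θ) y z z′ e e′ with own θ y
      ... | true  = CC.below-conn (pieceOf θ) (TMj.t (pieceOf θ) (CC.level (pieceOf θ) (suc (levelOf θ)) y) y) âsym e e′
      ... | false = subst₂ (Path _ (ρ + ρ)) (==-sound e) (==-sound e′) stop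

      codeθ : ∀ θ → Σ (Fin n → List (Fin h)) λ code → (∀ z → length (code z) ≤ decodeBound q K (suc (levelOf θ))) ×
        (∀ y z → TMj.U (pieceOf θ) y ≡ true → CC.cluster (pieceOf θ) (suc (levelOf θ)) y z ≡ true → repθ θ y ∈ code z)
      codeθ θ = CC.cluster-code (pieceOf θ) (levelOf θ) (levelOf-< θ)

      preimage : Fin n → List (Fin h)
      preimage z = maybeList (first (λ y → ι y == z))

      preimage-∈ : ∀ y z → (ι y == z) ≡ true → y ∈ preimage z
      preimage-∈ y z e with first-complete (λ y → ι y == z) y e
      ... | y′ , f = subst (λ o → y ∈ maybeList o) (sym f) (here (ι-inj y y′ (trans (==-sound e) (sym (==-sound (first-sound (λ y → ι y == z) f))))))

      code : Fin n → List (Fin (suc Θ * h))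
      code z = concatMap (λ c → map (combine c) (preimage z)) (elems {suc Θ} (λ _ → true)) ++
               concatMap (λ θ → map (combine (suc θ)) (proj₁ (codeθ θ) z)) (elems {Θ} (λ _ → true))

      code-len : ∀ z → length (code z) ≤ codeBound
      code-len z = subst (_≤ codeBound) (sym (Listₚ.length-++ (concatMap (λ c → map (combine c) (preimage z)) (elems {suc Θ} (λ _ → true)))))
        (ℕₚ.+-mono-≤
          (ℕₚ.≤-trans (length-concatMap-≤ (λ c → map (combine c) (preimage z)) (elems {suc Θ} (λ _ → true))
              (λ c _ → subst (_≤ 1) (sym (Listₚ.length-map (combine {suc Θ} c) (preimage z))) (maybeList-len (first (λ y → ι y == z)))))
            (ℕₚ.≤-reflexive (trans (ℕₚ.*-identityʳ _) (elems-all-len (suc Θ)))))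
          (ℕₚ.≤-trans (length-concatMap-≤ (λ θ → map (combine (suc θ)) (proj₁ (codeθ θ) z)) (elems {Θ} (λ _ → true))
              (λ θ _ → subst (_≤ _) (sym (Listₚ.length-map (combine {suc Θ} (suc θ)) (proj₁ (codeθ θ) z)))
                (ℕₚ.≤-trans (proj₁ (proj₂ (codeθ θ)) z) (∑-≥ q (λ i → decodeBound q K (suc (toℕ i))) (proj₂ (remQuot {#pieces} q θ))))))
            (ℕₚ.≤-reflexive (cong (_* ∑ q (λ i → decodeBound q K (suc (toℕ i)))) (elems-all-len Θ)))))

      code-∈ : ∀ c y z → X′ c y z ≡ true → combine c y ∈ code z
      code-∈ c y z e = go c e
        where
        viaPre : ∀ c → (ι y == z) ≡ true → combine c y ∈ code z
        viaPre c e = ∈ₚ.∈-++⁺ˡ (∈-concatMap (λ c → map (combine c) (preimage z)) (elems {suc Θ} (λ _ → true)) (elems-complete (λ _ → true) c refl) (∈ₚ.∈-map⁺ (combine c) (preimage-∈ y z e)))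
        go : ∀ c → X′ c y z ≡ true → combine c y ∈ code z
        go zero e = viaPre zero e
        go (suc θ) e with own θ y in o
        ... | false = viaPre (suc θ) e
        ... | true with ∧-elim {TMj.U (pieceOf θ) y} o
        ...   | u , rp = ∈ₚ.∈-++⁺ʳ (concatMap (λ c → map (combine c) (preimage z)) (elems {suc Θ} (λ _ → true)))
                  (∈-concatMap (λ θ → map (combine (suc θ)) (proj₁ (codeθ θ) z)) (elems {Θ} (λ _ → true)) (elems-complete (λ _ → true) θ refl)
                    (∈ₚ.∈-map⁺ (combine (suc θ)) (subst (_∈ proj₁ (codeθ θ) z) (==-sound rp) (proj₂ (proj₂ (codeθ θ)) y z u e))))

      link-meet : ∀ c x c′ y → link c x c′ y ≡ true → ∃[ z ] (X′ c x z ≡ true × X′ c′ y z ≡ true)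
      link-meet zero x (suc θ) y e with ∧-elim {TMj.U (pieceOf θ) x} e
      ... | u , r with ==-sound r
      ...   | refl = ι x , ==-refl (ι x) , class-in θ (∧-intro (CC.Eqv-U (pieceOf θ) (levelOf θ) cls u) (⌊⌋-complete (repθ θ (repθ θ x) ≟ repθ θ x) (sym (CC.rep-cong (pieceOf θ) _ cls))))
                         (CO.Good.e-sym (CO.good (pieceOf θ) (suc (levelOf θ))) cls)
        where
        cls : CO.Eqv (pieceOf θ) (suc (levelOf θ)) x (repθ θ x) ≡ true
        cls = CC.rep-class (pieceOf θ) (suc (levelOf θ)) x
      link-meet (suc θ) x zero y e with link-meet zero y (suc θ) x e
      ... | z , p , p′ = z , p′ , p

    node-wcol : ∀ r → WCol (adj nodeGraph) r (nodeBound r)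
    node-wcol r = ClusterOrder.clusterOrder â (adj nodeGraph) (λ u → X′ (copy u) (base u)) (ρ + ρ) codeBound (λ u → ι (base u))
      (λ u → X′-base (copy u) (base u)) (λ u → X′-conn (copy u) (base u)) code code-len
      (λ u z e → subst (_∈ code z) (combine-copy-base u) (code-∈ (copy u) (base u) z e))
      (λ u v → link-meet (copy u) (base u) (copy v) (base v)) r _ (â-wcol ((ρ + ρ) * suc r))

-- Recovering H from the node graph

module SparseTransduction (q′ ρ K : ℕ) (M : Fin K → Fin K → Bool) (M-sym : ∀ α β → M α β ≡ M β α) (g : ℕ → ℕ) where

  open Sparsification q′ ρ K M M-sym g

  sameNodeF : Fin Θ → Formula (Q + Θ) 2
  sameNodeF θ = ex (and (color (Q Fin.↑ʳ θ) zero) (and (edge (suc zero) zero) (edge (suc (suc zero)) zero)))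

  -- Descends through the stages while both vertices have a common node; at the first stage that
  -- separates them the model gives the adjacency.
  levelsF : Fin #pieces → Fin Q → Fin Q → ℕ → ℕ → Formula (Q + Θ) 2
  -- A default that distinct covered vertices never reach, since classes of stage `q` meet the piece
  -- in single vertices.
  levelsF j c d i zero    = boolF zero false
  levelsF j c d i (suc k) = or (and (sameNodeF (combine j (clip i))) (levelsF j c d (suc i) k))
                               (and (neg (sameNodeF (combine j (clip i)))) (boolF zero (M (ℓc j i c) (ℓc j i d))))

  pieceC : Fin Q → Fin Q → Fin #pieces
  pieceC c d = toSet q (λ k → member q (decode₁ c) k ∨ member q (decode₁ d) k)

  adjF : Fin Q ⊎ Fin Θ → Fin Q ⊎ Fin Θ → Formula (Q + Θ) 2
  adjF (inj₁ c) (inj₁ d) = levelsF (pieceC c d) c d 0 q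
  adjF (inj₁ c) (inj₂ _) = boolF zero false
  adjF (inj₂ _) _        = boolF zero false

  isReal : Fin Q ⊎ Fin Θ → Bool
  isReal (inj₁ _) = true
  isReal (inj₂ _) = false

  τ : Transduction
  τ = record
    { colours = Q + Θ
    ; δ = caseF zero (λ c → boolF zero (isReal (Fin.splitAt Q c)))
    ; φ = case₂F zero (suc zero) (λ c d → adjF (Fin.splitAt Q c) (Fin.splitAt Q d)) }

  module _ (H : Graph) (cov : Cover H q′ ρ K M g) where

    open Cover cov using (ι-inj; TM; piece; coveredˡ; coveredʳ) renaming (colours to palette)
    private
      h = size H
      relH = rel H cov
      ξH = ξ H cov
      module TMj j = TreeModel (TM j)
      module CC j = ComponentClusters (adj H) (adj-sym H) ι-inj M-sym (TM j)
      module CO j = Components (adj H) (adj-sym H) ι-inj M-sym (TM j)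
    open NodeGraph relH

    private
      real : Fin h → Fin (suc Θ * h)
      real x = combine {suc Θ} zero x

      mark : Fin (suc Θ) → Fin h → Fin (Q + Θ)
      mark zero    x = ξH x Fin.↑ˡ Θ
      mark (suc θ) x = Q Fin.↑ʳ θ

      ξ′ : Fin (suc Θ * h) → Fin (Q + Θ)
      ξ′ u = mark (copy u) (base u)

      ξ′-combine : ∀ c x → ξ′ (combine c x) ≡ mark c x
      ξ′-combine c x = cong₂ mark (copy-combine c x) (base-combine c x)

      adj-real : ∀ x θ y → adj nodeGraph (real x) (combine (suc θ) y) ≡ relH θ x y
      adj-real x θ y = trans (cong₂ (λ c z → link c z (copy (combine (suc θ) y)) (base (combine (suc θ) y))) (copy-combine zero x) (base-combine zero x))
        (cong₂ (λ c z → link zero x c z) (copy-combine (suc θ) y) (base-combine (suc θ) y))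

      evalN : ∀ {k} → Formula (Q + Θ) k → (Fin k → Fin (suc Θ * h)) → Bool
      evalN = eval nodeGraph (oneHot ξ′)

      mark-node : ∀ c x θ → mark c x ≡ Q Fin.↑ʳ θ → c ≡ suc θ
      mark-node zero x θ e with trans (sym (Finₚ.splitAt-↑ˡ Q (ξH x) Θ)) (trans (cong (Fin.splitAt Q) e) (Finₚ.splitAt-↑ʳ Q Θ θ))
      ... | ()
      mark-node (suc θ′) x θ e = cong suc (Finₚ.↑ʳ-injective Q θ′ θ e)

      eval-sameNodeF : ∀ θ {x y} → TMj.U (pieceOf θ) x ≡ true → TMj.U (pieceOf θ) y ≡ true →
        evalN (sameNodeF θ) (pair (real x) (real y)) ≡ CO.Eqv (pieceOf θ) (suc (levelOf θ)) x y
      eval-sameNodeF θ {x} {y} ux uy = iff⇒≡ to from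
        where
        body : Fin (suc Θ * h) → Bool
        body z = (ξ′ z == (Q Fin.↑ʳ θ)) ∧ (adj nodeGraph (real x) z ∧ adj nodeGraph (real y) z)
        to : anyFin (suc Θ * h) body ≡ true → CO.Eqv (pieceOf θ) (suc (levelOf θ)) x y ≡ true
        to e with anyFin-elim body e
        ... | z , t with ∧-elim {ξ′ z == (Q Fin.↑ʳ θ)} t
        ...   | c , ab with ∧-elim {adj nodeGraph (real x) z} ab
        ...     | a , b = CC.rep-Eqv (pieceOf θ) (suc (levelOf θ)) (trans (repOf x a) (sym (repOf y b)))
          where
          z≡ : combine (suc θ) (base z) ≡ z
          z≡ = trans (cong (λ c → combine c (base z)) (sym (mark-node (copy z) (base z) θ (==-sound c)))) (combine-copy-base z)
          repOf : ∀ x → adj nodeGraph (real x) z ≡ true → repθ H cov θ x ≡ base z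
          repOf x a = ==-sound (proj₂ (∧-elim {TMj.U (pieceOf θ) x} (trans (sym (adj-real x θ (base z))) (subst (λ z → adj nodeGraph (real x) z ≡ true) (sym z≡) a))))
        from : CO.Eqv (pieceOf θ) (suc (levelOf θ)) x y ≡ true → anyFin (suc Θ * h) body ≡ true
        from e = anyFin-intro body (combine (suc θ) (repθ H cov θ x)) (∧-intro
          (⌊⌋-complete (ξ′ (combine (suc θ) (repθ H cov θ x)) ≟ (Q Fin.↑ʳ θ)) (ξ′-combine (suc θ) (repθ H cov θ x)))
          (∧-intro (trans (adj-real x θ _) (∧-intro ux (==-refl (repθ H cov θ x))))
                   (trans (adj-real y θ _) (∧-intro uy (⌊⌋-complete (repθ H cov θ y ≟ repθ H cov θ x) (sym (CC.rep-cong (pieceOf θ) _ e)))))))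

      eval-sameNode : ∀ j i → i < q → ∀ {x y} → TMj.U j x ≡ true → TMj.U j y ≡ true →
        evalN (sameNodeF (combine j (clip i))) (pair (real x) (real y)) ≡ CO.Eqv j (suc i) x y
      eval-sameNode j i l {x} {y} ux uy = trans (eval-sameNodeF (combine j (clip i)) (at-piece ux) (at-piece uy))
        (trans (cong (λ jk → CO.Eqv (proj₁ jk) (suc (toℕ (proj₂ jk))) x y) (Finₚ.remQuot-combine j (clip i))) (cong (λ i → CO.Eqv j (suc i) x y) (toℕ-clip l)))
        where
        at-piece : ∀ {x} → TMj.U j x ≡ true → TMj.U (pieceOf (combine j (clip i))) x ≡ true
        at-piece {x} u = subst (λ jk → TMj.U (proj₁ jk) x ≡ true) (sym (Finₚ.remQuot-combine j (clip i))) u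

      eval-levelsF : ∀ j {x y} → x ≢ y → TMj.U j x ≡ true → TMj.U j y ≡ true → ∀ k i → i + k ≡ q → CO.Eqv j i x y ≡ true →
        evalN (levelsF j (ξH x) (ξH y) i k) (pair (real x) (real y)) ≡ adj H x y
      eval-levelsF j ne ux uy zero i e eqv = ⊥-elim (ne (CC.Eqv-top j ux uy (subst (λ i → CO.Eqv j i _ _ ≡ true) (trans (sym (ℕₚ.+-identityʳ i)) e) eqv)))
      eval-levelsF j {x} {y} ne ux uy (suc k) i e eqv = go (bool-cases (CO.Eqv j (suc i) x y))
        where
        i<q : i < q
        i<q = subst (i <_) e (ℕₚ.m<m+n i (s≤s z≤n))
        same = eval-sameNode j i i<q ux uy
        table = boolF {Q + Θ} {2} zero (M (ℓc j i (ξH x)) (ℓc j i (ξH y)))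
        go : CO.Eqv j (suc i) x y ≡ true ⊎ CO.Eqv j (suc i) x y ≡ false → evalN (levelsF j (ξH x) (ξH y) i (suc k)) (pair (real x) (real y)) ≡ adj H x y
        go (inj₁ t) = trans (cong₂ (λ s l → (s ∧ l) ∨ (not s ∧ evalN table (pair (real x) (real y)))) (trans same t) (eval-levelsF j ne ux uy k (suc i) (trans (sym (ℕₚ.+-suc i k)) e) t))
                        (Data.Bool.Properties.∨-identityʳ (adj H x y))
        go (inj₂ f) = trans (cong (λ s → (s ∧ evalN (levelsF j (ξH x) (ξH y) (suc i) k) (pair (real x) (real y))) ∨ (not s ∧ evalN table (pair (real x) (real y)))) (trans same f))
                        (trans (eval-boolF nodeGraph (oneHot ξ′) zero _ (pair (real x) (real y)))
                          (trans (cong₂ M (ℓc-ξ H cov j i i<q x) (ℓc-ξ H cov j i i<q y)) (sym (CC.separated-adj j i ux uy eqv f))))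

      pieceC-ξ : ∀ x y → pieceC (ξH x) (ξH y) ≡ piece (palette x) (palette y)
      pieceC-ξ x y = toSet-cong q λ k → cong₂ _∨_ (at-ξ x k) (at-ξ y k)
        where
        at-ξ : ∀ x k → member q (decode₁ (ξH x)) k ≡ palette x k
        at-ξ x k = trans (cong (λ s → member q s k) (decode₁-encode _ _ _ _)) (member-toSet q (palette x) k)

      split-real : ∀ x → Fin.splitAt Q (ξ′ (real x)) ≡ inj₁ (ξH x)
      split-real x = trans (cong (Fin.splitAt Q) (ξ′-combine zero x)) (Finₚ.splitAt-↑ˡ Q (ξH x) Θ)

      eval-φ : ∀ x y → x ≢ y → evalN (φ τ) (pair (real x) (real y)) ≡ adj H x y
      eval-φ x y ne = trans (eval-case₂F nodeGraph ξ′ zero (suc zero) (λ c d → adjF (Fin.splitAt Q c) (Fin.splitAt Q d)) (pair (real x) (real y)))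
        (trans (cong₂ (λ c d → evalN (adjF c d) (pair (real x) (real y))) (split-real x) (split-real y))
          (trans (cong (λ j → evalN (levelsF j (ξH x) (ξH y) 0 q) (pair (real x) (real y))) (pieceC-ξ x y))
            (eval-levelsF _ ne (coveredˡ x y) (coveredʳ x y) q 0 refl refl)))

    in-transduction : InTrans τ nodeGraph H
    in-transduction = oneHot ξ′ , real , (λ i j e → proj₂ (Finₚ.combine-injective {suc Θ} zero i zero j e)) ,
      (λ i → trans (eval-δ (real i)) (cong isReal (split-real i))) ,
      (λ v e → base v , realise v (copy v) refl (trans (sym (eval-δ v)) e)) ,
      (λ i j ne → sym (trans (cong₂ _∨_ (eval-φ i j ne) (trans (eval-φ j i (λ e → ne (sym e))) (adj-sym H j i))) (Data.Bool.Properties.∨-idem (adj H i j))))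
      where
      eval-δ : ∀ v → evalN (δ τ) (λ _ → v) ≡ isReal (Fin.splitAt Q (ξ′ v))
      eval-δ v = trans (eval-caseF nodeGraph ξ′ zero _ (λ _ → v)) (eval-boolF nodeGraph (oneHot ξ′) zero _ (λ _ → v))
      realise : ∀ v c → copy v ≡ c → isReal (Fin.splitAt Q (ξ′ v)) ≡ true → real (base v) ≡ v
      realise v zero    e t = trans (cong (λ c → combine c (base v)) (sym e)) (combine-copy-base v)
      realise v (suc θ) e t with trans (sym t) (cong isReal (trans (cong (λ c → Fin.splitAt Q (mark c (base v))) e) (Finₚ.splitAt-↑ʳ Q Θ θ)))
      ... | ()

  module Wide (s : ℕ) where

    Kθ : Fin Θ → ℕ
    Kθ θ = proj₁ (pairLocality (relF θ) (#flipLabels s))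

    K* R₀ : ℕ
    K* = ΠFin Θ Kθ
    R₀ = ∑ Θ (λ θ → radius (relF θ))

    -- The node functions are defined in H by `relF`, so locality relative to the flipped graph
    -- labels each of them; the product of the label sets and the sum of the radii serve all of them
    -- at once.
    flip-labels : ∀ (H : Graph) (cov : Cover H q′ ρ K M g) → FlipLabels H (rel H cov) s R₀ K*
    flip-labels H cov F lF = lam , lam-det
      where
      X : Context Q (#flipLabels s)
      X = flipContext H (oneHot (ξ H cov)) s F lF
      pl : ∀ θ → PairLocal X (relF θ) (Kθ θ)
      pl θ = proj₂ (pairLocality (relF θ) (#flipLabels s)) X
      lam : Fin (size H) → Fin K*
      lam x = pack Θ Kθ (λ θ → plab (pl θ) x)
      lam-det : ∀ θ x y x′ y′ → ¬ Path (m X) R₀ x y → ¬ Path (m X) R₀ x′ y′ → lam x ≡ lam x′ → lam y ≡ lam y′ → rel H cov θ x y ≡ rel H cov θ x′ y′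
      lam-det θ x y x′ y′ f f′ e e′ = trans (sym (eval-relF H cov θ x y)) (trans
        (pdet (pl θ) x y x′ y′ (λ w → f (weaken r≤ w)) (λ w → f′ (weaken r≤ w))
          (pack-injective Θ Kθ (λ θ → plab (pl θ) x) (λ θ → plab (pl θ) x′) e θ) (pack-injective Θ Kθ (λ θ → plab (pl θ) y) (λ θ → plab (pl θ) y′) e′ θ))
        (eval-relF H cov θ x′ y′))
        where
        r≤ : radius (relF θ) ≤ R₀
        r≤ = ∑-≥ Θ (λ θ → radius (relF θ)) θ

  sparse-class : ∀ (C : Class) → (∀ H → C H → Cover H q′ ρ K M g) → StronglyFlipFlat C →
    Σ Class λ D → Σ Transduction λ T → BoundedExpansion D × UniformlyAlmostWide D × C ⊆T[ T ] D
  sparse-class C cov (s , flat) = D , τ , bounded , wide , contained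
    where
    open Wide s

    nodeN : ℕ → ℕ → ℕ
    nodeN = nodeThreshold Θ R₀ K* (λ r → proj₁ (flat r))

    D : Class
    -- The class collects all graphs that satisfy the two families of bounds. Bounded expansion and
    -- almost-wideness are then read off, and the work is to show that node graphs belong to it.
    D G = (∀ r → WCol (adj G) r (nodeBound r)) × (∀ r k → AlmostWideAt G (Θ * (K* * 4)) (nodeN r k) r k)

    bounded : BoundedExpansion D
    bounded = (λ r → nodeBound ((r + r) + suc (r + r)) + nodeBound ((r + r) + suc (r + r))) ,
              λ r G H d → wcol-sparse G r (nodeBound ((r + r) + suc (r + r))) (proj₁ d ((r + r) + suc (r + r))) H

    wide : UniformlyAlmostWide D
    wide = Θ * (K* * 4) , λ r → nodeN r , λ k G d → proj₂ d r k

    contained : C ⊆T[ τ ] D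
    contained H cH = NodeGraph.nodeGraph (rel H (cov H cH)) ,
      (node-wcol H (cov H cH) , node-wide H (rel H (cov H cH)) (rel-fun H (cov H cH)) s R₀ K* (flip-labels H (cov H cH)) (λ r → proj₁ (flat r)) (λ r k → proj₂ (flat r) k H cH)) ,
      in-transduction H (cov H cH)

-- Assembling the equivalence

sparsify : ∀ (C D₀ : Class) (T : Transduction) → BoundedExpansion D₀ → C ⊆T[ T ] D₀ → StronglyFlipFlat C →
  Σ Class λ D → Σ Transduction λ T → BoundedExpansion D × UniformlyAlmostWide D × C ⊆T[ T ] D
sparsify C D₀ T (f , bound) sub flat = SparseTransduction.sparse-class q′ (2 ^ p) (K₀ * #Sets (K₀ * K₀)) (modelTable K₀) (modelTable-sym K₀) ĝ C (λ H cH → cov H (sub H cH)) flat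
  where
  g : ℕ → ℕ
  g r = wcolBound (hitBound f r) r
  open CoverOf (φ T) g
  cov : ∀ H → ∃[ G ] (D₀ G × InTrans T G H) → Cover H q′ (2 ^ p) (K₀ * #Sets (K₀ * K₀)) (modelTable K₀) ĝ
  cov H (G , dG , col , ι , ι-inj , _ , _ , ι-adj) =
    cover G (BoundedExpansionOrder.wcol G f (λ ρ H → bound ρ G H dG)) col H ι ι-inj ι-adj

mainTheorem4 : (C : Class) → StructurallyBoundedExpansion C →
    (StronglyFlipFlat C ⇔
    (Σ Class λ D → Σ Transduction λ T →
    BoundedExpansion D × UniformlyAlmostWide D × C ⊆T[ T ] D))
mainTheorem4 C (T , D₀ , be , sub) = mk⇔
  (sparsify C D₀ T be sub)
  (λ (D , T′ , _ , aw , sub′) → strongly-flip-flat-transduction C D T′ aw sub′)
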